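{- $\text{WSP}_2(=,\neq)$ and $\text{WSP}_3(=,\neq)$ can be decided in time \[ O\big((k-1)^c(c(k-1)^k + kn)\big)\quad\text{and}\quad O\big(k^{2c}(c(k-1)^k + kn)\big), \] respectively, where $c$ is the number of constraints, $n$ the number of users and $k$ the number of steps in the workflow instance.
   Context: A workflow specification is a directed acyclic graph $(S,E)$, where $S$ is a set of steps and $E\subseteq S\times S$. A constrained workflow authorization schema is a tuple $((S,E),U,A,C)$, where $(S,E)$ is a workflow specification, $U$ is a set of users, $A\subseteq S\times U$ is an authorization policy (user $u$ is authorized for step $s$ iff $(s,u)\in A$), and $C$ is a set of workflow constraints. It is assumed that for every $s\in S$ there is some $u\in U$ with $(s,u)\in A$. A workflow constraint has the form $(\rho,S_1,S_2)$ with $S_1,S_2\subseteq S$ and $\rho\subseteq U\times U$. A plan is a function $\pi:S\to U$. It is authorized if $(s,\pi(s))\in A$ for all $s\in S$. It satisfies the constraint $(\rho,S_1,S_2)$ if there exist $s_1\in S_1$ and $s_2\in S_2$ with $(\pi(s_1),\pi(s_2))\in\rho$. It is valid if it is authorized and satisfies all constraints in $C$. The Workflow Satisfiability Problem (WSP): given a constrained workflow authorization schema, find a valid plan or answer that none exists. The order on steps plays no role. A constraint $(\rho,S_1,S_2)$ is of Type 1 if $S_1$ and $S_2$ are both singletons, of Type 2 if at least one of $S_1,S_2$ is a singleton, and of Type 3 if $S_1,S_2$ are arbitrary sets. The symbol $=$ denotes the diagonal relation $\Delta=\{(u,u):u\in U\}$ and $\neq$ denotes its complement in $U\times U$. $\text{WSP}_i(=,\neq)$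 is the special case of WSP in which every constraint has the form $(\rho,S',S'')$ with $\rho\in\{=,\neq\}$, $S',S''\subseteq S$, and there are no constraints of Type $j$ for $j>i$ (so $\text{WSP}_2$ allows constraints of Types 1 and 2, and $\text{WSP}_3$ allows arbitrary sets $S',S''$).
   Formalization: The time bounds are asserted only for workflows with k ≥ 2 steps: for k = 1 and c > 0 the printed bound for WSP_2 is 0, which no running time meets; correctness and termination are still shown for every k. -}

module Defs where

open import Data.Bool.Base using (if_then_else_)
open import Data.Bool.Properties using () renaming (_≟_ to _≟ᵇ_)
open import Data.Fin.Base using (Fin; toℕ)
open import Data.Fin.Subset using (Subset; Side; inside; outside; _∈_; ⁅_⁆; ∁)
open import Data.List.Base using (List; []; _∷_; _++_; length; concatMap)
open import Data.List.Relation.Unary.All using (All)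
open import Data.List.Relation.Unary.Unique.Propositional using (Unique)
open import Data.Nat.Base using (ℕ; zero; suc; _+_; _∸_; _*_; _≤_; _≡ᵇ_)
open import Data.Product.Base using (Σ-syntax; ∃; ∃₂; ∃-syntax; _×_)
open import Data.Sum.Base using (_⊎_)
open import Data.Vec.Base using (Vec; lookup; map; tabulate; toList)
open import Data.Vec.Properties using (≡-dec)
open import Relation.Binary.Construct.Closure.Transitive using (TransClosure)
open import Relation.Binary.Definitions using (DecidableEquality)
open import Relation.Binary.PropositionalEquality.Core using (_≡_; _≢_)
open import Relation.Nullary using (¬_; does)

private
  variable
    k n : ℕ

------------------------------------------------------------------------
-- Workflow authorization schemas with steps Fin k and users Fin n

-- Subsets of Fin m × Fin n, so that propositional equality is extensional.
FinRel : ℕ → ℕ → Set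
FinRel m n = Vec (Subset n) m

Related : ∀ {m n} → FinRel m n → Fin m → Fin n → Set
Related R i j = j ∈ lookup R i

Δ : ∀ n → FinRel n n
Δ n = tabulate ⁅_⁆

Δᶜ : ∀ n → FinRel n n
Δᶜ n = map ∁ (Δ n)

record Constraint (k n : ℕ) : Set where
  constructor ⟨_,_,_⟩
  field
    ρ  : FinRel n n
    S₁ : Subset k
    S₂ : Subset k

record Schema (k n : ℕ) : Set where
  field
    E          : FinRel k k
    acyclic    : ∀ s → ¬ TransClosure (Related E) s s
    A          : FinRel k n
    authorized : ∀ s → ∃[ u ] Related A s u
    -- The set of constraints, listed without repetition.
    C          : List (Constraint k n)
    C-unique   : Unique C

  #C : ℕ
  #C = length C

Plan : ℕ → ℕ → Set
Plan k n = Fin k → Fin n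

Authorized : Schema k n → Plan k n → Set
Authorized W π = ∀ s → Related (Schema.A W) s (π s)

Satisfies : Plan k n → Constraint k n → Set
Satisfies π ⟨ ρ , S₁ , S₂ ⟩ =
  ∃₂ λ s₁ s₂ → s₁ ∈ S₁ × s₂ ∈ S₂ × Related ρ (π s₁) (π s₂)

Valid : Schema k n → Plan k n → Set
Valid W π = Authorized W π × All (Satisfies π) (Schema.C W)

IsSingleton : Subset k → Set
IsSingleton X = ∃[ s ] X ≡ ⁅ s ⁆

Type₂ : Constraint k n → Set
Type₂ ⟨ _ , S₁ , S₂ ⟩ = IsSingleton S₁ ⊎ IsSingleton S₂

EqNeq : Constraint k n → Set
EqNeq {n = n} ⟨ ρ , _ , _ ⟩ = ρ ≡ Δ n ⊎ ρ ≡ Δᶜ n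

SchemaClass : Set₁
SchemaClass = ∀ {k n} → Schema k n → Set

-- Types are cumulative: a Type 1 constraint is also of Type 2, and every
-- constraint is of Type 3.
WSP₂[=,≠] : SchemaClass
WSP₂[=,≠] W = All (λ c → EqNeq c × Type₂ c) (Schema.C W)

WSP₃[=,≠] : SchemaClass
WSP₃[=,≠] W = All EqNeq (Schema.C W)

------------------------------------------------------------------------
-- A random access machine: structured programs over ℕ-valued registers,
-- ℕ-indexed memory and a read-only random access input.  Running time is
-- the uniform cost measure.  The only arithmetic is addition and truncated
-- subtraction: with unit-cost multiplication (and hence fast-growing words)
-- the measure would be unreasonable.

record State : Set where
  constructor ⟪_,_⟫
  field
    reg : ℕ → ℕ
    mem : ℕ → ℕ
open State public

initial : State
initial = ⟪ (λ _ → 0) , (λ _ → 0) ⟫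

_[_↦_] : (ℕ → ℕ) → ℕ → ℕ → (ℕ → ℕ)
(f [ i ↦ v ]) j = if j ≡ᵇ i then v else f j

infixl 6 _⊕_ _⊖_

data Exp : Set where
  lit     : ℕ → Exp
  var     : ℕ → Exp
  _⊕_ _⊖_ : Exp → Exp → Exp
  load    : Exp → Exp
  input   : Exp → Exp

infix  5 _≔_
infixr 4 _⨾_

data Program : Set where
  skip           : Program
  _≔_            : ℕ → Exp → Program
  store          : (address value : Exp) → Program
  _⨾_            : Program → Program → Program
  if_then_else′_ : Exp → Program → Program → Program
  while_loop_    : Exp → Program → Program

-- Input cells beyond the end of the input read as 0.
_at_ : List ℕ → ℕ → ℕ
[]       at _     = 0
(x ∷ _)  at zero  = x
(_ ∷ xs) at suc i = xs at i

eval : List ℕ → State → Exp → ℕ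
eval I σ (lit m)   = m
eval I σ (var x)   = reg σ x
eval I σ (a ⊕ b)   = eval I σ a + eval I σ b
eval I σ (a ⊖ b)   = eval I σ a ∸ eval I σ b
eval I σ (load a)  = mem σ (eval I σ a)
eval I σ (input a) = I at eval I σ a

cost : Exp → ℕ
cost (lit _)   = 1
cost (var _)   = 1
cost (a ⊕ b)   = suc (cost a + cost b)
cost (a ⊖ b)   = suc (cost a + cost b)
cost (load a)  = suc (cost a)
cost (input a) = suc (cost a)

-- I ⊢ p , σ ⇓ τ ⟨ t ⟩: on input I, p started in σ halts in τ after time t.
-- Tests succeed on nonzero values.
infix 3 _⊢_,_⇓_⟨_⟩

data _⊢_,_⇓_⟨_⟩ (I : List ℕ) : Program → State → State → ℕ → Set where
  ⇓skip : ∀ {σ} → I ⊢ skip , σ ⇓ σ ⟨ 1 ⟩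
  ⇓≔ : ∀ {σ x a} →
    I ⊢ x ≔ a , σ ⇓ ⟪ reg σ [ x ↦ eval I σ a ] , mem σ ⟫ ⟨ suc (cost a) ⟩
  ⇓store : ∀ {σ a b} →
    I ⊢ store a b , σ ⇓ ⟪ reg σ , mem σ [ eval I σ a ↦ eval I σ b ] ⟫
      ⟨ suc (cost a + cost b) ⟩
  ⇓⨾ : ∀ {p q σ τ υ t u} →
    I ⊢ p , σ ⇓ τ ⟨ t ⟩ → I ⊢ q , τ ⇓ υ ⟨ u ⟩ →
    I ⊢ p ⨾ q , σ ⇓ υ ⟨ t + u ⟩
  ⇓then : ∀ {a p q σ τ t} →
    eval I σ a ≢ 0 → I ⊢ p , σ ⇓ τ ⟨ t ⟩ →
    I ⊢ if a then p else′ q , σ ⇓ τ ⟨ suc (cost a + t) ⟩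
  ⇓else : ∀ {a p q σ τ t} →
    eval I σ a ≡ 0 → I ⊢ q , σ ⇓ τ ⟨ t ⟩ →
    I ⊢ if a then p else′ q , σ ⇓ τ ⟨ suc (cost a + t) ⟩
  ⇓stop : ∀ {a p σ} →
    eval I σ a ≡ 0 →
    I ⊢ while a loop p , σ ⇓ σ ⟨ suc (cost a) ⟩
  ⇓loop : ∀ {a p σ τ υ t u} →
    eval I σ a ≢ 0 → I ⊢ p , σ ⇓ τ ⟨ t ⟩ → I ⊢ while a loop p , τ ⇓ υ ⟨ u ⟩ →
    I ⊢ while a loop p , σ ⇓ υ ⟨ suc (cost a + (t + u)) ⟩

------------------------------------------------------------------------
-- Instances as machine inputs

bit : Side → ℕ
bit inside  = 1
bit outside = 0

bits : Subset n → List ℕ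
bits X = toList (map bit X)

encodeRel : ∀ {m n} → FinRel m n → List ℕ
encodeRel R = concatMap bits (toList R)

_≟ᴿ_ : ∀ {m n} → DecidableEquality (FinRel m n)
_≟ᴿ_ = ≡-dec (≡-dec _≟ᵇ_)

-- For constraints over = and ≠ a single symbol represents the relation:
-- 0 stands for = and 1 for ≠.
encodeConstraint : Constraint k n → List ℕ
encodeConstraint {n = n} ⟨ ρ , S₁ , S₂ ⟩ =
  (if does (ρ ≟ᴿ Δ n) then 0 else 1) ∷ bits S₁ ++ bits S₂

encode : Schema k n → List ℕ
encode {k} {n} W =
  k ∷ n ∷ #C ∷ encodeRel A ++ concatMap encodeConstraint C ++ encodeRel E
  where open Schema W

------------------------------------------------------------------------
-- Solving WSP within a time bound

-- The verdict is left in register 0; a plan that was found is left in memory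
-- cells 0, …, k - 1.
data Answer (W : Schema k n) (σ : State) : Set where
  plan : (π : Plan k n) → Valid W π →
         reg σ 0 ≡ 1 → (∀ s → mem σ (toℕ s) ≡ toℕ (π s)) → Answer W σ
  none : ¬ ∃ (Valid W) → reg σ 0 ≡ 0 → Answer W σ

-- One program must answer every instance of the class; K is the constant
-- hidden by O.  The time bound is asserted for k ≥ 2 only: for k = 1 an
-- expression such as (k-1)^c (c (k-1)^k + k n) vanishes as soon as c > 0,
-- and k-1 is not meaningful for k = 0.
DecidableInTime : SchemaClass → (bound : (c n k : ℕ) → ℕ) → Set
DecidableInTime P bound =
  Σ[ p ∈ Program ] Σ[ K ∈ ℕ ]
    (∀ {k n} (W : Schema k n) → P W →
      Σ[ σ ∈ State ] Σ[ t ∈ ℕ ]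
        (encode W ⊢ p , initial ⇓ σ ⟨ t ⟩)
        × Answer W σ
        × (2 ≤ k → t ≤ K * bound (Schema.#C W) n k))

{-# OPTIONS --safe #-}
-- One program serves both classes.  Whether a plan satisfies the constraints
-- depends only on its pattern of equalities, hence on the weak order of the
-- steps that its values induce.  All weak orders can be tried: there are at most
-- 2ᵏ k! of them, and 2ᵏ k! k² = O((k - 1)ᵏ) as (1 + 1/m)ᵐ ≥ 9/4.  For a given weak order the
-- classes are served from the lowest to the highest, each receiving the first
-- authorised user not taken yet.  If a valid plan π induces the weak order, then
-- no class is ever served a user above its π-value, so every class is served.
-- A class only has to look at the first k users authorised for all its steps.
-- These are tabulated beforehand for all 2ᵏ sets of steps: a user whose own
-- set of steps already has k users is skipped, so that O(kn) time plus
-- O(2ᵏ k) table updates of cost O(2ᵏ k) suffice.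
module Submission where

open import Data.Bool.Base using (Bool; true; false; if_then_else_; T; not; _∧_)
open import Data.Bool.Properties using (T-≡; T-∧)
open import Data.Empty using (⊥-elim)
open import Data.Fin.Base using (Fin; toℕ; fromℕ<) renaming (zero to fzero; suc to fsuc)
open import Data.Fin.Properties using (pigeonhole; toℕ<n; toℕ-fromℕ<; toℕ-injective)
open import Data.Fin.Subset using (Subset; inside; outside; _∈_; ⁅_⁆; ∁)
open import Data.Fin.Subset.Properties using (x∈⁅x⁆; x∈⁅y⁆⇒x≡y; x∈∁p⇒x∉p; x∉p⇒x∈∁p)
open import Data.List.Base using (List; []; _∷_; _++_; length; concatMap)
open import Data.List.Properties using (++-assoc)
open import Data.List.Relation.Unary.All as All using (All; []; _∷_)
open import Data.Nat.Base
open import Data.Nat.DivMod using (_%_; [m+kn]%n≡m%n; m<n⇒m%n≡m)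
open import Data.Nat.Properties
open import Data.Nat.Tactic.RingSolver using (solve-∀)
open import Data.Product.Base using (Σ-syntax; _×_; _,_; proj₁; proj₂; ∃-syntax)
open import Data.Sum.Base using (_⊎_; inj₁; inj₂)
open import Data.Unit.Base using (tt)
open import Data.Vec.Base using ([]; _∷_; lookup)
open import Data.Vec.Properties using (lookup-map; lookup∘tabulate; []=⇒lookup; lookup⇒[]=)
open import Defs
open import Function.Bundles using (Equivalence)
open import Relation.Binary.Definitions using (tri<; tri≈; tri>)
open import Relation.Binary.PropositionalEquality hiding (J)
open import Relation.Nullary using (¬_; yes; no; does)

-- A LOOP language: registers, eight arrays, and counted loops only, so that
-- running a command and timing it are total functions.

-- The program spends less than either bound allows: for `2 ≤ k` the factors (k - 1)^c and k^(2c)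
-- are at least 1, so it suffices to stay within O(c (k - 1)^k + k n). This budget shapes the
-- program. The term k n leaves O(k) time per user, so the table cannot be visited for every user; a
-- visit is paid for by the entry that it adds, and the resulting 4^k k^2 is at most twice 2^k k!
-- k^2. The term c (k - 1)^k vanishes for c = 0, so instances without constraints bypass table and
-- search alike. A candidate may take time O(c k^2), so the marks on taken users must never need
-- clearing. Looking at k users per class suffices because fewer than k classes were served before:
-- if all k users were taken, two of them would have been taken by the same class. Skipping a user
-- whose own row is full is harmless because everyone in that row may also do any smaller set of
-- steps, so the rows of all those sets are full as well. The machine cannot multiply; hence powers,
-- counts and offsets arise from repeated addition.

infixl 6 _⊞_ _⊟_

data Ex : Set where
  num     : ℕ → Ex
  rg      : ℕ → Ex
  _⊞_ _⊟_ : Ex → Ex → Ex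
  _⟦_⟧    : ℕ → Ex → Ex
  inp     : Ex → Ex

infix  5 _:=_ _⟦_⟧:=_
infixr 4 _▹_

data Cmd : Set where
  nop          : Cmd
  _:=_         : ℕ → Ex → Cmd
  _⟦_⟧:=_      : ℕ → Ex → Ex → Cmd
  _▹_          : Cmd → Cmd → Cmd
  iff          : Ex → Cmd → Cmd → Cmd
  for_upto_⟲_ : (x b : ℕ) → Cmd → Cmd

record Store : Set where
  constructor _∥_
  field
    rv : ℕ → ℕ
    ar : ℕ → ℕ → ℕ
open Store public

setR : ℕ → ℕ → Store → Store
setR x v s = (rv s [ x ↦ v ]) ∥ ar s

setA : ℕ → ℕ → ℕ → Store → Store
setA a i v s = rv s ∥ λ b → if b ≡ᵇ a then ar s a [ i ↦ v ] else ar s b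

nz : ℕ → Bool
nz zero    = false
nz (suc _) = true

repeat : (ℕ → Store → Store) → ℕ → Store → Store
repeat f zero    s = s
repeat f (suc n) s = f n (repeat f n s)

-- Compilation to the random access machine

dbl : ℕ → ℕ
dbl x = x + x

-- Three doublings stand in for the missing multiplication by 8. The eight copies of `e` in `octₑ e`
-- make an array access dearer by a constant factor only.
oct : ℕ → ℕ
oct x = dbl (dbl (dbl x))

dblₑ octₑ : Exp → Exp
dblₑ e = e ⊕ e
octₑ e = dblₑ (dblₑ (dblₑ e))

-- Cell i of array a lives at address 8 i + a.
addr : ℕ → ℕ → ℕ
addr a i = oct i + a

addrₑ : ℕ → Exp → Exp
addrₑ a e = octₑ e ⊕ lit a

compileₑ : Ex → Exp
compileₑ (num m)    = lit m
compileₑ (rg x)     = var x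
compileₑ (d ⊞ e)    = compileₑ d ⊕ compileₑ e
compileₑ (d ⊟ e)    = compileₑ d ⊖ compileₑ e
compileₑ (a ⟦ e ⟧)  = load (addrₑ a (compileₑ e))
compileₑ (inp e)    = input (compileₑ e)

compile : Cmd → Program
compile nop                    = skip
compile (x := e)               = x ≔ compileₑ e
compile (a ⟦ i ⟧:= e)          = store (addrₑ a (compileₑ i)) (compileₑ e)
compile (p ▹ q)                = compile p ⨾ compile q
compile (iff e p q)            = if compileₑ e then compile p else′ compile q
compile (for x upto b ⟲ p)   =
  x ≔ lit 0 ⨾ while var b ⊖ var x loop (compile p ⨾ x ≔ var x ⊕ lit 1)

costₑ : Ex → ℕ
costₑ e = cost (compileₑ e)

-- Boolean rather than inductive, so that for a concrete command the side conditions below compute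
-- and are closed by `tt`.
fresh : ℕ → Cmd → Bool
fresh y nop                  = true
fresh y (x := _)             = not (y ≡ᵇ x)
fresh y (_ ⟦ _ ⟧:= _)        = true
fresh y (p ▹ q)              = fresh y p ∧ fresh y q
fresh y (iff _ p q)          = fresh y p ∧ fresh y q
fresh y (for x upto _ ⟲ p) = not (y ≡ᵇ x) ∧ fresh y p

freshA : ℕ → Cmd → Bool
freshA c nop                  = true
freshA c (x := _)             = true
freshA c (a ⟦ _ ⟧:= _)        = not (c ≡ᵇ a)
freshA c (p ▹ q)              = freshA c p ∧ freshA c q
freshA c (iff _ p q)          = freshA c p ∧ freshA c q
freshA c (for x upto _ ⟲ p) = freshA c p

wfₑ : Ex → Bool
wfₑ (num m)   = true
wfₑ (rg x)    = true
wfₑ (d ⊞ e)   = wfₑ d ∧ wfₑ e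
wfₑ (d ⊟ e)   = wfₑ d ∧ wfₑ e
wfₑ (a ⟦ e ⟧) = (a <ᵇ 8) ∧ wfₑ e
wfₑ (inp e)   = wfₑ e

-- The compiled loop tests `b ∸ x` anew in each round, whereas `run` fixes the number of rounds at
-- entry. The two agree if the body assigns neither the counter nor the bound.
wf : Cmd → Bool
wf nop                  = true
wf (x := e)             = wfₑ e
wf (a ⟦ i ⟧:= e)        = (a <ᵇ 8) ∧ (wfₑ i ∧ wfₑ e)
wf (p ▹ q)              = wf p ∧ wf q
wf (iff e p q)          = wfₑ e ∧ (wf p ∧ wf q)
wf (for x upto b ⟲ p) = not (b ≡ᵇ x) ∧ (fresh x p ∧ (fresh b p ∧ wf p))

-- The time of the last j rounds, from round i on, of a loop whose i-th body
-- takes time c i.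
loopTime : (ℕ → ℕ) → ℕ → ℕ → ℕ
-- A test of `var b ⊖ var x` takes 1 + 3 steps, whether it fails or succeeds; in a successful round
-- the increment of the counter takes another 1 + 3.
loopTime c i zero    = 4
loopTime c i (suc j) = suc (3 + ((c i + 4) + loopTime c (suc i) j))

∧-split : ∀ {a b} → T (a ∧ b) → T a × T b
∧-split = Equivalence.to T-∧

not-T : ∀ {b} → T (not b) → b ≡ false
not-T {false} _ = refl

≡ᵇ-refl : ∀ x → (x ≡ᵇ x) ≡ true
≡ᵇ-refl zero    = refl
≡ᵇ-refl (suc x) = ≡ᵇ-refl x

≢⇒≡ᵇ-false : ∀ {x y} → x ≢ y → (x ≡ᵇ y) ≡ false
≢⇒≡ᵇ-false {x} {y} x≢y with x ≡ᵇ y in eq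
... | true  = ⊥-elim (x≢y (≡ᵇ⇒≡ x y (Equivalence.from T-≡ eq)))
... | false = refl

get-set : ∀ (f : ℕ → ℕ) x v → (f [ x ↦ v ]) x ≡ v
get-set f x v rewrite ≡ᵇ-refl x = refl

get-set-≢ : ∀ (f : ℕ → ℕ) {x y} v → y ≢ x → (f [ x ↦ v ]) y ≡ f y
get-set-≢ f v y≢x rewrite ≢⇒≡ᵇ-false y≢x = refl

get-set-fresh : ∀ (f : ℕ → ℕ) x y v → T (not (y ≡ᵇ x)) → (f [ x ↦ v ]) y ≡ f y
get-set-fresh f x y v h rewrite not-T h = refl

nz-≢0 : ∀ {m} → m ≢ 0 → nz m ≡ true
nz-≢0 {zero}  h = ⊥-elim (h refl)
nz-≢0 {suc m} h = refl

nz-0 : ∀ {m} → m ≡ 0 → nz m ≡ false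
nz-0 refl = refl

nz⁻¹ : ∀ {m} → nz m ≡ true → m ≢ 0
nz⁻¹ {suc m} _ ()

nz-false⁻¹ : ∀ {m} → nz m ≡ false → m ≡ 0
nz-false⁻¹ {zero} _ = refl

oct≡ : ∀ i → oct i ≡ i * 8
oct≡ = eight
  where
  eight : ∀ i → ((i + i) + (i + i)) + ((i + i) + (i + i)) ≡ i * 8
  eight = solve-∀

addr-mod : ∀ {a} i → a < 8 → addr a i % 8 ≡ a
addr-mod {a} i a<8 = begin
  (oct i + a) % 8    ≡⟨ cong (λ z → z % 8) (trans (+-comm (oct i) a) (cong (a +_) (oct≡ i))) ⟩
  (a + i * 8) % 8    ≡⟨ [m+kn]%n≡m%n a i 8 ⟩
  a % 8              ≡⟨ m<n⇒m%n≡m a<8 ⟩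
  a                  ∎
  where open ≡-Reasoning

-- The remainder modulo 8 recovers the array, after which the cell is found by cancellation.
addr-injective : ∀ {a b i j} → a < 8 → b < 8 → addr a i ≡ addr b j → a ≡ b × i ≡ j
addr-injective {a} {b} {i} {j} a<8 b<8 eq with trans (sym (addr-mod i a<8)) (trans (cong (_% 8) eq) (addr-mod j b<8))
... | refl = refl , *-cancelʳ-≡ i j 8 (trans (sym (oct≡ i)) (trans (+-cancelʳ-≡ a (oct i) (oct j) eq) (oct≡ j)))

addr-≡ᵇ : ∀ {a b i j} → a < 8 → b < 8 → (addr a i ≡ᵇ addr b j) ≡ (a ≡ᵇ b) ∧ (i ≡ᵇ j)
addr-≡ᵇ {a} {b} {i} {j} a<8 b<8 with a ≟ b
... | no a≢b rewrite ≢⇒≡ᵇ-false a≢b =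
  ≢⇒≡ᵇ-false (λ eq → a≢b (proj₁ (addr-injective {i = i} {j} a<8 b<8 eq)))
... | yes refl rewrite ≡ᵇ-refl a with i ≟ j
...   | yes refl = trans (≡ᵇ-refl (addr a i)) (sym (≡ᵇ-refl i))
...   | no i≢j rewrite ≢⇒≡ᵇ-false i≢j =
  ≢⇒≡ᵇ-false (λ eq → i≢j (proj₂ (addr-injective {i = i} {j} a<8 b<8 eq)))

-- Semantics, simulation and running time of the LOOP language

module Semantics (I : List ℕ) where

  ev : Store → Ex → ℕ
  ev s (num m)   = m
  ev s (rg x)    = rv s x
  ev s (d ⊞ e)   = ev s d + ev s e
  ev s (d ⊟ e)   = ev s d ∸ ev s e
  ev s (a ⟦ e ⟧) = ar s a (ev s e)
  ev s (inp e)   = I at ev s e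

  run : Cmd → Store → Store
  run nop s                  = s
  run (x := e) s             = setR x (ev s e) s
  run (a ⟦ i ⟧:= e) s        = setA a (ev s i) (ev s e) s
  run (p ▹ q) s              = run q (run p s)
  run (iff e p q) s          = if nz (ev s e) then run p s else run q s
  run (for x upto b ⟲ p) s =
    setR x (rv s b) (repeat (λ i t → run p (setR x i t)) (rv s b) s)

  tm : Cmd → Store → ℕ
  tm nop s                  = 1
  tm (x := e) s             = suc (costₑ e)
  tm (a ⟦ i ⟧:= e) s        = suc (cost (addrₑ a (compileₑ i)) + costₑ e)
  tm (p ▹ q) s              = tm p s + tm q (run p s)
  tm (iff e p q) s          = suc (costₑ e + (if nz (ev s e) then tm p s else tm q s))
  tm (for x upto b ⟲ p) s =
    2 + loopTime (λ i → tm p (setR x i (repeat (λ j t → run p (setR x j t)) i s))) 0 (rv s b)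

  -- With an explicit motive `Q`, nested conditionals are split without a `with` that would unfold
  -- the commands inside them.
  run-iff : ∀ {ℓ} (Q : Store → Set ℓ) {e p q} s →
    (ev s e ≢ 0 → Q (run p s)) → (ev s e ≡ 0 → Q (run q s)) → Q (run (iff e p q) s)
  run-iff Q {e} s h₁ h₀ with ev s e
  ... | zero  = h₀ refl
  ... | suc _ = h₁ λ ()

  repeat-ind : ∀ {ℓ} (J : ℕ → Store → Set ℓ) f n s → J 0 s →
    (∀ i t → i < n → J i t → J (suc i) (f i t)) → J n (repeat f n s)
  repeat-ind J f zero    s j₀ step = j₀
  repeat-ind J f (suc n) s j₀ step =
    step n _ ≤-refl (repeat-ind J f n s j₀ (λ i t i<n → step i t (m≤n⇒m≤1+n i<n)))

  frame : ∀ p y → T (fresh y p) → ∀ s → rv (run p s) y ≡ rv s y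
  frame nop           y h s = refl
  frame (x := e)  y h s = get-set-fresh (rv s) x y _ h
  frame (a ⟦ i ⟧:= e) y h s = refl
  frame (p ▹ q)       y h s = let hp , hq = ∧-split h in trans (frame q y hq _) (frame p y hp s)
  frame (iff e p q)   y h s with nz (ev s e)
  ... | true  = frame p y (proj₁ (∧-split h)) s
  ... | false = frame q y (proj₂ (∧-split h)) s
  frame (for x upto b ⟲ p) y h s =
    let hx , hp = ∧-split {not (y ≡ᵇ x)} h
        f = λ i t → run p (setR x i t) in
    trans (get-set-fresh (rv (repeat f (rv s b) s)) x y _ hx)
      (repeat-ind (λ _ t → rv t y ≡ rv s y) f (rv s b) s refl
        λ i t _ eq → trans (frame p y hp _) (trans (get-set-fresh (rv t) x y i hx) eq))

  frameA : ∀ p c → T (freshA c p) → ∀ s → ar (run p s) c ≡ ar s c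
  frameA nop           c h s = refl
  frameA (x := e)      c h s = refl
  frameA (a ⟦ i ⟧:= e) c h s rewrite not-T h = refl
  frameA (p ▹ q)       c h s = let hp , hq = ∧-split h in trans (frameA q c hq _) (frameA p c hp s)
  frameA (iff e p q)   c h s with nz (ev s e)
  ... | true  = frameA p c (proj₁ (∧-split h)) s
  ... | false = frameA q c (proj₂ (∧-split h)) s
  frameA (for x upto b ⟲ p) c h s =
    repeat-ind (λ _ t → ar t c ≡ ar s c) (λ i t → run p (setR x i t)) (rv s b) s refl
      λ i t _ eq → trans (frameA p c h _) eq

  -- What a store `t` in the middle of a loop still shares with the store `s` at its entry, as far
  -- as the syntax reveals it. Loop invariants then only have to mention what does change.
  record Agree (p : Cmd) (t s : Store) : Set where
    constructor agreeing
    field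
      regs : ∀ y → T (fresh y p) → rv t y ≡ rv s y
      arrs : ∀ c → T (freshA c p) → ar t c ≡ ar s c
  open Agree public

  agree-refl : ∀ {p s} → Agree p s s
  agree-refl = agreeing (λ _ _ → refl) (λ _ _ → refl)

  agree : ∀ p s → Agree p (run p s) s
  agree p s = agreeing (λ y h → frame p y h s) (λ c h → frameA p c h s)

  agree-step : ∀ {x b p} {i s t} → Agree (for x upto b ⟲ p) t s →
    Agree (for x upto b ⟲ p) (run p (setR x i t)) s
  agree-step {x} {p = p} {i} {t = t} a = agreeing
    (λ y h → let hx , hp = ∧-split {not (y ≡ᵇ x)} h in
       trans (frame p y hp _) (trans (get-set-fresh (rv t) x y i hx) (regs a y h)))
    (λ c h → trans (frameA p c h _) (arrs a c h))

  agree-rounds : ∀ {x b p} n s →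
    Agree (for x upto b ⟲ p) (repeat (λ i t → run p (setR x i t)) n s) s
  agree-rounds {x} {b} {p} n s =
    repeat-ind (λ _ t → Agree (for x upto b ⟲ p) t s) (λ i t → run p (setR x i t)) n s agree-refl
      λ _ _ _ → agree-step

  -- J must not depend on the counter x; for concrete x and J the premise is
  -- discharged by the identity.
  for-ind : ∀ {ℓ} {x b p} (J : ℕ → Store → Set ℓ) s →
    (∀ i v t → J i t → J i (setR x v t)) → J 0 s →
    (∀ i t → i < rv s b → Agree (for x upto b ⟲ p) t s → J i t → J (suc i) (run p (setR x i t))) →
    J (rv s b) (run (for x upto b ⟲ p) s)
  for-ind {x = x} {b} {p} J s stable j₀ step =
    stable _ _ _ (proj₁ (repeat-ind (λ i t → J i t × Agree (for x upto b ⟲ p) t s)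
      (λ i t → run p (setR x i t)) (rv s b) s (j₀ , agree-refl)
      λ i t i<n (j , a) → step i t i<n a j , agree-step a))

  infix 3 _≈_
  record _≈_ (σ : State) (s : Store) : Set where
    constructor sim
    field
      reg≡ : ∀ x → reg σ x ≡ rv s x
      mem≡ : ∀ a i → a < 8 → mem σ (addr a i) ≡ ar s a i
  open _≈_ public

  eval-sound : ∀ e {σ s} → T (wfₑ e) → σ ≈ s → eval I σ (compileₑ e) ≡ ev s e
  eval-sound (num m)   h r = refl
  eval-sound (rg x)    h r = reg≡ r x
  eval-sound (d ⊞ e)   h r =
    let hd , he = ∧-split h in cong₂ _+_ (eval-sound d hd r) (eval-sound e he r)
  eval-sound (d ⊟ e)   h r =
    let hd , he = ∧-split h in cong₂ _∸_ (eval-sound d hd r) (eval-sound e he r)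
  eval-sound (a ⟦ e ⟧) {σ} h r =
    let ha , he = ∧-split h in
    trans (cong (λ z → mem σ (addr a z)) (eval-sound e he r)) (mem≡ r a _ (<ᵇ⇒< a 8 ha))
  eval-sound (inp e)   h r = cong (I at_) (eval-sound e h r)

  setR-sound : ∀ {σ s} x {v w} → v ≡ w → σ ≈ s → ⟪ reg σ [ x ↦ v ] , mem σ ⟫ ≈ setR x w s
  setR-sound {σ} {s} x {v} refl r = sim lemma (mem≡ r)
    where
    lemma : ∀ y → (reg σ [ x ↦ v ]) y ≡ (rv s [ x ↦ v ]) y
    lemma y with y ≡ᵇ x
    ... | true  = refl
    ... | false = reg≡ r y

  setA-sound : ∀ {σ s} a {i j v w} → a < 8 → i ≡ j → v ≡ w → σ ≈ s →
    ⟪ reg σ , mem σ [ addr a i ↦ v ] ⟫ ≈ setA a j w s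
  setA-sound {σ} {s} a {i} {_} {v} a<8 refl refl r = sim (reg≡ r) lemma
    where
    lemma : ∀ b j → b < 8 →
      (mem σ [ addr a i ↦ v ]) (addr b j) ≡ ar (setA a i v s) b j
    lemma b j b<8 rewrite addr-≡ᵇ {b} {a} {j} {i} b<8 a<8 with b ≡ᵇ a in eq
    ... | false = mem≡ r b j b<8
    ... | true with j ≡ᵇ i
    ...   | true  = refl
    ...   | false rewrite ≡ᵇ⇒≡ b a (Equivalence.from T-≡ eq) = mem≡ r a j b<8

  -- The derivation takes exactly the time `tm p s`, so both correctness and running time can be
  -- studied on total functions.
  compile-sound : ∀ p → T (wf p) → ∀ {σ s} → σ ≈ s →
    Σ[ τ ∈ State ] (I ⊢ compile p , σ ⇓ τ ⟨ tm p s ⟩) × τ ≈ run p s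
  compile-sound nop h r = _ , ⇓skip , r
  compile-sound (x := e) h r = _ , ⇓≔ , setR-sound x (eval-sound e h r) r
  compile-sound (a ⟦ i ⟧:= e) h r =
    let ha , h′ = ∧-split h ; hi , he = ∧-split h′ in
    _ , ⇓store , setA-sound a (<ᵇ⇒< a 8 ha) (eval-sound i hi r) (eval-sound e he r) r
  compile-sound (p ▹ q) h r =
    let hp , hq       = ∧-split h
        _ , dp , rp = compile-sound p hp r
        _ , dq , rq = compile-sound q hq rp
    in _ , ⇓⨾ dp dq , rq
  compile-sound (iff e p q) h {σ} {s} r with ∧-split h
  ... | he , h′ with nz (ev s e) in eq
  ...   | true  =
    let _ , d , r′ = compile-sound p (proj₁ (∧-split h′)) r
    in _ , ⇓then (λ z → nz⁻¹ eq (trans (sym (eval-sound e he r)) z)) d , r′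
  ...   | false =
    let _ , d , r′ = compile-sound q (proj₂ (∧-split h′)) r
    in _ , ⇓else (trans (eval-sound e he r) (nz-false⁻¹ eq)) d , r′
  compile-sound (for x upto b ⟲ p) h {σ₀} {s} r₀ with ∧-split h
  ... | b≠x , h′ with ∧-split h′
  ...   | x#p , h″ with ∧-split h″
  ...     | b#p , hp =
    let τ , d , r = rounds n 0 refl (setR-sound x refl r₀)
    in τ , ⇓⨾ ⇓≔ d , r
    where
    n = rv s b
    step : ℕ → Store → Store
    step i t = run p (setR x i t)
    body : Program
    body = compile p ⨾ x ≔ var x ⊕ lit 1
    bound : ∀ i → rv (setR x i (repeat step i s)) b ≡ n
    bound i = trans (get-set-fresh (rv (repeat step i s)) x b i b≠x)
      (repeat-ind (λ _ t → rv t b ≡ n) step i s refl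
        λ j t _ eq → trans (frame p b b#p _) (trans (get-set-fresh (rv t) x b j b≠x) eq))
    -- Here `i` rounds are done and `j` are left. As the body does not touch `x`, the increment
    -- leads from `setR x i` to `setR x (suc i)`.
    rounds : ∀ j i {σ} → i + j ≡ n → σ ≈ setR x i (repeat step i s) →
      Σ[ τ ∈ State ]
        (I ⊢ while var b ⊖ var x loop body , σ ⇓ τ
          ⟨ loopTime (λ i → tm p (setR x i (repeat step i s))) i j ⟩)
        × τ ≈ setR x n (repeat step n s)
    rounds zero i {σ} i+0≡n r with trans (sym (+-identityʳ i)) i+0≡n
    ... | refl = σ , ⇓stop test , r
      where
      test : reg σ b ∸ reg σ x ≡ 0
      test rewrite reg≡ r b | reg≡ r x | bound n | get-set (rv (repeat step n s)) x n = n∸n≡0 n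
    rounds (suc j) i {σ} i+j≡n r =
      let τ , d , rp = compile-sound p hp r
          υ , d′ , r′ = rounds j (suc i) (trans (sym (+-suc i j)) i+j≡n) (advance rp)
      in υ , ⇓loop test (⇓⨾ d ⇓≔) d′ , r′
      where
      test : reg σ b ∸ reg σ x ≢ 0
      test rewrite reg≡ r b | reg≡ r x | bound i | get-set (rv (repeat step i s)) x i
                 | sym i+j≡n | m+n∸m≡n i (suc j) = λ ()
      advance : ∀ {τ} → τ ≈ repeat step (suc i) s →
        ⟪ reg τ [ x ↦ reg τ x + 1 ] , mem τ ⟫ ≈ setR x (suc i) (repeat step (suc i) s)
      advance rp = setR-sound x
        (trans (cong (_+ 1) (trans (reg≡ rp x) (trans (frame p x x#p _) (get-set (rv (repeat step i s)) x i)))) (+-comm i 1)) rp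

  -- The 6 is the initial assignment (2) and the failing test (4); the 8 in each round is the
  -- successful test and the increment.
  tm-for : ∀ {x b p} s K →
    (∀ i t → i < rv s b → Agree (for x upto b ⟲ p) t s → tm p (setR x i t) ≤ K) →
    tm (for x upto b ⟲ p) s ≤ 6 + rv s b * (8 + K)
  tm-for {x} {b} {p} s K h = s≤s (s≤s (≤-trans (go (rv s b) 0 ≤-refl) (≤-reflexive (+-comm _ 4))))
    where
    n = rv s b
    S : ℕ → Store
    S i = repeat (λ j t → run p (setR x j t)) i s
    go : ∀ j i → i + j ≤ n → loopTime (λ i → tm p (setR x i (S i))) i j ≤ j * (8 + K) + 4
    go zero    i _ = ≤-refl
    go (suc j) i le = ≤-trans
      (+-monoʳ-≤ 4 (+-mono-≤ (+-monoˡ-≤ 4 (h i (S i) i<n (agree-rounds {x} {b} i s))) (go j (suc i) (≤-trans (≤-reflexive (sym (+-suc i j))) le))))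
      (≤-reflexive (arith K (j * (8 + K))))
      where
      i<n : i < n
      i<n = ≤-trans (s≤s (m≤m+n i j)) (≤-trans (≤-reflexive (sym (+-suc i j))) le)
      arith : ∀ K z → 4 + ((K + 4) + (z + 4)) ≡ (8 + K) + z + 4
      arith = solve-∀

  -- If all loops share one bound register, the time is at most a polynomial in its value, of degree
  -- the nesting depth. Loops nested with different bounds are timed separately.
  loopsOnly : ℕ → Cmd → Bool
  loopsOnly y nop                  = true
  loopsOnly y (_ := _)             = true
  loopsOnly y (_ ⟦ _ ⟧:= _)        = true
  loopsOnly y (p ▹ q)              = loopsOnly y p ∧ loopsOnly y q
  loopsOnly y (iff _ p q)          = loopsOnly y p ∧ loopsOnly y q
  loopsOnly y (for x upto b ⟲ p) = (b ≡ᵇ y) ∧ loopsOnly y p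

-- Polynomial time bounds read off the syntax

rawSize : Cmd → ℕ
rawSize nop                  = 1
rawSize (_ := e)             = suc (costₑ e)
rawSize (a ⟦ i ⟧:= e)        = suc (cost (addrₑ a (compileₑ i)) + costₑ e)
rawSize (p ▹ q)              = rawSize p + rawSize q
rawSize (iff e p q)          = suc (costₑ e + (rawSize p + rawSize q))
-- The constants 6 and 8 of `tm-for`, added.
rawSize (for x upto b ⟲ p) = 14 + rawSize p

-- Opaque, lest the type checker compute with unary products of sizes.
opaque
  size : Cmd → ℕ
  size = rawSize

  size-:= : ∀ x e → suc (costₑ e) ≡ size (x := e)
  size-:= x e = refl

  size-⟦⟧:= : ∀ a i e → suc (cost (addrₑ a (compileₑ i)) + costₑ e) ≡ size (a ⟦ i ⟧:= e)
  size-⟦⟧:= a i e = refl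

  size-▹ : ∀ p q → size (p ▹ q) ≡ size p + size q
  size-▹ p q = refl

depth : Cmd → ℕ
depth nop                  = 0
depth (_ := e)             = 0
depth (a ⟦ i ⟧:= e)        = 0
depth (p ▹ q)              = depth p ⊔ depth q
depth (iff e p q)          = depth p ⊔ depth q
depth (for x upto b ⟲ p) = suc (depth p)

module Timing (I : List ℕ) where
  open Semantics I

  const≤ : ∀ m B d → 1 ≤ B → m ≤ m * B ^ d
  const≤ m B d 1≤B = ≤-trans (≤-reflexive (sym (*-identityʳ m)))
    (*-monoʳ-≤ m (m^n>0 B {{>-nonZero 1≤B}} d))

  ^-monoʳ : ∀ B {d e} → 1 ≤ B → d ≤ e → B ^ d ≤ B ^ e
  ^-monoʳ B 1≤B = ^-monoʳ-≤ B {{>-nonZero 1≤B}}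

  -- Freshness of `y` keeps the bound of all loops constant throughout the run; a value of at least
  -- 1 lets lower powers be absorbed by the highest one.
  rawTm≤ : ∀ p y → T (loopsOnly y p) → T (fresh y p) → ∀ s → 1 ≤ rv s y →
    tm p s ≤ rawSize p * rv s y ^ depth p
  rawTm≤ nop y h f s 1≤ = ≤-refl
  rawTm≤ (x := e) y h f s 1≤ = const≤ (suc (costₑ e)) (rv s y) 0 1≤
  rawTm≤ (a ⟦ i ⟧:= e) y h f s 1≤ = const≤ (suc (cost (addrₑ a (compileₑ i)) + costₑ e)) (rv s y) 0 1≤
  rawTm≤ (p ▹ q) y h f s 1≤ =
    let hp , hq = ∧-split h ; fp , fq = ∧-split f ; B = rv s y
        eq = frame p y fp s
    in ≤-trans
      (+-mono-≤ {tm p s} {_} {tm q (run p s)}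
        (≤-trans (rawTm≤ p y hp fp s 1≤) (*-monoʳ-≤ (rawSize p) (^-monoʳ B 1≤ (m≤m⊔n (depth p) (depth q)))))
        (≤-trans (subst (λ z → tm q (run p s) ≤ rawSize q * z ^ depth q) eq (rawTm≤ q y hq fq _ (subst (1 ≤_) (sym eq) 1≤)))
                 (*-monoʳ-≤ (rawSize q) (^-monoʳ B 1≤ (m≤n⊔m (depth p) (depth q))))))
      (≤-reflexive (sym (*-distribʳ-+ (B ^ (depth p ⊔ depth q)) (rawSize p) (rawSize q))))
  rawTm≤ (iff e p q) y h f s 1≤ = ≤-trans
      (s≤s (+-monoʳ-≤ (costₑ e) branch))
      (≤-trans (+-monoˡ-≤ ((rawSize p + rawSize q) * X) (const≤ (suc (costₑ e)) B (depth p ⊔ depth q) 1≤))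
        (≤-reflexive (sym (*-distribʳ-+ X (suc (costₑ e)) (rawSize p + rawSize q)))))
    where
    B = rv s y
    X = B ^ (depth p ⊔ depth q)
    branch : (if nz (ev s e) then tm p s else tm q s) ≤ (rawSize p + rawSize q) * X
    branch with nz (ev s e)
    ... | true  = ≤-trans (rawTm≤ p y (proj₁ (∧-split h)) (proj₁ (∧-split f)) s 1≤)
      (*-mono-≤ (m≤m+n (rawSize p) (rawSize q)) (^-monoʳ B 1≤ (m≤m⊔n (depth p) (depth q))))
    ... | false = ≤-trans (rawTm≤ q y (proj₂ (∧-split h)) (proj₂ (∧-split f)) s 1≤)
      (*-mono-≤ (m≤n+m (rawSize q) (rawSize p)) (^-monoʳ B 1≤ (m≤n⊔m (depth p) (depth q))))
  rawTm≤ (for x upto b ⟲ p) y h f s 1≤ with ∧-split {b ≡ᵇ y} h | ∧-split {not (y ≡ᵇ x)} f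
  ... | b≡y , hp | y≠x , fp with ≡ᵇ⇒≡ b y b≡y
  ...   | refl = ≤-trans
      (tm-for {x} {b} {p} s (rawSize p * B ^ depth p) λ i t _ a →
        let eq = trans (get-set-fresh (rv t) x b i y≠x) (regs a b (Equivalence.from (T-∧ {not (b ≡ᵇ x)}) (y≠x , fp))) in
        subst (λ z → tm p (setR x i t) ≤ rawSize p * z ^ depth p) eq (rawTm≤ p b hp fp _ (subst (1 ≤_) (sym eq) 1≤)))
      (≤-trans (+-mono-≤ (*-monoʳ-≤ 6 (m^n>0 B {{>-nonZero 1≤}} (suc (depth p))))
                         (*-monoʳ-≤ B (+-monoˡ-≤ (rawSize p * B ^ depth p) (const≤ 8 B (depth p) 1≤))))
        (≤-reflexive (arith B (B ^ depth p) (rawSize p))))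
    where
    B = rv s b
    arith : ∀ B X z → 6 * (B * X) + B * (8 * X + z * X) ≡ (14 + z) * (B * X)
    arith = solve-∀

  opaque
    unfolding size

    tm≤ : ∀ p y → T (loopsOnly y p) → T (fresh y p) → ∀ s → 1 ≤ rv s y →
      tm p s ≤ size p * rv s y ^ depth p
    tm≤ = rawTm≤

-- Numerical bounds

-- weakOrders k = 2ᵏ k! counts the digit vectors that encode weak orders.
weakOrders : ℕ → ℕ
weakOrders zero    = 1
weakOrders (suc s) = suc s * (weakOrders s + weakOrders s)

weakOrders>0 : ∀ s → 0 < weakOrders s
weakOrders>0 zero    = s≤s z≤n
weakOrders>0 (suc s) = ≤-trans (weakOrders>0 s) (≤-trans (m≤m+n _ _) (m≤m+n _ _))

n≤n*n : ∀ n → n ≤ n * n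
n≤n*n zero    = z≤n
n≤n*n (suc n) = m≤m*n (suc n) (suc n)

-- The first three terms of the binomial expansion of (a + 1)^j, for a = b + 1.
binomial-≤ : ∀ b j → suc b ^ j * (2 * (suc b * suc b) + (b + suc b) * j + j * j)
                     ≤ 2 * (suc b * suc b) * (2 + b) ^ j
binomial-≤ b zero    = ≤-reflexive (base b)
  where
  base : ∀ b → 1 * (2 * (suc b * suc b) + (b + suc b) * 0 + 0) ≡ 2 * (suc b * suc b) * 1
  base = solve-∀
binomial-≤ b (suc j) = begin
  suc b * A * (2 * (suc b * suc b) + (b + suc b) * suc j + suc j * suc j)
    ≡⟨ split A b j ⟩
  A * (suc b * X + (2 * (suc b * suc b) + (b + suc b) * j + j))
    ≤⟨ *-monoʳ-≤ A (+-monoʳ-≤ (suc b * X) (+-monoʳ-≤ (2 * (suc b * suc b) + (b + suc b) * j) (n≤n*n j))) ⟩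
  A * (suc b * X + X)
    ≡⟨ collect A b X ⟩
  (2 + b) * (A * X)
    ≤⟨ *-monoʳ-≤ (2 + b) (binomial-≤ b j) ⟩
  (2 + b) * (2 * (suc b * suc b) * (2 + b) ^ j)
    ≡⟨ swap b ((2 + b) ^ j) ⟩
  2 * (suc b * suc b) * ((2 + b) * (2 + b) ^ j) ∎
  where
  open ≤-Reasoning
  A = suc b ^ j
  X = 2 * (suc b * suc b) + (b + suc b) * j + j * j
  split : ∀ A b j → suc b * A * (2 * (suc b * suc b) + (b + suc b) * suc j + suc j * suc j)
    ≡ A * (suc b * (2 * (suc b * suc b) + (b + suc b) * j + j * j)
           + (2 * (suc b * suc b) + (b + suc b) * j + j))
  split = solve-∀
  collect : ∀ A b X → A * (suc b * X + X) ≡ (2 + b) * (A * X)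
  collect = solve-∀
  swap : ∀ b Y → (2 + b) * (2 * (suc b * suc b) * Y) ≡ 2 * (suc b * suc b) * ((2 + b) * Y)
  swap = solve-∀

-- The binomial bound for 8 + 1, of which only the summand m^2 is kept; 128 is 2 · 8^2.
square-≤ : ∀ m → 8 ^ m * (m * m) ≤ 128 * 9 ^ m
square-≤ m = ≤-trans (*-monoʳ-≤ (8 ^ m) (m≤n+m (m * m) (128 + 15 * m))) (binomial-≤ 7 m)

-- The binomial bound for (1 + 1/a)^a gives 1 + 1 + (a - 1)/(2a) = 5/2 - 1/(2a), which reaches 9/4
-- from a = 2 on.
nine-quarters-≤ : ∀ b → 9 * (2 + b) ^ (2 + b) ≤ 4 * (3 + b) ^ (2 + b)
nine-quarters-≤ b = *-cancelʳ-≤ (9 * Y) (4 * Z) (a * a) (begin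
  9 * Y * (a * a)               ≤⟨ m≤m+n _ _ ⟩
  9 * Y * (a * a) + Y * (a * b) ≡⟨ split Y b ⟩
  2 * (Y * (2 * (a * a) + (suc b + a) * a + a * a)) ≤⟨ *-monoʳ-≤ 2 (binomial-≤ (suc b) a) ⟩
  2 * (2 * (a * a) * Z)         ≡⟨ swap a Z ⟩
  4 * Z * (a * a)               ∎)
  where
  open ≤-Reasoning
  a = 2 + b
  Y = a ^ a
  Z = suc a ^ a
  split : ∀ Y b → 9 * Y * ((2 + b) * (2 + b)) + Y * ((2 + b) * b)
    ≡ 2 * (Y * (2 * ((2 + b) * (2 + b)) + (suc b + (2 + b)) * (2 + b) + (2 + b) * (2 + b)))
  split = solve-∀
  swap : ∀ a Z → 2 * (2 * (a * a) * Z) ≡ 4 * Z * (a * a)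
  swap = solve-∀

-- From m to m + 1 the count grows by 2 (m + 1) and m^m by (m + 1)(1 + 1/m)^m, which is at least 9/4
-- (m + 1), so their quotient gains a factor of at most 8/9. As this needs m ≥ 2, the cases 1 and 2
-- are computed; the second asks for a constant of at least 81/32, whence the 3.
weakOrders-≤ : ∀ b → 9 ^ suc b * weakOrders (suc b) ≤ 3 * 8 ^ suc b * suc b ^ suc b
weakOrders-≤ zero          = ≤ᵇ⇒≤ 18 24 _
weakOrders-≤ (suc zero)    = ≤ᵇ⇒≤ 648 768 _
weakOrders-≤ (suc (suc b)) = begin
  9 * N * (suc m * (V + V))     ≡⟨ e₁ N V m ⟩
  18 * suc m * (N * V)          ≤⟨ *-monoʳ-≤ (18 * suc m) (weakOrders-≤ (suc b)) ⟩
  18 * suc m * (3 * E * Y)      ≡⟨ e₂ E Y m ⟩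
  6 * E * suc m * (9 * Y)       ≤⟨ *-monoʳ-≤ (6 * E * suc m) (nine-quarters-≤ b) ⟩
  6 * E * suc m * (4 * Z)       ≡⟨ e₃ E Z m ⟩
  3 * (8 * E) * (suc m * Z)     ∎
  where
  open ≤-Reasoning
  m = 2 + b
  N = 9 ^ m
  V = weakOrders m
  E = 8 ^ m
  Y = m ^ m
  Z = suc m ^ m
  e₁ : ∀ N V m → 9 * N * (suc m * (V + V)) ≡ 18 * suc m * (N * V)
  e₁ = solve-∀
  e₂ : ∀ E Y m → 18 * suc m * (3 * E * Y) ≡ 6 * E * suc m * (9 * Y)
  e₂ = solve-∀
  e₃ : ∀ E Z m → 6 * E * suc m * (4 * Z) ≡ 3 * (8 * E) * (suc m * Z)
  e₃ = solve-∀

-- The geometric surplus (8/9)^m swallows m^2 by `square-≤`; 384 is 3 · 128.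
weakOrders*square-≤ : ∀ b → weakOrders (suc b) * (suc b * suc b) ≤ 384 * suc b ^ suc b
weakOrders*square-≤ b = *-cancelˡ-≤ N {{m^n≢0 9 m}} (begin
  N * (V * (m * m))         ≡⟨ sym (*-assoc N V (m * m)) ⟩
  N * V * (m * m)           ≤⟨ *-monoˡ-≤ (m * m) (weakOrders-≤ b) ⟩
  3 * E * Y * (m * m)       ≡⟨ e₁ E Y (m * m) ⟩
  3 * Y * (E * (m * m))     ≤⟨ *-monoʳ-≤ (3 * Y) (square-≤ m) ⟩
  3 * Y * (128 * N)         ≡⟨ e₂ Y N ⟩
  N * (384 * Y)             ∎)
  where
  open ≤-Reasoning
  m = suc b
  N = 9 ^ m
  V = weakOrders m
  E = 8 ^ m
  Y = m ^ m
  e₁ : ∀ E Y q → 3 * E * Y * q ≡ 3 * Y * (E * q)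
  e₁ = solve-∀
  e₂ : ∀ Y N → 3 * Y * (128 * N) ≡ N * (384 * Y)
  e₂ = solve-∀

-- For k = m + 1 the target is m · m^m. The estimate m + 1 ≤ 2m is used three times and `weakOrders`
-- brings one more factor 2, so the constant is 16 · 384.
weakOrders-bound : ∀ {k} → 2 ≤ k → weakOrders k * (k * k) ≤ 6144 * (k ∸ 1) ^ k
weakOrders-bound {suc zero} (s≤s ())
weakOrders-bound {suc (suc b)} _ = begin
  suc m * (V + V) * (suc m * suc m)              ≤⟨ *-mono-≤ (*-monoˡ-≤ (V + V) m+1≤2m) (*-mono-≤ m+1≤2m m+1≤2m) ⟩
  (m + m) * (V + V) * ((m + m) * (m + m))        ≡⟨ e₁ m V ⟩
  16 * m * (V * (m * m))                         ≤⟨ *-monoʳ-≤ (16 * m) (weakOrders*square-≤ b) ⟩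
  16 * m * (384 * m ^ m)                         ≡⟨ e₂ m (m ^ m) ⟩
  6144 * (m * m ^ m)                             ∎
  where
  open ≤-Reasoning
  m = suc b
  V = weakOrders m
  m+1≤2m : suc m ≤ m + m
  m+1≤2m = s≤s (≤-trans (≤-reflexive (+-comm 1 b)) (+-monoʳ-≤ b (s≤s z≤n)))
  e₁ : ∀ m V → (m + m) * (V + V) * ((m + m) * (m + m)) ≡ 16 * m * (V * (m * m))
  e₁ = solve-∀
  e₂ : ∀ m Y → 16 * m * (384 * Y) ≡ 6144 * (m * Y)
  e₂ = solve-∀

-- This lets the search term pay for the table. From k = 1 on, a step multiplies the left side by 4
-- and the right side by at least 4.
4^-≤-weakOrders : ∀ k → 2 ^ k * 2 ^ k ≤ 2 * weakOrders k
4^-≤-weakOrders zero          = s≤s z≤n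
4^-≤-weakOrders (suc zero)    = ≤-refl
4^-≤-weakOrders (suc (suc k)) = begin
  2 * P * (2 * P)            ≡⟨ e₁ P ⟩
  4 * (P * P)                ≤⟨ *-monoʳ-≤ 4 (4^-≤-weakOrders (suc k)) ⟩
  4 * (2 * V)                ≤⟨ m≤m+n _ _ ⟩
  4 * (2 * V) + k * (4 * V)  ≡⟨ e₂ k V ⟩
  2 * ((2 + k) * (V + V))    ∎
  where
  open ≤-Reasoning
  P = 2 ^ suc k
  V = weakOrders (suc k)
  e₁ : ∀ P → 2 * P * (2 * P) ≡ 4 * (P * P)
  e₁ = solve-∀
  e₂ : ∀ k V → 4 * (2 * V) + k * (4 * V) ≡ 2 * ((2 + k) * (V + V))
  e₂ = solve-∀

-- Masks, rows and weak orders

-- How an invariant about all `u` below the counter survives one more round.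
<suc-elim : ∀ {ℓ} m (Q : ℕ → Set ℓ) → (∀ u → u < m → Q u) → Q m → ∀ u → u < suc m → Q u
<suc-elim m Q h q u u< with m≤n⇒m<n∨m≡n (s≤s⁻¹ u<)
... | inj₁ u<m  = h u u<m
... | inj₂ refl = q

mask : (ℕ → Bool) → ℕ → ℕ
mask b zero    = 0
mask b (suc s) = (if b s then 2 ^ s else 0) + mask b s

mask< : ∀ b s → mask b s < 2 ^ s
mask< b zero    = s≤s z≤n
mask< b (suc s) = ≤-trans (+-mono-≤-< (bit≤ (b s)) (mask< b s)) (≤-reflexive (sym (cong (2 ^ s +_) (+-identityʳ (2 ^ s)))))
  where
  bit≤ : ∀ c → (if c then 2 ^ s else 0) ≤ 2 ^ s
  bit≤ true  = ≤-refl
  bit≤ false = z≤n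

count : (ℕ → Bool) → ℕ → ℕ
count g zero    = 0
count g (suc u) = (if g u then 1 else 0) + count g u

count-mono : ∀ g {u v} → u ≤ v → count g u ≤ count g v
count-mono g {u} {v} u≤v with m≤n⇒m<n∨m≡n u≤v
count-mono g {u} {suc v} u≤v | inj₁ (s≤s u≤v′) = ≤-trans (count-mono g u≤v′) (m≤n+m _ _)
... | inj₂ refl = ≤-refl

count-strict : ∀ g {u v} → g u ≡ true → u < v → count g u < count g v
count-strict g {u} {v} gu u<v = ≤-trans (≤-reflexive step) (count-mono g u<v)
  where
  step : suc (count g u) ≡ count g (suc u)
  step rewrite gu = refl

count-nth : ∀ g U {e} → e < count g U → ∃[ u ] u < U × g u ≡ true × count g u ≡ e
count-nth g (suc U) {e} e< with g U in eq
... | false = let u , u<U , gu , c = count-nth g U e< in u , m≤n⇒m≤1+n u<U , gu , c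
... | true with e ≟ count g U
...   | yes e≡ = U , ≤-refl , eq , sym e≡
...   | no e≢ =
  let u , u<U , gu , c = count-nth g U (≤∧≢⇒< (s≤s⁻¹ e<) e≢) in u , m≤n⇒m≤1+n u<U , gu , c

count-⊆ : ∀ g h U → (∀ u → u < U → g u ≡ true → h u ≡ true) → count g U ≤ count h U
count-⊆ g h zero    sub = z≤n
count-⊆ g h (suc U) sub with g U in eq
... | false = ≤-trans (count-⊆ g h U (λ u u<U → sub u (m≤n⇒m≤1+n u<U))) (m≤n+m _ _)
... | true rewrite sub U ≤-refl eq = s≤s (count-⊆ g h U (λ u u<U → sub u (m≤n⇒m≤1+n u<U)))

sumTo : (ℕ → ℕ) → ℕ → ℕ
sumTo f zero    = 0
sumTo f (suc n) = f n + sumTo f n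

sumTo-≤ : ∀ {f B} n → (∀ i → f i ≤ B) → sumTo f n ≤ n * B
sumTo-≤ zero    h = z≤n
sumTo-≤ (suc n) h = +-mono-≤ (h n) (sumTo-≤ n h)

sumTo-mono : ∀ {f g} n → (∀ i → f i ≤ g i) → sumTo f n ≤ sumTo g n
sumTo-mono zero    h = z≤n
sumTo-mono (suc n) h = +-mono-≤ (h n) (sumTo-mono n h)

sumTo-strict : ∀ {f g} n {j} → j < n → (∀ i → f i ≤ g i) → f j < g j → sumTo f n < sumTo g n
sumTo-strict (suc n) {j} j<n h lt with m≤n⇒m<n∨m≡n (s≤s⁻¹ j<n)
... | inj₁ j<n′ = +-mono-≤-< (h n) (sumTo-strict n j<n′ h lt)
... | inj₂ refl = +-mono-<-≤ lt (sumTo-mono n h)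

-- The row of a predicate g lists the first k users below U that satisfy g:
-- the user u is its entry number count g u.
record Row (k : ℕ) (g : ℕ → Bool) (U : ℕ) (len : ℕ) (ent : ℕ → ℕ) : Set where
  constructor row
  field
    length≡ : len ≡ k ⊓ count g U
    entry≡ : ∀ u → u < U → g u ≡ true → count g u < k → ent (count g u) ≡ u
open Row public

row-cong : ∀ {k g U len len′ ent ent′} → len ≡ len′ → (∀ e → e < k → ent e ≡ ent′ e) →
  Row k g U len ent → Row k g U len′ ent′
row-cong refl eq r = row (length≡ r) λ u u<U gu c → trans (sym (eq _ c)) (entry≡ r u u<U gu c)

row-len≤ : ∀ {k g U len ent} → Row k g U len ent → len ≤ k
row-len≤ {k} r = ≤-trans (≤-reflexive (length≡ r)) (m⊓n≤m k _)

row-skip : ∀ {k g U len ent} → g U ≡ false → Row k g U len ent → Row k g (suc U) len ent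
row-skip {k} {g} {U} {len} {ent} gU r = row len′ ent′
  where
  len′ : len ≡ k ⊓ count g (suc U)
  len′ rewrite gU = length≡ r
  ent′ : ∀ u → u < suc U → g u ≡ true → count g u < k → ent (count g u) ≡ u
  ent′ u u< gu c with m≤n⇒m<n∨m≡n (s≤s⁻¹ u<)
  ... | inj₁ u<U  = entry≡ r u u<U gu c
  ... | inj₂ refl with trans (sym gU) gu
  ...   | ()

row-full : ∀ {k g U len ent} → k ≤ count g U → Row k g U len ent → Row k g (suc U) len ent
row-full {k} {g} {U} {len} {ent} k≤ r = row
  (trans (length≡ r) (trans (m≤n⇒m⊓n≡m k≤) (sym (m≤n⇒m⊓n≡m (≤-trans k≤ (count-mono g (n≤1+n U)))))))
  ent′
  where
  ent′ : ∀ u → u < suc U → g u ≡ true → count g u < k → ent (count g u) ≡ u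
  ent′ u u< gu c with m≤n⇒m<n∨m≡n (s≤s⁻¹ u<)
  ... | inj₁ u<U  = entry≡ r u u<U gu c
  ... | inj₂ refl = ⊥-elim (<-irrefl refl (≤-trans c k≤))

row-len-count : ∀ {k g U len ent} → Row k g U len ent → len < k → len ≡ count g U
row-len-count {k} {g} {U} r len<k with ⊓-sel k (count g U)
... | inj₁ eq = ⊥-elim (<-irrefl (trans (length≡ r) eq) len<k)
... | inj₂ eq = trans (length≡ r) eq

row-full-count : ∀ {k g U len ent} → Row k g U len ent → k ≤ len → k ≤ count g U
row-full-count {k} {g} {U} r k≤len =
  ≤-trans k≤len (≤-trans (≤-reflexive (length≡ r)) (m⊓n≤n k (count g U)))

-- A row that is not full has length `count g U`, which is just the entry number that belongs to
-- `U`.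
row-push : ∀ {k g U len ent} → g U ≡ true → len < k → Row k g U len ent →
  Row k g (suc U) (suc len) (ent [ len ↦ U ])
row-push {k} {g} {U} {len} {ent} gU len<k r = row len′ ent′
  where
  len≡c = row-len-count r len<k
  len′ : suc len ≡ k ⊓ count g (suc U)
  len′ rewrite gU | sym len≡c = sym (m≥n⇒m⊓n≡n len<k)
  ent′ : ∀ u → u < suc U → g u ≡ true → count g u < k → (ent [ len ↦ U ]) (count g u) ≡ u
  ent′ u u< gu c with m≤n⇒m<n∨m≡n (s≤s⁻¹ u<)
  ... | inj₁ u<U  = trans
    (get-set-≢ ent U (λ eq → <-irrefl (trans eq len≡c) (count-strict g gu u<U))) (entry≡ r u u<U gu c)
  ... | inj₂ refl = trans (cong (ent [ len ↦ U ]) (sym len≡c)) (get-set ent len U)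

row-entry : ∀ {k g U len ent e} → Row k g U len ent → e < len →
  ent e < U × g (ent e) ≡ true × count g (ent e) ≡ e
row-entry {k} {g} {U} {ent = ent} {e} r e<len
  with count-nth g U (≤-trans e<len (≤-trans (≤-reflexive (length≡ r)) (m⊓n≤n k _)))
... | u , u<U , gu , refl
  rewrite entry≡ r u u<U gu (≤-trans e<len (row-len≤ r)) = u<U , gu , refl

-- Insertion of a new step s into a weak order of the steps below s, given by
-- its ranks l: a digit δ ≤ s puts s into the class δ, a digit δ = s + 1 + p
-- into a new class p, moving the classes from p on up by one.
isNew : ℕ → ℕ → Bool
isNew s δ = nz (δ ∸ s)

rankOf : ℕ → ℕ → ℕ
rankOf s δ = if isNew s δ then δ ∸ suc s else δ

-- With p = `δ ∸ suc s`, the summand `1 ∸ (p ∸ v)` is the truth value of p ≤ v, in the arithmetic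
-- that the machine offers.
shift : ℕ → ℕ → ℕ → ℕ
shift s δ v = if isNew s δ then v + (1 ∸ ((δ ∸ suc s) ∸ v)) else v

insertStep : ℕ → ℕ → (ℕ → ℕ) → ℕ → ℕ
insertStep s δ l t = if t <ᵇ s then shift s δ (l t) else rankOf s δ

ranks : (ℕ → ℕ) → ℕ → ℕ → ℕ
ranks d zero    t = 0
ranks d (suc s) t = insertStep s (d s) (ranks d s) t

<ᵇ-true : ∀ {t s} → t < s → (t <ᵇ s) ≡ true
<ᵇ-true t<s = Equivalence.to T-≡ (<⇒<ᵇ t<s)

<ᵇ-irrefl : ∀ s → (s <ᵇ s) ≡ false
<ᵇ-irrefl zero    = refl
<ᵇ-irrefl (suc s) = <ᵇ-irrefl s

insertStep-old : ∀ {s δ t} l → t < s → insertStep s δ l t ≡ shift s δ (l t)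
insertStep-old l t<s rewrite <ᵇ-true t<s = refl

insertStep-new : ∀ {s δ} l → insertStep s δ l s ≡ rankOf s δ
insertStep-new {s} l rewrite <ᵇ-irrefl s = refl

ranks-cong : ∀ {d d′} s → (∀ t → t < s → d t ≡ d′ t) → ∀ t → ranks d s t ≡ ranks d′ s t
ranks-cong zero    h t = refl
ranks-cong {d} {d′} (suc s) h t
  rewrite h s ≤-refl | ranks-cong {d} {d′} s (λ u u<s → h u (m≤n⇒m≤1+n u<s)) t = refl

DigitsBelow : ℕ → (ℕ → ℕ) → Set
DigitsBelow k d = ∀ s → s < k → d s < suc s + suc s

rankOf< : ∀ s {δ} → δ < suc s + suc s → rankOf s δ < suc s
rankOf< s {δ} δ< with δ ∸ s in eq
... | zero  = s≤s (m∸n≡0⇒m≤n eq)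
... | suc _ = ≤-trans (∸-monoˡ-< δ< (m∸n≢0⇒n<m (λ z → 0≢1+n (trans (sym z) eq))))
  (≤-reflexive (m+n∸m≡n (suc s) (suc s)))

shift< : ∀ s δ {v} → v < s → shift s δ v < suc s
shift< s δ {v} v<s with isNew s δ
... | false = m≤n⇒m≤1+n v<s
... | true  = s≤s (≤-trans (+-monoʳ-≤ v (m∸n≤m 1 ((δ ∸ suc s) ∸ v))) (≤-trans (≤-reflexive (+-comm v 1)) v<s))

ranks< : ∀ {d} s → DigitsBelow s d → ∀ t → t < s → ranks d s t < s
ranks< {d} (suc s) db t t<  with m≤n⇒m<n∨m≡n (s≤s⁻¹ t<)
... | inj₁ t<s  rewrite insertStep-old {s} {d s} (ranks d s) t<s =
  shift< s (d s) (ranks< s (λ u u<s → db u (m≤n⇒m≤1+n u<s)) t t<s)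
... | inj₂ refl rewrite insertStep-new {s} {d s} (ranks d s) = rankOf< s (db s ≤-refl)

-- Only the forward implications are recorded: by trichotomy on the values of `π` they entail the
-- converses.
Tracks : (π l : ℕ → ℕ) → ℕ → Set
Tracks π l s = ∀ t u → t < s → u < s → (π t < π u → l t < l u) × (π t ≡ π u → l t ≡ l u)

tracks-≡⁻¹ : ∀ {π l s} → Tracks π l s → ∀ t u → t < s → u < s → l t ≡ l u → π t ≡ π u
tracks-≡⁻¹ {π} tr t u t<s u<s eq with <-cmp (π t) (π u)
... | tri≈ _ e _ = e
... | tri< h _ _ = ⊥-elim (<-irrefl eq (proj₁ (tr t u t<s u<s) h))
... | tri> _ _ h = ⊥-elim (<-irrefl (sym eq) (proj₁ (tr u t u<s t<s) h))

tracks-<⁻¹ : ∀ {π l s} → Tracks π l s → ∀ t u → t < s → u < s → l t < l u → π t < π u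
tracks-<⁻¹ {π} tr t u t<s u<s lt with <-cmp (π t) (π u)
... | tri< h _ _ = h
... | tri≈ _ e _ = ⊥-elim (<-irrefl (proj₂ (tr t u t<s u<s) e) lt)
... | tri> _ _ h = ⊥-elim (<-asym lt (proj₁ (tr u t u<s t<s) h))

bump : ℕ → ℕ → ℕ
bump p v = v + (1 ∸ (p ∸ v))

bump-< : ∀ {p v} → v < p → bump p v ≡ v
bump-< {p} {v} v<p with p ∸ v in eq
... | zero  = ⊥-elim (<-irrefl refl (≤-trans v<p (m∸n≡0⇒m≤n eq)))
... | suc n rewrite 0∸n≡0 n = +-identityʳ v

bump-≥ : ∀ {p v} → p ≤ v → bump p v ≡ suc v
bump-≥ {p} {v} p≤v rewrite m≤n⇒m∸n≡0 p≤v = +-comm v 1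

bump-strict : ∀ p {v w} → v < w → bump p v < bump p w
bump-strict p {v} {w} v<w with v <? p | w <? p
... | yes a | yes b rewrite bump-< a | bump-< b = v<w
... | yes a | no  b rewrite bump-< a | bump-≥ (≮⇒≥ b) = m≤n⇒m≤1+n v<w
... | no  a | yes b = ⊥-elim (a (<-trans v<w b))
... | no  a | no  b rewrite bump-≥ (≮⇒≥ a) | bump-≥ (≮⇒≥ b) = s≤s v<w

-- Either s is tied with an earlier step, or a rank p for it separates the
-- earlier steps below it from those above it.
Place : (π l : ℕ → ℕ) → ℕ → ℕ → Set
Place π l s m =
  (∃[ t ] t < m × π t ≡ π s)
  ⊎ (∃[ p ] p ≤ s × (∀ t → t < m → π t ≢ π s)
      × (∀ t → t < m → π t < π s → l t < p) × (∀ u → u < s → π s < π u → p ≤ l u))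

-- The rank for `s` is one more than the largest rank of an earlier step with a smaller value, or 0.
-- It is at most `s` because ranks are below `s`, and it overtakes no step with a larger value
-- because `Tracks` is strict.
place : ∀ {π l s} → Tracks π l s → (∀ t → t < s → l t < s) → ∀ m → m ≤ s → Place π l s m
place tr bd zero _ = inj₂ (0 , z≤n , (λ _ ()) , (λ _ ()) , λ _ _ _ → z≤n)
place {π} {l} {s} tr bd (suc m) m<s with place tr bd m (<⇒≤ m<s)
... | inj₁ (t , t<m , eq) = inj₁ (t , m≤n⇒m≤1+n t<m , eq)
... | inj₂ (p , p≤s , ne , lo , hi) with <-cmp (π m) (π s)
...   | tri≈ _ eq _ = inj₁ (m , ≤-refl , eq)
...   | tri< lt m≢ _ = inj₂ (p ⊔ suc (l m) , ⊔-lub p≤s (bd m m<s)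
        , (λ t t≤m → <suc-elim m (λ u → π u ≢ π s) ne m≢ t t≤m)
        , (λ t t≤m → <suc-elim m (λ u → π u < π s → l u < p ⊔ suc (l m))
            (λ u u<m h → ≤-trans (lo u u<m h) (m≤m⊔n p _)) (λ _ → m≤n⊔m p _) t t≤m)
        , λ u u<s h → ⊔-lub (hi u u<s h) (proj₁ (tr m u m<s u<s) (<-trans lt h)))
...   | tri> ¬lt m≢ _ = inj₂ (p , p≤s
        , (λ t t≤m → <suc-elim m (λ u → π u ≢ π s) ne m≢ t t≤m)
        , (λ t t≤m → <suc-elim m (λ u → π u < π s → l u < p) lo (λ h → ⊥-elim (¬lt h)) t t≤m)
        , hi)

shift-old : ∀ s {δ} v → δ ≤ s → shift s δ v ≡ v
shift-old s v δ≤s rewrite m≤n⇒m∸n≡0 δ≤s = refl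

rankOf-old : ∀ s {δ} → δ ≤ s → rankOf s δ ≡ δ
rankOf-old s δ≤s rewrite m≤n⇒m∸n≡0 δ≤s = refl

isNew-new : ∀ s p → isNew s (suc s + p) ≡ true
isNew-new s p rewrite sym (+-suc s p) | m+n∸m≡n s (suc p) = refl

shift-new : ∀ s p v → shift s (suc s + p) v ≡ bump p v
shift-new s p v rewrite isNew-new s p | m+n∸m≡n s p = refl

rankOf-new : ∀ s p → rankOf s (suc s + p) ≡ p
rankOf-new s p rewrite isNew-new s p = m+n∸m≡n s p

insertStep-tracks : ∀ {π l s δ} → Tracks π l s →
  (∀ v w → v < w → shift s δ v < shift s δ w) →
  (∀ t → t < s → (π t < π s → shift s δ (l t) < rankOf s δ)
               × (π s < π t → rankOf s δ < shift s δ (l t))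
               × (π t ≡ π s → shift s δ (l t) ≡ rankOf s δ)) →
  Tracks π (insertStep s δ l) (suc s)
insertStep-tracks {π} {l} {s} {δ} tr mono new t u t< u<
  with m≤n⇒m<n∨m≡n (s≤s⁻¹ t<) | m≤n⇒m<n∨m≡n (s≤s⁻¹ u<)
... | inj₁ t<s  | inj₁ u<s
  rewrite insertStep-old {s} {δ} l t<s | insertStep-old {s} {δ} l u<s =
    (λ h → mono _ _ (proj₁ (tr t u t<s u<s) h)) , (λ h → cong (shift s δ) (proj₂ (tr t u t<s u<s) h))
... | inj₁ t<s  | inj₂ refl
  rewrite insertStep-old {s} {δ} l t<s | insertStep-new {s} {δ} l =
    let lo , _ , eq = new t t<s in lo , eq
... | inj₂ refl | inj₁ u<s
  rewrite insertStep-old {s} {δ} l u<s | insertStep-new {s} {δ} l =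
    let _ , hi , eq = new u u<s in hi , (λ h → sym (eq (sym h)))
... | inj₂ refl | inj₂ refl = (λ h → ⊥-elim (<-irrefl refl h)) , (λ _ → refl)

insert-digit : ∀ {π l s} → Tracks π l s → (∀ t → t < s → l t < s) →
  ∃[ δ ] δ < suc s + suc s × Tracks π (insertStep s δ l) (suc s)
insert-digit {π} {l} {s} tr bd with place tr bd s ≤-refl
... | inj₁ (t , t<s , tied) = l t , ≤-trans (m≤n⇒m≤1+n (bd t t<s)) (m≤m+n (suc s) (suc s))
    , insertStep-tracks tr mono new
  where
  δ≤s = <⇒≤ (bd t t<s)
  mono : ∀ v w → v < w → shift s (l t) v < shift s (l t) w
  mono v w v<w rewrite shift-old s v δ≤s | shift-old s w δ≤s = v<w
  new : ∀ u → u < s → (π u < π s → shift s (l t) (l u) < rankOf s (l t))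
                    × (π s < π u → rankOf s (l t) < shift s (l t) (l u))
                    × (π u ≡ π s → shift s (l t) (l u) ≡ rankOf s (l t))
  new u u<s rewrite shift-old s (l u) δ≤s | rankOf-old s δ≤s | sym tied =
    proj₁ (tr u t u<s t<s) , proj₁ (tr t u t<s u<s) , proj₂ (tr u t u<s t<s)
... | inj₂ (p , p≤s , ne , lo , hi) = suc s + p , +-monoʳ-< (suc s) (s≤s p≤s)
    , insertStep-tracks tr mono new
  where
  mono : ∀ v w → v < w → shift s (suc s + p) v < shift s (suc s + p) w
  mono v w v<w rewrite shift-new s p v | shift-new s p w = bump-strict p v<w
  new : ∀ u → u < s → (π u < π s → shift s (suc s + p) (l u) < rankOf s (suc s + p))
                    × (π s < π u → rankOf s (suc s + p) < shift s (suc s + p) (l u))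
                    × (π u ≡ π s → shift s (suc s + p) (l u) ≡ rankOf s (suc s + p))
  new u u<s rewrite shift-new s p (l u) | rankOf-new s p =
      (λ h → ≤-trans (s≤s (≤-reflexive (bump-< (lo u u<s h)))) (lo u u<s h))
    , (λ h → ≤-trans (s≤s (hi u u<s h)) (≤-reflexive (sym (bump-≥ (hi u u<s h)))))
    , (λ h → ⊥-elim (ne u u<s h))

-- Completeness of the code: the steps are inserted one by one, and changing digit `s` does not
-- affect the ranks computed from the digits below it.
tracking-digits : ∀ π s → ∃[ d ] DigitsBelow s d × Tracks π (ranks d s) s
tracking-digits π zero = (λ _ → 0) , (λ _ ()) , λ _ _ ()
tracking-digits π (suc s) with tracking-digits π s
... | d , db , tr with insert-digit tr (ranks< s db)
...   | δ , δ< , tr′ = d [ s ↦ δ ]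
    , <suc-elim s (λ t → (d [ s ↦ δ ]) t < suc t + suc t)
        (λ t t<s → subst (_< suc t + suc t) (sym (same t t<s)) (db t t<s))
        (subst (_< suc s + suc s) (sym (get-set d s δ)) δ<)
    , λ t u t< u< → subst₂ (λ a b → (π t < π u → a < b) × (π t ≡ π u → a ≡ b))
        (eq t) (eq u) (tr′ t u t< u<)
  where
  same : ∀ t → t < s → (d [ s ↦ δ ]) t ≡ d t
  same t t<s = get-set-≢ d δ (<⇒≢ t<s)
  eq : ∀ t → insertStep s δ (ranks d s) t ≡ ranks (d [ s ↦ δ ]) (suc s) t
  eq t rewrite get-set d s δ | ranks-cong {d [ s ↦ δ ]} {d} s same t = refl

-- The value of a digit vector in the mixed radix 2, 4, 6, ….
value : (ℕ → ℕ) → ℕ → ℕ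
value d zero    = 0
value d (suc s) = d s * weakOrders s + value d s

value< : ∀ d k → DigitsBelow k d → value d k < weakOrders k
value< d zero    db = s≤s z≤n
value< d (suc s) db = begin
  suc (d s * w + value d s)  ≡⟨ sym (+-suc _ _) ⟩
  d s * w + suc (value d s)  ≤⟨ +-monoʳ-≤ _ (value< d s (λ t t<s → db t (m≤n⇒m≤1+n t<s))) ⟩
  d s * w + w                ≡⟨ +-comm _ w ⟩
  suc (d s) * w              ≤⟨ *-monoˡ-≤ w (db s ≤-refl) ⟩
  (suc s + suc s) * w        ≡⟨ arith (suc s) w ⟩
  suc s * (w + w)            ∎
  where
  open ≤-Reasoning
  w = weakOrders s
  arith : ∀ a w → (a + a) * w ≡ a * (w + w)
  arith = solve-∀

leading-digit-≤ : ∀ {w x y r q} → q < w → x * w + r ≡ y * w + q → x ≤ y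
leading-digit-≤ {w} {x} {y} {r} {q} q<w eq = ≮⇒≥ λ y<x → <-irrefl (sym eq) (begin-strict
  y * w + q   <⟨ +-monoʳ-< (y * w) q<w ⟩
  y * w + w   ≡⟨ +-comm (y * w) w ⟩
  suc y * w   ≤⟨ *-monoˡ-≤ w y<x ⟩
  x * w       ≤⟨ m≤m+n (x * w) r ⟩
  x * w + r   ∎)
  where open ≤-Reasoning

-- The search only knows the value of its digit vector in round x, namely x; this identifies the
-- vector itself with the one that is waited for.
value-injective : ∀ {d d′} k → DigitsBelow k d → DigitsBelow k d′ → value d k ≡ value d′ k →
  ∀ t → t < k → d t ≡ d′ t
value-injective zero db db′ eq t ()
value-injective {d} {d′} (suc s) db db′ eq = <suc-elim s (λ t → d t ≡ d′ t)
  (value-injective s dbₛ db′ₛ (+-cancelˡ-≡ (d s * weakOrders s) _ _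
    (trans eq (cong (λ z → z * weakOrders s + value d′ s) (sym top)))))
  top
  where
  dbₛ : DigitsBelow s d
  dbₛ t t<s = db t (m≤n⇒m≤1+n t<s)
  db′ₛ : DigitsBelow s d′
  db′ₛ t t<s = db′ t (m≤n⇒m≤1+n t<s)
  top : d s ≡ d′ s
  top = ≤-antisym (leading-digit-≤ (value< d′ s db′ₛ) eq)
                  (leading-digit-≤ (value< d s dbₛ) (sym eq))

-- In its use `x` enumerates the k taken users of a full row and `y` the picks of the v classes
-- served so far.
pigeonhole-ℕ : ∀ {v k} (x y : ℕ → ℕ) → v < k →
  (∀ e e′ → e < e′ → e′ < k → x e ≢ x e′) →
  ¬ (∀ e → e < k → ∃[ i ] i < v × y i ≡ x e)
pigeonhole-ℕ {v} {k} x y v<k inj hit with pigeonhole v<k f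
  where
  f : Fin k → Fin v
  f e = let _ , i<v , _ = hit (toℕ e) (toℕ<n e) in fromℕ< i<v
... | i , j , i<j , eq = inj (toℕ i) (toℕ j) i<j (toℕ<n j)
  (trans (sym (proj₂ (proj₂ (hit _ (toℕ<n i)))))
    (trans (cong y (trans (sym (toℕ-fromℕ< _)) (trans (cong toℕ eq) (toℕ-fromℕ< _))))
      (proj₂ (proj₂ (hit _ (toℕ<n j))))))

-- The program and its table of rows

kᵣ nᵣ cᵣ powᵣ numᵣ baseᵣ resᵣ uᵣ τᵣ wᵣ qᵣ sᵣ jᵣ lᵣ xᵣ vᵣ hitᵣ fndᵣ pickᵣ failᵣ okᵣ satᵣ carᵣ accᵣ tᵣ iᵣ : ℕ
kᵣ = 1 ; nᵣ = 2 ; cᵣ = 3 ; powᵣ = 4 ; numᵣ = 5 ; baseᵣ = 6 ; resᵣ = 7 ; uᵣ = 8 ; τᵣ = 9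
wᵣ = 10 ; qᵣ = 11 ; sᵣ = 12 ; jᵣ = 13 ; lᵣ = 14 ; xᵣ = 15 ; vᵣ = 16 ; hitᵣ = 17 ; fndᵣ = 18
pickᵣ = 19 ; failᵣ = 20 ; okᵣ = 21 ; satᵣ = 22 ; carᵣ = 23 ; accᵣ = 24 ; tᵣ = 25 ; iᵣ = 26

LEN LST SUB DIG RNK MRK PCK BST : ℕ
LEN = 0 ; LST = 1 ; SUB = 2 ; DIG = 3 ; RNK = 4 ; MRK = 5 ; PCK = 6 ; BST = 7

readParams : Cmd
readParams = kᵣ := inp (num 0) ▹ nᵣ := inp (num 1) ▹ cᵣ := inp (num 2)

-- Without constraints any authorised user will do.
lastAuthorised : Cmd
lastAuthorised =
  iff (inp (rg qᵣ)) (BST ⟦ rg sᵣ ⟧:= rg uᵣ) nop ▹ qᵣ := rg qᵣ ⊞ num 1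

unconstrained : Cmd
unconstrained =
  qᵣ := num 3 ▹ (for sᵣ upto kᵣ ⟲ (for uᵣ upto nᵣ ⟲ lastAuthorised)) ▹ resᵣ := num 1

power : Cmd
power = wᵣ := num 1 ▹ (for sᵣ upto kᵣ ⟲ (wᵣ := rg wᵣ ⊞ rg wᵣ)) ▹ powᵣ := rg wᵣ

-- Multiplication by 2 (s + 1) as repeated addition: the test succeeds for t ≤ s, hence s + 1 times.
-- Running over all k rounds keeps `kᵣ` the only loop bound.
addTwice : Cmd
addTwice = iff (num 1 ⊞ rg sᵣ ⊟ rg tᵣ) (accᵣ := rg accᵣ ⊞ (rg wᵣ ⊞ rg wᵣ)) nop

candidates : Cmd
candidates = wᵣ := num 1
  ▹ (for sᵣ upto kᵣ ⟲ (accᵣ := num 0 ▹ (for tᵣ upto kᵣ ⟲ addTwice) ▹ wᵣ := rg accᵣ))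
  ▹ numᵣ := rg wᵣ

constraintBase : Cmd
constraintBase = qᵣ := num 3 ▹ (for sᵣ upto kᵣ ⟲ (qᵣ := rg qᵣ ⊞ rg nᵣ)) ▹ baseᵣ := rg qᵣ

-- Masks are scaled by k: they are offsets of rows of length k.
column : Cmd
column = τᵣ := num 0 ▹ wᵣ := rg kᵣ ▹ qᵣ := num 3 ⊞ rg uᵣ
  ▹ (for sᵣ upto kᵣ ⟲
      (iff (inp (rg qᵣ)) (τᵣ := rg τᵣ ⊞ rg wᵣ) nop ▹ wᵣ := rg wᵣ ⊞ rg wᵣ ▹ qᵣ := rg qᵣ ⊞ rg nᵣ))

-- Only the first w = 2^s cells are to be doubled, but the loop always runs over all 2^k and the
-- test discards the rest, so that its bound is a fixed register.
doubleCell : Cmd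
doubleCell = iff (rg wᵣ ⊟ rg jᵣ)
  (iff (inp (rg qᵣ)) (SUB ⟦ rg wᵣ ⊞ rg jᵣ ⟧:= SUB ⟦ rg jᵣ ⟧) (SUB ⟦ rg wᵣ ⊞ rg jᵣ ⟧:= num 0))
  nop

doubleTable : Cmd
doubleTable = for jᵣ upto powᵣ ⟲ doubleCell

-- Afterwards cell m of SUB tells whether user u may perform all the steps of
-- the set with mask m.
subsets : Cmd
subsets = SUB ⟦ num 0 ⟧:= num 1 ▹ wᵣ := num 1 ▹ qᵣ := num 3 ⊞ rg uᵣ
  ▹ (for sᵣ upto kᵣ ⟲ (doubleTable ▹ wᵣ := rg wᵣ ⊞ rg wᵣ ▹ qᵣ := rg qᵣ ⊞ rg nᵣ))

append : Cmd
append = lᵣ := LEN ⟦ rg τᵣ ⟧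
  ▹ iff (rg kᵣ ⊟ rg lᵣ)
      (LST ⟦ rg τᵣ ⊞ rg lᵣ ⟧:= rg uᵣ ▹ LEN ⟦ rg τᵣ ⟧:= rg lᵣ ⊞ num 1)
      nop

pushRow : Cmd
pushRow = iff (SUB ⟦ rg jᵣ ⟧) append nop ▹ τᵣ := rg τᵣ ⊞ rg kᵣ

push : Cmd
push = τᵣ := num 0 ▹ (for jᵣ upto powᵣ ⟲ pushRow)

addUser : Cmd
addUser = column ▹ iff (rg kᵣ ⊟ LEN ⟦ rg τᵣ ⟧) (subsets ▹ push) nop

users : Cmd
users = for uᵣ upto nᵣ ⟲ addUser

shiftRank : Cmd
shiftRank = iff (rg sᵣ ⊟ rg tᵣ)
  (RNK ⟦ rg tᵣ ⟧:= RNK ⟦ rg tᵣ ⟧ ⊞ (num 1 ⊟ (rg accᵣ ⊟ RNK ⟦ rg tᵣ ⟧))) nop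

insert : Cmd
insert = iff (rg accᵣ ⊟ rg sᵣ)
  (accᵣ := rg accᵣ ⊟ (num 1 ⊞ rg sᵣ)
    ▹ (for tᵣ upto kᵣ ⟲ shiftRank)
    ▹ RNK ⟦ rg sᵣ ⟧:= rg accᵣ)
  (RNK ⟦ rg sᵣ ⟧:= rg accᵣ)

decode : Cmd
decode = for sᵣ upto kᵣ ⟲ (accᵣ := DIG ⟦ rg sᵣ ⟧ ▹ insert)

-- The absolute difference.
neq : Ex → Ex → Ex
neq d e = (d ⊟ e) ⊞ (e ⊟ d)

classMask : Cmd
classMask = hitᵣ := num 0 ▹ τᵣ := num 0 ▹ wᵣ := rg kᵣ
  ▹ (for sᵣ upto kᵣ ⟲
      (iff (neq (RNK ⟦ rg sᵣ ⟧) (rg vᵣ)) nop (τᵣ := rg τᵣ ⊞ rg wᵣ ▹ hitᵣ := num 1)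
        ▹ wᵣ := rg wᵣ ⊞ rg wᵣ))

-- Candidate x marks with x + 1, so marks left by earlier candidates are at most x and count as
-- free. Clearing an array indexed by users would cost time depending on n for every candidate.
stamp : Ex
stamp = rg xᵣ ⊞ num 1

-- A user is taken by the current candidate if it bears the current stamp.
tryEntry : Cmd
tryEntry = iff (LEN ⟦ rg τᵣ ⟧ ⊟ rg iᵣ)
  (iff (rg fndᵣ) nop
    (accᵣ := LST ⟦ rg τᵣ ⊞ rg iᵣ ⟧
      ▹ iff (stamp ⊟ MRK ⟦ rg accᵣ ⟧) (fndᵣ := num 1 ▹ pickᵣ := rg accᵣ) nop))
  nop

firstFree : Cmd
firstFree = fndᵣ := num 0 ▹ (for iᵣ upto kᵣ ⟲ tryEntry)

take : Cmd
take = iff (rg fndᵣ) (MRK ⟦ rg pickᵣ ⟧:= stamp ▹ PCK ⟦ rg vᵣ ⟧:= rg pickᵣ) (failᵣ := num 1)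

serveClass : Cmd
serveClass = classMask ▹ iff (rg hitᵣ) (firstFree ▹ take) nop

greedy : Cmd
greedy = failᵣ := num 0 ▹ (for vᵣ upto kᵣ ⟲ serveClass)

-- The ranks give way to the plan itself. Testing the actual plan makes a saved answer correct
-- independently of whether distinct classes were served distinct users.
assign : Cmd
assign = for sᵣ upto kᵣ ⟲ (RNK ⟦ rg sᵣ ⟧:= PCK ⟦ RNK ⟦ rg sᵣ ⟧ ⟧)

testPair : Cmd
testPair = iff (inp (rg qᵣ ⊞ (num 1 ⊞ (rg kᵣ ⊞ rg tᵣ))))
  (iff (inp (rg qᵣ))
    (iff (neq (RNK ⟦ rg sᵣ ⟧) (RNK ⟦ rg tᵣ ⟧)) (satᵣ := num 1) nop)
    (iff (neq (RNK ⟦ rg sᵣ ⟧) (RNK ⟦ rg tᵣ ⟧)) nop (satᵣ := num 1)))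
  nop

testStep : Cmd
testStep = iff (inp (rg qᵣ ⊞ (num 1 ⊞ rg sᵣ))) (for tᵣ upto kᵣ ⟲ testPair) nop

testConstraint : Cmd
testConstraint = satᵣ := num 0 ▹ (for sᵣ upto kᵣ ⟲ testStep)
  ▹ iff (rg satᵣ) nop (okᵣ := num 0)
  ▹ qᵣ := rg qᵣ ⊞ (num 1 ⊞ (rg kᵣ ⊞ rg kᵣ))

check : Cmd
check = okᵣ := num 1 ⊟ rg failᵣ ▹ qᵣ := rg baseᵣ ▹ (for jᵣ upto cᵣ ⟲ testConstraint)

-- Counted loops cannot stop early: a later success overwrites an earlier one.
save : Cmd
save = iff (rg okᵣ) (resᵣ := num 1 ▹ (for sᵣ upto kᵣ ⟲ (BST ⟦ rg sᵣ ⟧:= RNK ⟦ rg sᵣ ⟧))) nop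

incrementDigit : Cmd
incrementDigit = iff (rg carᵣ)
  -- Digit s has radix 2s + 2, so it can still grow as long as it is below 2s + 1.
  (iff ((num 1 ⊞ rg sᵣ) ⊞ rg sᵣ ⊟ DIG ⟦ rg sᵣ ⟧)
    (DIG ⟦ rg sᵣ ⟧:= DIG ⟦ rg sᵣ ⟧ ⊞ num 1 ▹ carᵣ := num 0)
    (DIG ⟦ rg sᵣ ⟧:= num 0))
  nop

increment : Cmd
increment = carᵣ := num 1 ▹ (for sᵣ upto kᵣ ⟲ incrementDigit)

tryCandidate : Cmd
tryCandidate = decode ▹ greedy ▹ assign ▹ check ▹ save ▹ increment

search : Cmd
search = for xᵣ upto numᵣ ⟲ tryCandidate

constrained : Cmd
constrained = power ▹ candidates ▹ constraintBase ▹ users ▹ search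

solve : Cmd
solve = readParams ▹ iff (rg cᵣ) constrained unconstrained

-- Inclusion of sets with the same recursion as `mask`, so that each round of `subsets` realises one
-- clause of it.
within : (b a : ℕ → Bool) → ℕ → Bool
within b a zero    = true
within b a (suc s) =
  if b s then (if a s then within b a s else false) else within b a s

within-sound : ∀ b a k → within b a k ≡ true → ∀ t → t < k → b t ≡ true → a t ≡ true
within-sound b a (suc k) h t t< bt with m≤n⇒m<n∨m≡n (s≤s⁻¹ t<)
within-sound b a (suc k) h t t< bt | inj₂ refl with a t
... | true  = refl
... | false rewrite bt with h
...   | ()
within-sound b a (suc k) h t t< bt | inj₁ t<k with b k | a k
... | false | _     = within-sound b a k h t t<k bt
... | true  | true  = within-sound b a k h t t<k bt
within-sound b a (suc k) () t t< bt | inj₁ t<k | true | false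

within-complete : ∀ b a k → (∀ t → t < k → b t ≡ true → a t ≡ true) → within b a k ≡ true
within-complete b a zero    h = refl
within-complete b a (suc k) h with b k in eq
... | false = within-complete b a k λ t t<k → h t (m≤n⇒m≤1+n t<k)
... | true rewrite h k ≤-refl eq = within-complete b a k λ t t<k → h t (m≤n⇒m≤1+n t<k)

rows-disjoint : ∀ {k i j e l} → e < k → l < k → i * k + e ≡ j * k + l → i ≡ j
rows-disjoint e<k l<k eq = ≤-antisym (leading-digit-≤ l<k eq) (leading-digit-≤ e<k (sym eq))

module _ (LEN₀ LST₀ : ℕ → ℕ) {k j l M u : ℕ} (M≡ : M ≡ j * k) (l≡ : l ≡ LEN₀ M) (l<k : l < k) where

  append-same : ∀ {g} → g u ≡ true → Row k g u (LEN₀ (j * k)) (λ e → LST₀ (j * k + e)) →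
    Row k g (suc u) ((LEN₀ [ M ↦ l + 1 ]) (j * k)) (λ e → (LST₀ [ M + l ↦ u ]) (j * k + e))
  append-same {g} gu r rewrite M≡ = row-cong
    (sym (trans (get-set LEN₀ (j * k) (l + 1)) (+-comm l 1)))
    entries
    (row-push gu l<k (subst (λ z → Row k g u z (λ e → LST₀ (j * k + e))) (sym l≡) r))
    where
    ent : ℕ → ℕ
    ent e = LST₀ (j * k + e)
    entries : ∀ e → e < k →
      (ent [ l ↦ u ]) e ≡ (LST₀ [ j * k + l ↦ u ]) (j * k + e)
    entries e _ with e ≟ l
    ... | yes refl = trans (get-set ent e u) (sym (get-set LST₀ (j * k + e) u))
    ... | no e≢l   = trans (get-set-≢ ent u e≢l)
      (sym (get-set-≢ LST₀ u λ eq → e≢l (+-cancelˡ-≡ (j * k) e l eq)))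

  -- Rows are blocks of `k` cells and `l < k`, so a write into block `j` misses all the others.
  append-other : ∀ {g i U} → i ≢ j → Row k g U (LEN₀ (i * k)) (λ e → LST₀ (i * k + e)) →
    Row k g U ((LEN₀ [ M ↦ l + 1 ]) (i * k)) (λ e → (LST₀ [ M + l ↦ u ]) (i * k + e))
  append-other {i = i} i≢j r rewrite M≡ = row-cong
    (sym (get-set-≢ LEN₀ (l + 1) λ eq → i≢j (*-cancelʳ-≡ i j k {{>-nonZero (≤-trans (s≤s z≤n) l<k)}} eq)))
    (λ e e<k → sym (get-set-≢ LST₀ u λ eq → i≢j (rows-disjoint e<k l<k eq)))
    r

module Correctness (I : List ℕ) where
  open Semantics I public

  k n c : ℕ
  k = I at 0
  n = I at 1
  c = I at 2

  mayDo : ℕ → ℕ → Bool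
  mayDo u s = nz (I at (3 + u + s * n))

  mayDoAll : (ℕ → Bool) → ℕ → Bool
  mayDoAll b u = within b (mayDo u) k

  -- Indexed by numbers instead of a store: `Ready` then takes definitionally equal forms for a
  -- store before and after an assignment to another register.
  record Params (k′ n′ c′ pow′ num′ base′ : ℕ) : Set where
    constructor params
    field
      k≡    : k′ ≡ k
      n≡    : n′ ≡ n
      c≡    : c′ ≡ c
      pow≡  : pow′ ≡ 2 ^ k
      num≡  : num′ ≡ weakOrders k
      base≡ : base′ ≡ 3 + k * n
  open Params public

  Ready : Store → Set
  Ready t = Params (rv t kᵣ) (rv t nᵣ) (rv t cᵣ) (rv t powᵣ) (rv t numᵣ) (rv t baseᵣ)

  keepsParams : Cmd → Bool
  keepsParams p = fresh kᵣ p ∧ (fresh nᵣ p ∧ (fresh cᵣ p ∧ (fresh powᵣ p ∧ (fresh numᵣ p ∧ fresh baseᵣ p))))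

  ready-agree : ∀ p {s t} → T (keepsParams p) → Agree p t s → Ready s → Ready t
  ready-agree p {s} {t} h a r =
    let h₁ , h′ = ∧-split {fresh kᵣ p} h ; h₂ , h″ = ∧-split {fresh nᵣ p} h′
        h₃ , h‴ = ∧-split {fresh cᵣ p} h″ ; h₄ , h⁗ = ∧-split {fresh powᵣ p} h‴
        h₅ , h₆ = ∧-split {fresh numᵣ p} h⁗ in
    params (trans (regs a kᵣ h₁) (k≡ r)) (trans (regs a nᵣ h₂) (n≡ r)) (trans (regs a cᵣ h₃) (c≡ r))
      (trans (regs a powᵣ h₄) (pow≡ r)) (trans (regs a numᵣ h₅) (num≡ r)) (trans (regs a baseᵣ h₆) (base≡ r))

  for-upto : ∀ {ℓ} {m} x b p (J : ℕ → Store → Set ℓ) s → rv s b ≡ m →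
    (∀ i v t → J i t → J i (setR x v t)) → J 0 s →
    (∀ i t → i < m → Agree (for x upto b ⟲ p) t s → J i t → J (suc i) (run p (setR x i t))) →
    J m (run (for x upto b ⟲ p) s)
  for-upto x b p J s refl = for-ind {x = x} {b} {p} J s

  column-spec : ∀ s {u} → rv s kᵣ ≡ k → rv s nᵣ ≡ n → rv s uᵣ ≡ u →
    rv (run column s) τᵣ ≡ mask (mayDo u) k * k
  column-spec s {u} k≡ n≡ u≡ = proj₁ (for-upto sᵣ kᵣ body J s₀ k≡ (λ _ _ _ j → j) init step)
    where
    body rest : Cmd
    rest = wᵣ := rg wᵣ ⊞ rg wᵣ ▹ qᵣ := rg qᵣ ⊞ rg nᵣ
    body = iff (inp (rg qᵣ)) (τᵣ := rg τᵣ ⊞ rg wᵣ) nop ▹ rest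
    s₀ = run (τᵣ := num 0 ▹ wᵣ := rg kᵣ ▹ qᵣ := num 3 ⊞ rg uᵣ) s
    J : ℕ → Store → Set
    J i t = rv t τᵣ ≡ mask (mayDo u) i * k × rv t wᵣ ≡ 2 ^ i * k × rv t qᵣ ≡ 3 + u + i * n
    init : J 0 s₀
    init = refl , trans k≡ (sym (+-identityʳ k)) , trans (cong (3 +_) u≡) (sym (+-identityʳ (3 + u)))
    step : ∀ i t → i < k → Agree (for sᵣ upto kᵣ ⟲ body) t s₀ → J i t → J (suc i) (run body (setR sᵣ i t))
    step i t i<k a (τ≡ , w≡ , q≡) =
      run-iff (λ z → J (suc i) (run rest z)) {inp (rg qᵣ)} {τᵣ := rg τᵣ ⊞ rg wᵣ} {nop} (setR sᵣ i t)
        (λ h → trans (cong₂ _+_ τ≡ w≡) (sym (taken h)) , w′ , q′)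
        (λ h → trans τ≡ (sym (left h)) , w′ , q′)
      where
      w′ : rv t wᵣ + rv t wᵣ ≡ 2 ^ suc i * k
      w′ rewrite w≡ = double (2 ^ i) k
        where
        double : ∀ p k → p * k + p * k ≡ 2 * p * k
        double = solve-∀
      q′ : rv t qᵣ + rv t nᵣ ≡ 3 + u + suc i * n
      q′ rewrite q≡ | regs a nᵣ tt | n≡ = next (3 + u) i n
        where
        next : ∀ x i n → x + i * n + n ≡ x + suc i * n
        next = solve-∀
      taken : I at rv t qᵣ ≢ 0 → mask (mayDo u) (suc i) * k ≡ mask (mayDo u) i * k + 2 ^ i * k
      taken h rewrite nz-≢0 (subst (λ z → I at z ≢ 0) q≡ h) =
        trans (*-distribʳ-+ k (2 ^ i) (mask (mayDo u) i)) (+-comm (2 ^ i * k) _)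
      left : I at rv t qᵣ ≡ 0 → mask (mayDo u) (suc i) * k ≡ mask (mayDo u) i * k
      left h rewrite nz-0 (subst (λ z → I at z ≡ 0) q≡ h) = refl

  -- Doubling in place is safe, as all cells written are at `w` or above while all cells read are
  -- below `w`.
  doubleTable-spec : ∀ s → rv s wᵣ ≤ rv s powᵣ →
    let Z = ar s SUB ; Z′ = ar (run doubleTable s) SUB ; w = rv s wᵣ in
    (∀ i → i < w → Z′ i ≡ Z i)
    × (∀ i → i < w → Z′ (w + i) ≡ (if nz (I at rv s qᵣ) then Z i else 0))
  doubleTable-spec s w≤pow =
    let old , new = for-upto jᵣ powᵣ doubleCell J s refl (λ _ _ _ j → j) ((λ _ _ → refl) , λ _ ()) step
    in old , λ i i<w → new i (≤-trans i<w w≤pow) i<w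
    where
    w = rv s wᵣ
    Z = ar s SUB
    b = nz (I at rv s qᵣ)
    J : ℕ → Store → Set
    J j t = (∀ i → i < w → ar t SUB i ≡ Z i)
          × (∀ i → i < j → i < w → ar t SUB (w + i) ≡ (if b then Z i else 0))
    step : ∀ j t → j < rv s powᵣ → Agree doubleTable t s → J j t → J (suc j) (run doubleCell (setR jᵣ j t))
    step j t _ a (old , new) = run-iff (J (suc j)) {rg wᵣ ⊟ rg jᵣ} {write} {nop} t′
      (λ h → let j<w = subst (j <_) w≡ (m∸n≢0⇒n<m h) in
        run-iff (J (suc j)) {inp (rg qᵣ)} {SUB ⟦ rg wᵣ ⊞ rg jᵣ ⟧:= SUB ⟦ rg jᵣ ⟧} {SUB ⟦ rg wᵣ ⊞ rg jᵣ ⟧:= num 0} t′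
          (λ h′ → put (ar t SUB j) (trans (old j j<w) (sym (if-true (nz-≢0 (subst (λ z → I at z ≢ 0) q≡ h′))))))
          (λ h′ → put 0 (sym (if-false (nz-0 (subst (λ z → I at z ≡ 0) q≡ h′))))))
      (λ h → let w≤j = subst (_≤ j) w≡ (m∸n≡0⇒m≤n h) in
        old , <suc-elim j (λ i → i < w → ar t SUB (w + i) ≡ (if b then Z i else 0))
          new (λ j<w → ⊥-elim (<-irrefl refl (≤-trans j<w w≤j))))
      where
      t′ = setR jᵣ j t
      write = iff (inp (rg qᵣ)) (SUB ⟦ rg wᵣ ⊞ rg jᵣ ⟧:= SUB ⟦ rg jᵣ ⟧) (SUB ⟦ rg wᵣ ⊞ rg jᵣ ⟧:= num 0)
      w≡ : rv t wᵣ ≡ w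
      w≡ = regs a wᵣ tt
      q≡ : rv t qᵣ ≡ rv s qᵣ
      q≡ = regs a qᵣ tt
      if-true : ∀ {x y : ℕ} → b ≡ true → (if b then x else y) ≡ x
      if-true eq rewrite eq = refl
      if-false : ∀ {x y : ℕ} → b ≡ false → (if b then x else y) ≡ y
      if-false eq rewrite eq = refl
      put : ∀ v → v ≡ (if b then Z j else 0) → J (suc j) (setA SUB (rv t wᵣ + j) v t′)
      put v v≡ rewrite w≡ =
          (λ i i<w → trans (get-set-≢ (ar t SUB) v (<⇒≢ (≤-trans i<w (m≤m+n w j)))) (old i i<w))
        , <suc-elim j (λ i → i < w → (ar t SUB [ w + j ↦ v ]) (w + i) ≡ (if b then Z i else 0))
            (λ i i<j i<w → trans (get-set-≢ (ar t SUB) v (λ eq → <⇒≢ i<j (+-cancelˡ-≡ w i j eq))) (new i i<j i<w))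
            (λ _ → trans (get-set (ar t SUB) (w + j) v) v≡)

  -- After i rounds the cells below 2^i decide the sets of the first i steps. A set that also
  -- contains step i has its mask 2^i higher, and its cell repeats the lower one if step i is
  -- permitted.
  subsets-spec : ∀ s {u} → Ready s → rv s uᵣ ≡ u →
    ∀ b → nz (ar (run subsets s) SUB (mask b k)) ≡ mayDoAll b u
  subsets-spec s {u} r u≡ = proj₂ (proj₂
    (for-upto sᵣ kᵣ body J s₀ (k≡ r) (λ _ _ _ j → j) (refl , trans (cong (3 +_) u≡) (sym (+-identityʳ (3 + u))) , λ _ → refl) step))
    where
    body : Cmd
    body = doubleTable ▹ wᵣ := rg wᵣ ⊞ rg wᵣ ▹ qᵣ := rg qᵣ ⊞ rg nᵣ
    s₀ = run (SUB ⟦ num 0 ⟧:= num 1 ▹ wᵣ := num 1 ▹ qᵣ := num 3 ⊞ rg uᵣ) s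
    J : ℕ → Store → Set
    J i t = rv t wᵣ ≡ 2 ^ i × rv t qᵣ ≡ 3 + u + i * n × (∀ b → nz (ar t SUB (mask b i)) ≡ within b (mayDo u) i)
    step : ∀ i t → i < k → Agree (for sᵣ upto kᵣ ⟲ body) t s₀ → J i t → J (suc i) (run body (setR sᵣ i t))
    step i t i<k a (w≡ , q≡ , tab) = w′ , q′ , tab′
      where
      t′ = setR sᵣ i t
      w≤ : rv t wᵣ ≤ rv t powᵣ
      w≤ = subst₂ _≤_ (sym w≡) (sym (trans (regs a powᵣ tt) (pow≡ r))) (^-monoʳ-≤ 2 (<⇒≤ i<k))
      spec = doubleTable-spec t′ w≤
      w′ : rv (run doubleTable t′) wᵣ + rv (run doubleTable t′) wᵣ ≡ 2 ^ suc i
      w′ = trans (cong dbl (trans (frame doubleTable wᵣ tt t′) w≡)) (sym (cong (2 ^ i +_) (+-identityʳ (2 ^ i))))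
      q′ : rv (run doubleTable t′) qᵣ + rv (run doubleTable t′) nᵣ ≡ 3 + u + suc i * n
      q′ = trans (cong₂ _+_ (trans (frame doubleTable qᵣ tt t′) q≡)
                            (trans (frame doubleTable nᵣ tt t′) (trans (regs a nᵣ tt) (n≡ r))))
                 (next (3 + u) i n)
        where
        next : ∀ x i n → x + i * n + n ≡ x + suc i * n
        next = solve-∀
      may≡ : nz (I at rv t qᵣ) ≡ mayDo u i
      may≡ = cong (λ z → nz (I at z)) q≡
      tab′ : ∀ b → nz (ar (run doubleTable t′) SUB (mask b (suc i))) ≡ within b (mayDo u) (suc i)
      tab′ b with b i
      ... | false = trans (cong nz (proj₁ spec _ (subst (mask b i <_) (sym w≡) (mask< b i)))) (tab b)
      ... | true rewrite sym w≡ | proj₂ spec _ (subst (mask b i <_) (sym w≡) (mask< b i)) | may≡ with mayDo u i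
      ...   | true  = tab b
      ...   | false = refl

  Rows : ℕ → Store → Set
  Rows U t = ∀ b → Row k (mayDoAll b) U (ar t LEN (mask b k * k)) (λ e → ar t LST (mask b k * k + e))

  rows-cong : ∀ U s t → ar t LEN ≡ ar s LEN → ar t LST ≡ ar s LST → Rows U s → Rows U t
  rows-cong U s t len lst R b = subst₂ (λ f g → Row k (mayDoAll b) U (f (mask b k * k)) (λ e → g (mask b k * k + e)))
    (sym len) (sym lst) (R b)

  -- What the time analysis needs from `push`: the rows with room that the user belongs to really
  -- grow, no row shrinks, and none exceeds k entries.
  record Pushed (s t : Store) : Set where
    field
      grows    : ∀ x → ar s LEN x ≤ ar t LEN x
      strictly : ∀ i → i < 2 ^ k → ar s SUB i ≢ 0 → ar s LEN (i * k) < k → ar s LEN (i * k) < ar t LEN (i * k)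
      bounded  : (∀ x → ar s LEN x ≤ k) → ∀ x → ar t LEN x ≤ k

  -- The premise `Rows u s` sits inside the first component, so that the second can serve the time
  -- analysis on its own.
  push-spec : ∀ s {u} → Ready s → rv s uᵣ ≡ u → (∀ b → nz (ar s SUB (mask b k)) ≡ mayDoAll b u) →
    (Rows u s → Rows (suc u) (run push s)) × Pushed s (run push s)
  push-spec s {u} r u≡ sub =
    let _ , rows , gr , st , bd = for-upto jᵣ powᵣ pushRow J s₀ (pow≡ r) (λ _ _ _ j → j)
          (refl , (λ R b → (λ ()) , λ _ → R b) , (λ _ → ≤-refl) , (λ _ ()) , λ h → h) step
    in (λ R b → proj₁ (rows R b) (mask< b k)) , record { grows = gr ; strictly = st ; bounded = bd }
    where
    s₀ = run (τᵣ := num 0) s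
    L₀ = ar s LEN
    RowOf : ℕ → Store → (ℕ → Bool) → Set
    RowOf U t b = Row k (mayDoAll b) U (ar t LEN (mask b k * k)) (λ e → ar t LST (mask b k * k + e))
    J : ℕ → Store → Set
    J j t = rv t τᵣ ≡ j * k
      × (Rows u s → ∀ b → (mask b k < j → RowOf (suc u) t b) × (j ≤ mask b k → RowOf u t b))
      × (∀ x → L₀ x ≤ ar t LEN x)
      × (∀ i → i < j → ar s SUB i ≢ 0 → L₀ (i * k) < k → L₀ (i * k) < ar t LEN (i * k))
      × ((∀ x → L₀ x ≤ k) → ∀ x → ar t LEN x ≤ k)
    step : ∀ j t → j < 2 ^ k → Agree (for jᵣ upto powᵣ ⟲ pushRow) t s₀ → J j t → J (suc j) (run pushRow (setR jᵣ j t))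
    step j t j<pow a (τ≡ , rows , gr , st , bd) =
      run-iff Q {SUB ⟦ rg jᵣ ⟧} {append} {nop} t′
        (λ h → let h′ = subst (_≢ 0) sub≡ h in
          run-iff Q {rg kᵣ ⊟ rg lᵣ} {write} {nop} t″
            (λ l< → pushed h′ (subst (l <_) kt≡ (m∸n≢0⇒n<m l<)))
            (λ l≥ → full (subst (_≤ l) kt≡ (m∸n≡0⇒m≤n l≥))))
        (λ h → skipped (subst (_≡ 0) sub≡ h))
      where
      Q : Store → Set
      Q z = J (suc j) (run (τᵣ := rg τᵣ ⊞ rg kᵣ) z)
      t′ = setR jᵣ j t
      l = ar t LEN (rv t τᵣ)
      t″ = setR lᵣ l t′
      write = LST ⟦ rg τᵣ ⊞ rg lᵣ ⟧:= rg uᵣ ▹ LEN ⟦ rg τᵣ ⟧:= rg lᵣ ⊞ num 1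
      kt≡ : rv t kᵣ ≡ k
      kt≡ = trans (regs a kᵣ tt) (k≡ r)
      ut≡ : rv t uᵣ ≡ u
      ut≡ = trans (regs a uᵣ tt) u≡
      sub≡ : ar t SUB j ≡ ar s SUB j
      sub≡ = cong (λ f → f j) (arrs a SUB tt)
      l≡ : l ≡ ar t LEN (j * k)
      l≡ = cong (ar t LEN) τ≡
      τ′ : rv t τᵣ + rv t kᵣ ≡ suc j * k
      τ′ = trans (cong₂ _+_ τ≡ kt≡) (+-comm (j * k) k)
      keep : (∀ b → mask b k ≡ j → RowOf u t b → RowOf (suc u) t b) →
        Rows u s → ∀ b → (mask b k < suc j → RowOf (suc u) t b) × (suc j ≤ mask b k → RowOf u t b)
      keep h R b = (λ m< → <-or-≡ (m≤n⇒m<n∨m≡n (s≤s⁻¹ m<))) , λ j< → proj₂ (rows R b) (<⇒≤ j<)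
        where
        <-or-≡ : mask b k < j ⊎ mask b k ≡ j → RowOf (suc u) t b
        <-or-≡ (inj₁ m<j) = proj₁ (rows R b) m<j
        <-or-≡ (inj₂ m≡j) = h b m≡j (proj₂ (rows R b) (≤-reflexive (sym m≡j)))
      skipped : ar s SUB j ≡ 0 → Q t′
      skipped z = τ′ , keep (λ b m≡j → row-skip (trans (sym (sub b)) (cong nz (trans (cong (ar s SUB) m≡j) z))))
        , gr , <suc-elim j (λ i → ar s SUB i ≢ 0 → L₀ (i * k) < k → L₀ (i * k) < ar t LEN (i * k)) st (λ h → ⊥-elim (h z))
        , bd
      full : k ≤ l → Q t″
      full k≤l = τ′ , keep (λ b m≡j ρ → row-full (row-full-count ρ (subst (k ≤_) (trans l≡ (cong (λ z → ar t LEN (z * k)) (sym m≡j))) k≤l)) ρ)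
        , gr , <suc-elim j (λ i → ar s SUB i ≢ 0 → L₀ (i * k) < k → L₀ (i * k) < ar t LEN (i * k)) st
            (λ _ l<k → ≤-trans l<k (subst (k ≤_) l≡ k≤l))
        , bd
      pushed : ar s SUB j ≢ 0 → l < k → Q (run write t″)
      pushed z l<k = τ′ , rows′ , gr′ , st′ , bd′
        where
        A = ar t LEN
        B = ar t LST
        A′ = A [ rv t τᵣ ↦ l + 1 ]
        B′ = B [ rv t τᵣ + l ↦ rv t uᵣ ]
        rows′ : Rows u s → ∀ b → (mask b k < suc j → RowOf (suc u) (run write t″) b) × (suc j ≤ mask b k → RowOf u (run write t″) b)
        rows′ R b =
            (λ m< → <-or-≡ (m≤n⇒m<n∨m≡n (s≤s⁻¹ m<)))
          , (λ j< → append-other A B {j = j} {l} {rv t τᵣ} {rv t uᵣ} τ≡ refl l<k (λ e → <⇒≢ j< (sym e)) (proj₂ (rows R b) (<⇒≤ j<)))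
          where
          <-or-≡ : mask b k < j ⊎ mask b k ≡ j → RowOf (suc u) (run write t″) b
          <-or-≡ (inj₁ m<j) = append-other A B {j = j} {l} {rv t τᵣ} {rv t uᵣ} τ≡ refl l<k (<⇒≢ m<j) (proj₁ (rows R b) m<j)
          <-or-≡ (inj₂ m≡j) = subst (λ U → Row k (mayDoAll b) (suc U) (A′ (mask b k * k)) (λ e → B′ (mask b k * k + e))) ut≡
            (append-same A B {j = mask b k} {l} {rv t τᵣ} {rv t uᵣ} (trans τ≡ (cong (_* k) (sym m≡j))) refl l<k
              (trans (cong (mayDoAll b) ut≡) (trans (sym (sub b)) (nz-≢0 (subst (λ i → ar s SUB i ≢ 0) (sym m≡j) z))))
              (subst (λ U → Row k (mayDoAll b) U (A (mask b k * k)) (λ e → B (mask b k * k + e))) (sym ut≡)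
                (proj₂ (rows R b) (≤-reflexive (sym m≡j)))))
        up : ∀ x → A x ≤ A′ x
        up x with x ≟ rv t τᵣ
        ... | yes refl = ≤-trans (m≤m+n l 1) (≤-reflexive (sym (get-set A x (l + 1))))
        ... | no x≢    = ≤-reflexive (sym (get-set-≢ A (l + 1) x≢))
        gr′ : ∀ x → L₀ x ≤ A′ x
        gr′ x = ≤-trans (gr x) (up x)
        st′ : ∀ i → i < suc j → ar s SUB i ≢ 0 → L₀ (i * k) < k → L₀ (i * k) < A′ (i * k)
        st′ = <suc-elim j (λ i → ar s SUB i ≢ 0 → L₀ (i * k) < k → L₀ (i * k) < A′ (i * k))
          (λ i i<j h h′ → ≤-trans (st i i<j h h′) (up (i * k)))
          (λ _ _ → subst (λ x → L₀ x < A′ x) τ≡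
            (≤-trans (s≤s (gr (rv t τᵣ))) (≤-reflexive (trans (+-comm 1 l) (sym (get-set A (rv t τᵣ) (l + 1)))))))
        bd′ : (∀ x → L₀ x ≤ k) → ∀ x → A′ x ≤ k
        bd′ h x with x ≟ rv t τᵣ
        ... | yes refl = subst (_≤ k) (sym (get-set A x (l + 1))) (subst (_≤ k) (+-comm 1 l) l<k)
        ... | no x≢    = subst (_≤ k) (sym (get-set-≢ A (l + 1) x≢)) (bd h x)

  -- If `u` is skipped and satisfies `b`, then `b` is contained in the set of `u`. Each of the k
  -- users in the row of that set satisfies `b` too, so `u` would come too late for the row of `b`.
  addUser-rows : ∀ s {u} → Ready s → rv s uᵣ ≡ u → Rows u s → Rows (suc u) (run addUser s)
  addUser-rows s {u} r u≡ R =
    run-iff (Rows (suc u)) {rg kᵣ ⊟ LEN ⟦ rg τᵣ ⟧} {subsets ▹ push} {nop} s₁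
      (λ _ → proj₁ (push-spec (run subsets s₁) (ready-agree subsets tt (agree subsets s₁) r₁)
                (trans (frame subsets uᵣ tt s₁) u₁≡) (subsets-spec s₁ r₁ u₁≡))
          (rows-cong u s₁ (run subsets s₁) (frameA subsets LEN tt s₁) (frameA subsets LST tt s₁) R₁))
      (λ h b → keptFull b (m∸n≡0⇒m≤n h))
    where
    s₁ = run column s
    r₁ : Ready s₁
    r₁ = ready-agree column tt (agree column s) r
    u₁≡ : rv s₁ uᵣ ≡ u
    u₁≡ = trans (frame column uᵣ tt s) u≡
    R₁ : Rows u s₁
    R₁ = rows-cong u s s₁ (frameA column LEN tt s) (frameA column LST tt s) R
    keptFull : ∀ b → rv s₁ kᵣ ≤ ar s₁ LEN (rv s₁ τᵣ) →
      Row k (mayDoAll b) (suc u) (ar s₁ LEN (mask b k * k)) (λ e → ar s₁ LST (mask b k * k + e))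
    keptFull b h with mayDoAll b u in eq
    ... | false = row-skip eq (R₁ b)
    ... | true  = row-full
      (≤-trans (row-full-count (R₁ (mayDo u)) (subst₂ _≤_ (k≡ r₁) (cong (ar s₁ LEN) (column-spec s (k≡ r) (n≡ r) u≡)) h))
        (count-⊆ (mayDoAll (mayDo u)) (mayDoAll b) u λ v _ h → within-complete b (mayDo v) k
          λ t t<k bt → within-sound (mayDo u) (mayDo v) k h t t<k (within-sound b (mayDo u) k eq t t<k bt)))
      (R₁ b)

  users-rows : ∀ s → Ready s → (∀ x → ar s LEN x ≡ 0) → Rows n (run users s)
  users-rows s r empty = for-upto uᵣ nᵣ addUser Rows s (n≡ r) (λ _ _ _ R → R)
    (λ b → row (trans (empty _) (sym (m≥n⇒m⊓n≡n z≤n))) (λ _ ()))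
    λ u t _ a R → addUser-rows (setR uᵣ u t) (ready-agree users tt a r) refl R

-- The search

neq-0 : ∀ {a b} → (a ∸ b) + (b ∸ a) ≡ 0 → a ≡ b
neq-0 {a} {b} eq = ≤-antisym (m∸n≡0⇒m≤n (m+n≡0⇒m≡0 (a ∸ b) eq)) (m∸n≡0⇒m≤n (m+n≡0⇒n≡0 (a ∸ b) eq))

neq-≢0 : ∀ {a b} → (a ∸ b) + (b ∸ a) ≢ 0 → a ≢ b
neq-≢0 {a} h refl = h (cong₂ _+_ (n∸n≡0 a) (n∸n≡0 a))

≡ᵇ-true⁻¹ : ∀ {x y} → (x ≡ᵇ y) ≡ true → x ≡ y
≡ᵇ-true⁻¹ {x} {y} eq = ≡ᵇ⇒≡ x y (subst T (sym eq) tt)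

module Search (I : List ℕ) where
  open Correctness I

  power-spec : ∀ s → rv s kᵣ ≡ k → rv (run power s) powᵣ ≡ 2 ^ k
  power-spec s k≡ = for-upto sᵣ kᵣ (wᵣ := rg wᵣ ⊞ rg wᵣ) (λ i t → rv t wᵣ ≡ 2 ^ i) (run (wᵣ := num 1) s)
    k≡ (λ _ _ _ j → j) refl λ i t _ _ w≡ → trans (cong dbl w≡) (sym (cong (2 ^ i +_) (+-identityʳ (2 ^ i))))

  addTwice-spec : ∀ s {i} → rv s kᵣ ≡ k → rv s sᵣ ≡ i → rv s accᵣ ≡ 0 → i < k →
    rv (run (for tᵣ upto kᵣ ⟲ addTwice) s) accᵣ ≡ suc i * (rv s wᵣ + rv s wᵣ)
  addTwice-spec s {i} k≡ s≡ acc≡ i<k = proj₂ (for-upto tᵣ kᵣ addTwice J s k≡ (λ _ _ _ j → j)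
    ((λ _ → acc≡) , λ ()) step) i<k
    where
    w = rv s wᵣ + rv s wᵣ
    J : ℕ → Store → Set
    J j t = (j ≤ suc i → rv t accᵣ ≡ j * w) × (suc i ≤ j → rv t accᵣ ≡ suc i * w)
    step : ∀ j t → j < k → Agree (for tᵣ upto kᵣ ⟲ addTwice) t s → J j t → J (suc j) (run addTwice (setR tᵣ j t))
    step j t _ a (below , above) =
      run-iff (J (suc j)) {num 1 ⊞ rg sᵣ ⊟ rg tᵣ} {accᵣ := rg accᵣ ⊞ (rg wᵣ ⊞ rg wᵣ)} {nop} (setR tᵣ j t)
        (λ h → let j<i = subst (j <_) (cong suc s′≡) (m∸n≢0⇒n<m h)
                   eq = trans (cong₂ _+_ (below (<⇒≤ j<i)) (cong dbl (regs a wᵣ tt))) (+-comm (j * w) w) in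
          (λ _ → eq) , λ i<j → trans eq (cong (λ z → suc z * w) (≤-antisym (s≤s⁻¹ j<i) (s≤s⁻¹ i<j))))
        (λ h → let i≤j = subst (_≤ j) (cong suc s′≡) (m∸n≡0⇒m≤n h) in
          (λ j≤i → ⊥-elim (<-irrefl refl (≤-trans (s≤s i≤j) j≤i))) , λ _ → above i≤j)
      where
      s′≡ : rv t sᵣ ≡ i
      s′≡ = trans (regs a sᵣ tt) s≡

  candidates-spec : ∀ s → rv s kᵣ ≡ k → rv (run candidates s) numᵣ ≡ weakOrders k
  candidates-spec s k≡ = for-upto sᵣ kᵣ body (λ i t → rv t wᵣ ≡ weakOrders i) (run (wᵣ := num 1) s)
    k≡ (λ _ _ _ j → j) refl λ i t i<k a w≡ →
      trans (addTwice-spec (run (accᵣ := num 0) (setR sᵣ i t)) (trans (regs a kᵣ tt) k≡) refl refl i<k)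
        (cong (λ z → suc i * (z + z)) w≡)
    where
    body = accᵣ := num 0 ▹ (for tᵣ upto kᵣ ⟲ addTwice) ▹ wᵣ := rg accᵣ

  base-spec : ∀ s → rv s kᵣ ≡ k → rv s nᵣ ≡ n → rv (run constraintBase s) baseᵣ ≡ 3 + k * n
  base-spec s k≡ n≡ = for-upto sᵣ kᵣ (qᵣ := rg qᵣ ⊞ rg nᵣ) (λ i t → rv t qᵣ ≡ 3 + i * n) (run (qᵣ := num 3) s)
    k≡ (λ _ _ _ j → j) refl λ i t _ a q≡ → trans (cong₂ _+_ q≡ (trans (regs a nᵣ tt) n≡)) (next i n)
    where
    next : ∀ i n → 3 + i * n + n ≡ 3 + suc i * n
    next = solve-∀

  RelN : ℕ → ℕ → ℕ → Set
  RelN ρ a b = (ρ ≢ 0 × a ≢ b) ⊎ (ρ ≡ 0 × a ≡ b)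

  conAt : ℕ → ℕ
  conAt j = 3 + k * n + j * (1 + (k + k))

  SatPair : (ℕ → ℕ) → ℕ → ℕ → ℕ → Set
  SatPair p q s t = I at (q + (1 + s)) ≢ 0 × I at (q + (1 + (k + t))) ≢ 0 × RelN (I at q) (p s) (p t)

  SatN : (ℕ → ℕ) → ℕ → Set
  SatN p q = ∃[ s ] ∃[ t ] s < k × t < k × SatPair p q s t

  AuthN : (ℕ → ℕ) → Set
  AuthN p = ∀ t → t < k → p t < n × mayDo (p t) t ≡ true

  ValidN : (ℕ → ℕ) → Set
  ValidN p = AuthN p × (∀ j → j < c → SatN p (conAt j))

  satN-cong : ∀ {p p′ q} → (∀ s t → s < k → t < k → (p s ≡ p t → p′ s ≡ p′ t) × (p′ s ≡ p′ t → p s ≡ p t)) →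
    SatN p q → SatN p′ q
  satN-cong h (s , t , s<k , t<k , i₁ , i₂ , rel) = s , t , s<k , t<k , i₁ , i₂ , go rel
    where
    go : RelN _ _ _ → RelN _ _ _
    go (inj₁ (ρ≢0 , ne)) = inj₁ (ρ≢0 , λ eq → ne (proj₂ (h s t s<k t<k) eq))
    go (inj₂ (ρ≡0 , eq)) = inj₂ (ρ≡0 , proj₁ (h s t s<k t<k) eq)

  shiftRank-spec : ∀ s {i δ} → rv s kᵣ ≡ k → rv s sᵣ ≡ i → rv s accᵣ ≡ δ ∸ suc i → isNew i δ ≡ true → i < k →
    ∀ u → u < i → ar (run (for tᵣ upto kᵣ ⟲ shiftRank) s) RNK u ≡ shift i δ (ar s RNK u)
  shiftRank-spec s {i} {δ} k≡ s≡ acc≡ new i<k u u<i = proj₁ (for-upto tᵣ kᵣ shiftRank J s k≡ (λ _ _ _ j → j)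
    ((λ _ ()) , λ _ _ _ → refl) step) u (<-trans u<i i<k) u<i
    where
    R = ar s RNK
    J : ℕ → Store → Set
    J j t = (∀ u → u < j → u < i → ar t RNK u ≡ shift i δ (R u)) × (∀ u → j ≤ u → u < i → ar t RNK u ≡ R u)
    step : ∀ j t → j < k → Agree (for tᵣ upto kᵣ ⟲ shiftRank) t s → J j t → J (suc j) (run shiftRank (setR tᵣ j t))
    step j t _ a (done , todo) =
      run-iff (J (suc j)) {rg sᵣ ⊟ rg tᵣ} {RNK ⟦ rg tᵣ ⟧:= RNK ⟦ rg tᵣ ⟧ ⊞ (num 1 ⊟ (rg accᵣ ⊟ RNK ⟦ rg tᵣ ⟧))} {nop} (setR tᵣ j t)
        (λ h → let j<i = subst (j <_) s′≡ (m∸n≢0⇒n<m h) in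
            <suc-elim j (λ u → u < i → (R′ [ j ↦ v ]) u ≡ shift i δ (R u))
              (λ u u<j u<i → trans (get-set-≢ R′ v (<⇒≢ u<j)) (done u u<j u<i))
              (λ _ → trans (get-set R′ j v) (v≡ (todo j ≤-refl j<i)))
          , λ u j<u u<i → trans (get-set-≢ R′ v (>⇒≢ j<u)) (todo u (<⇒≤ j<u) u<i))
        (λ h → let i≤j = subst (_≤ j) s′≡ (m∸n≡0⇒m≤n h) in
            (λ u _ u<i → done u (<-≤-trans u<i i≤j) u<i)
          , λ u j<u u<i → ⊥-elim (<-irrefl refl (<-trans u<i (≤-<-trans i≤j j<u))))
      where
      R′ = ar t RNK
      v = R′ j + (1 ∸ (rv t accᵣ ∸ R′ j))
      s′≡ : rv t sᵣ ≡ i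
      s′≡ = trans (regs a sᵣ tt) s≡
      v≡ : R′ j ≡ R j → v ≡ shift i δ (R j)
      v≡ eq rewrite eq | trans (regs a accᵣ tt) acc≡ | new = refl

  decode-spec : ∀ s → rv s kᵣ ≡ k → ∀ u → u < k → ar (run decode s) RNK u ≡ ranks (ar s DIG) k u
  decode-spec s k≡ = for-upto sᵣ kᵣ body J s k≡ (λ _ _ _ j → j) (λ _ ()) step
    where
    d = ar s DIG
    body = accᵣ := DIG ⟦ rg sᵣ ⟧ ▹ insert
    J : ℕ → Store → Set
    J i t = ∀ u → u < i → ar t RNK u ≡ ranks d i u
    step : ∀ i t → i < k → Agree decode t s → J i t → J (suc i) (run body (setR sᵣ i t))
    step i t i<k a eqs =
      run-iff (J (suc i)) {rg accᵣ ⊟ rg sᵣ} {fresh-class} {RNK ⟦ rg sᵣ ⟧:= rg accᵣ} t′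
        (λ h → put (run (for tᵣ upto kᵣ ⟲ shiftRank) t″) (d i ∸ suc i)
          (sym (if-true (new h)))
          (λ u u<i → trans (shiftRank-spec t″ {i} {d i} (trans (regs a kᵣ tt) k≡) refl
                              (cong (_∸ suc i) δ≡) (new h) i<k u u<i)
                       (cong (shift i (d i)) (eqs u u<i)))
          (trans (frame (for tᵣ upto kᵣ ⟲ shiftRank) sᵣ tt t″) refl)
          (trans (frame (for tᵣ upto kᵣ ⟲ shiftRank) accᵣ tt t″) (cong (_∸ suc i) δ≡)))
        (λ h → put t′ (d i) (sym (if-false (old h)))
          (λ u u<i → trans (eqs u u<i) (sym (shift-same (old h) (ranks d i u)))) refl δ≡)
      where
      fresh-class = accᵣ := rg accᵣ ⊟ (num 1 ⊞ rg sᵣ) ▹ (for tᵣ upto kᵣ ⟲ shiftRank) ▹ RNK ⟦ rg sᵣ ⟧:= rg accᵣ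
      t′ = run (accᵣ := DIG ⟦ rg sᵣ ⟧) (setR sᵣ i t)
      t″ = run (accᵣ := rg accᵣ ⊟ (num 1 ⊞ rg sᵣ)) t′
      δ≡ : ar t DIG i ≡ d i
      δ≡ = cong (λ f → f i) (arrs a DIG tt)
      new : ar t DIG i ∸ i ≢ 0 → isNew i (d i) ≡ true
      new h = nz-≢0 (subst (λ z → z ∸ i ≢ 0) δ≡ h)
      old : ar t DIG i ∸ i ≡ 0 → isNew i (d i) ≡ false
      old h = nz-0 (subst (λ z → z ∸ i ≡ 0) δ≡ h)
      if-true : isNew i (d i) ≡ true → rankOf i (d i) ≡ d i ∸ suc i
      if-true eq rewrite eq = refl
      if-false : isNew i (d i) ≡ false → rankOf i (d i) ≡ d i
      if-false eq rewrite eq = refl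
      shift-same : isNew i (d i) ≡ false → ∀ v → shift i (d i) v ≡ v
      shift-same eq v rewrite eq = refl
      put : ∀ z r → r ≡ rankOf i (d i) → (∀ u → u < i → ar z RNK u ≡ shift i (d i) (ranks d i u)) →
        rv z sᵣ ≡ i → rv z accᵣ ≡ r → J (suc i) (run (RNK ⟦ rg sᵣ ⟧:= rg accᵣ) z)
      put z r r≡ olds s≡ acc≡ rewrite s≡ | acc≡ = <suc-elim i (λ u → (ar z RNK [ i ↦ r ]) u ≡ ranks d (suc i) u)
        (λ u u<i → trans (get-set-≢ (ar z RNK) r (<⇒≢ u<i))
                     (trans (olds u u<i) (sym (insertStep-old {i} {d i} (ranks d i) u<i))))
        (trans (get-set (ar z RNK) i r) (trans r≡ (sym (insertStep-new {i} {d i} (ranks d i)))))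

  classOf : (ℕ → ℕ) → ℕ → ℕ → Bool
  classOf ρ v t = ρ t ≡ᵇ v

  classMask-spec : ∀ s {v} → rv s kᵣ ≡ k → rv s vᵣ ≡ v → let t = run classMask s ; ρ = ar s RNK in
    rv t τᵣ ≡ mask (classOf ρ v) k * k
    × (rv t hitᵣ ≡ 0 → ∀ u → u < k → ρ u ≢ v)
    × (rv t hitᵣ ≢ 0 → ∃[ u ] u < k × ρ u ≡ v)
  classMask-spec s {v} k≡ v≡ =
    let _ , τ≡ , absent , present = for-upto sᵣ kᵣ body J s₀ k≡ (λ _ _ _ j → j)
          (trans k≡ (sym (+-identityʳ k)) , refl , (λ _ _ ()) , λ h → ⊥-elim (h refl)) step
    in τ≡ , absent , λ h → let u , u<k , eq = present h in u , u<k , eq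
    where
    ρ = ar s RNK
    rest add : Cmd
    rest = wᵣ := rg wᵣ ⊞ rg wᵣ
    add = τᵣ := rg τᵣ ⊞ rg wᵣ ▹ hitᵣ := num 1
    body = iff (neq (RNK ⟦ rg sᵣ ⟧) (rg vᵣ)) nop add ▹ rest
    s₀ = run (hitᵣ := num 0 ▹ τᵣ := num 0 ▹ wᵣ := rg kᵣ) s
    J : ℕ → Store → Set
    J i t = rv t wᵣ ≡ 2 ^ i * k × rv t τᵣ ≡ mask (classOf ρ v) i * k
      × (rv t hitᵣ ≡ 0 → ∀ u → u < i → ρ u ≢ v)
      × (rv t hitᵣ ≢ 0 → ∃[ u ] u < i × ρ u ≡ v)
    step : ∀ i t → i < k → Agree (for sᵣ upto kᵣ ⟲ body) t s₀ → J i t → J (suc i) (run body (setR sᵣ i t))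
    step i t _ a (w≡ , τ≡ , absent , present) =
      run-iff (λ z → J (suc i) (run rest z)) {neq (RNK ⟦ rg sᵣ ⟧) (rg vᵣ)} {nop} {add} (setR sᵣ i t)
        (λ h → let ne = out h in
            w′ , trans τ≡ (sym (left ne))
          , (λ z → <suc-elim i (λ u → ρ u ≢ v) (absent z) ne)
          , (λ z → let u , u<i , eq = present z in u , m≤n⇒m≤1+n u<i , eq))
        (λ h → let eq = into h in
            w′ , trans (cong₂ _+_ τ≡ w≡) (sym (taken eq)) , (λ ()) , λ _ → i , ≤-refl , eq)
      where
      ρ≡ : ar t RNK i ≡ ρ i
      ρ≡ = cong (λ f → f i) (arrs a RNK tt)
      v′≡ : rv t vᵣ ≡ v
      v′≡ = trans (regs a vᵣ tt) v≡
      out : ev (setR sᵣ i t) (neq (RNK ⟦ rg sᵣ ⟧) (rg vᵣ)) ≢ 0 → ρ i ≢ v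
      out h eq = neq-≢0 h (trans ρ≡ (trans eq (sym v′≡)))
      into : ev (setR sᵣ i t) (neq (RNK ⟦ rg sᵣ ⟧) (rg vᵣ)) ≡ 0 → ρ i ≡ v
      into h = trans (sym ρ≡) (trans (neq-0 h) v′≡)
      w′ : rv t wᵣ + rv t wᵣ ≡ 2 ^ suc i * k
      w′ rewrite w≡ = double (2 ^ i) k
        where
        double : ∀ p k → p * k + p * k ≡ 2 * p * k
        double = solve-∀
      left : ρ i ≢ v → mask (classOf ρ v) (suc i) * k ≡ mask (classOf ρ v) i * k
      left ne rewrite ≢⇒≡ᵇ-false ne = refl
      taken : ρ i ≡ v → mask (classOf ρ v) (suc i) * k ≡ mask (classOf ρ v) i * k + 2 ^ i * k
      taken eq rewrite eq | ≡ᵇ-refl v =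
        trans (*-distribʳ-+ k (2 ^ i) (mask (classOf ρ v) i)) (+-comm (2 ^ i * k) _)

  firstFree-spec : ∀ s {x} → rv s kᵣ ≡ k → rv s xᵣ ≡ x →
    let t = run firstFree s ; len = ar s LEN (rv s τᵣ) ; ent = λ e → ar s LST (rv s τᵣ + e) in
    len ≤ k →
    (rv t fndᵣ ≡ 0 → ∀ e → e < len → x < ar s MRK (ent e))
    × (rv t fndᵣ ≢ 0 → ∃[ e ] e < len × rv t pickᵣ ≡ ent e × ar s MRK (ent e) ≤ x
                              × (∀ e′ → e′ < e → x < ar s MRK (ent e′)))
  firstFree-spec s {x} k≡ x≡ len≤k =
    let absent , present = for-upto iᵣ kᵣ tryEntry J s₀ k≡ (λ _ _ _ j → j) ((λ _ _ ()) , λ h → ⊥-elim (h refl)) step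
    in (λ z e e<len → absent z e (≤-trans e<len len≤k) e<len) , present
    where
    s₀ = run (fndᵣ := num 0) s
    M = ar s MRK
    len = ar s LEN (rv s τᵣ)
    ent : ℕ → ℕ
    ent e = ar s LST (rv s τᵣ + e)
    J : ℕ → Store → Set
    J i t = (rv t fndᵣ ≡ 0 → ∀ e → e < i → e < len → x < M (ent e))
      × (rv t fndᵣ ≢ 0 → ∃[ e ] e < len × rv t pickᵣ ≡ ent e × M (ent e) ≤ x
                                × (∀ e′ → e′ < e → x < M (ent e′)))
    step : ∀ i t → i < k → Agree (for iᵣ upto kᵣ ⟲ tryEntry) t s₀ → J i t → J (suc i) (run tryEntry (setR iᵣ i t))
    step i t _ a (absent , present) =
      run-iff (J (suc i)) {LEN ⟦ rg τᵣ ⟧ ⊟ rg iᵣ} {iff (rg fndᵣ) nop look} {nop} t′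
        (λ h → let i<len = subst (i <_) len≡ (m∸n≢0⇒n<m h) in
          run-iff (J (suc i)) {rg fndᵣ} {nop} {look} t′
            (λ f → (λ z → ⊥-elim (f z)) , present)
            (λ f → run-iff (J (suc i)) {stamp ⊟ MRK ⟦ rg accᵣ ⟧} {found} {nop} t″
              (λ g → (λ ()) , λ _ → i , i<len , ent≡ , subst (_≤ x) mrk≡ (s≤s⁻¹ (subst (ar t MRK (ar t LST (rv t τᵣ + i)) <_) stamp≡ (m∸n≢0⇒n<m g)))
                   , λ e′ e′<i → absent f e′ e′<i (<-trans e′<i i<len))
              (λ g → (λ _ → <suc-elim i (λ e → e < len → x < M (ent e)) (absent f)
                        (λ _ → subst₂ _≤_ stamp≡ mrk≡ (m∸n≡0⇒m≤n g)))
                   , λ z → ⊥-elim (z f))))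
        (λ h → let len≤i = subst (_≤ i) len≡ (m∸n≡0⇒m≤n h) in
            (λ z → <suc-elim i (λ e → e < len → x < M (ent e)) (absent z)
                     (λ i<len → ⊥-elim (<-irrefl refl (≤-trans i<len len≤i))))
          , present)
      where
      found look : Cmd
      found = fndᵣ := num 1 ▹ pickᵣ := rg accᵣ
      look = accᵣ := LST ⟦ rg τᵣ ⊞ rg iᵣ ⟧ ▹ iff (stamp ⊟ MRK ⟦ rg accᵣ ⟧) found nop
      t′ = setR iᵣ i t
      t″ = run (accᵣ := LST ⟦ rg τᵣ ⊞ rg iᵣ ⟧) t′
      len≡ : ar t LEN (rv t τᵣ) ≡ len
      len≡ = cong₂ (λ f z → f z) (arrs a LEN tt) (regs a τᵣ tt)
      ent≡ : ar t LST (rv t τᵣ + i) ≡ ent i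
      ent≡ = cong₂ (λ f z → f (z + i)) (arrs a LST tt) (regs a τᵣ tt)
      mrk≡ : ar t MRK (ar t LST (rv t τᵣ + i)) ≡ M (ent i)
      mrk≡ = cong₂ (λ f z → f z) (arrs a MRK tt) ent≡
      stamp≡ : rv t xᵣ + 1 ≡ suc x
      stamp≡ = trans (cong (_+ 1) (trans (regs a xᵣ tt) x≡)) (+-comm x 1)

  -- What serving the class v of the ranks ρ does to the marks M, the picks P
  -- and the failure flag f.
  data Served (x v : ℕ) (ρ M P : ℕ → ℕ) (f : ℕ) : (M′ P′ : ℕ → ℕ) → ℕ → Set where
    empty : ∀ {f′} → (∀ u → u < k → ρ u ≢ v) → f′ ≡ f → Served x v ρ M P f M P f′
    picked : ∀ {f′} w y → w < k → ρ w ≡ v →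
      y < n → mayDoAll (classOf ρ v) y ≡ true → M y ≤ x →
      (∀ z → z < y → mayDoAll (classOf ρ v) z ≡ true → x < M z) → f′ ≡ f →
      Served x v ρ M P f (M [ y ↦ suc x ]) (P [ v ↦ y ]) f′
    failed : ∀ {f′} w → w < k → ρ w ≡ v →
      (∀ z → z < n → mayDoAll (classOf ρ v) z ≡ true → count (mayDoAll (classOf ρ v)) z < k → x < M z) →
      f′ ≢ 0 → Served x v ρ M P f M P f′

  takeMarked : Cmd
  takeMarked = MRK ⟦ rg pickᵣ ⟧:= stamp ▹ PCK ⟦ rg vᵣ ⟧:= rg pickᵣ

  takeMarked-spec : ∀ t {x v ρ M P f w y} → ar t MRK ≡ M → ar t PCK ≡ P → rv t failᵣ ≡ f →
    rv t xᵣ ≡ x → rv t vᵣ ≡ v → rv t pickᵣ ≡ y → w < k → ρ w ≡ v →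
    y < n → mayDoAll (classOf ρ v) y ≡ true → M y ≤ x →
    (∀ z → z < y → mayDoAll (classOf ρ v) z ≡ true → x < M z) →
    let t′ = run takeMarked t in Served x v ρ M P f (ar t′ MRK) (ar t′ PCK) (rv t′ failᵣ)
  takeMarked-spec t {x} {v} {ρ} refl refl refl refl refl refl w<k ρw y<n gy My before =
    subst (λ z → Served x v ρ (ar t MRK) (ar t PCK) (rv t failᵣ) (ar t MRK [ rv t pickᵣ ↦ z ]) (ar t PCK [ v ↦ rv t pickᵣ ]) (rv t failᵣ))
      (+-comm 1 x) (picked _ _ w<k ρw y<n gy My before refl)

  served-empty : ∀ t {x v ρ M P f} → ar t MRK ≡ M → ar t PCK ≡ P → rv t failᵣ ≡ f → (∀ u → u < k → ρ u ≢ v) →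
    Served x v ρ M P f (ar t MRK) (ar t PCK) (rv t failᵣ)
  served-empty t refl refl refl h = empty h refl

  served-failed : ∀ t {x v ρ M P f w} → ar t MRK ≡ M → ar t PCK ≡ P → w < k → ρ w ≡ v →
    (∀ z → z < n → mayDoAll (classOf ρ v) z ≡ true → count (mayDoAll (classOf ρ v)) z < k → x < M z) →
    Served x v ρ M P f (ar t MRK) (ar t PCK) 1
  served-failed t refl refl w<k ρw h = failed _ w<k ρw h λ ()

  -- The entry number `count g z` increases with the user, so the first free entry is the least free
  -- user of the class: every smaller candidate stands before it in the row and was seen to be
  -- taken.
  serveClass-spec : ∀ s {x v} → Ready s → Rows n s → rv s xᵣ ≡ x → rv s vᵣ ≡ v →
    let t = run serveClass s in
    Served x v (ar s RNK) (ar s MRK) (ar s PCK) (rv s failᵣ) (ar t MRK) (ar t PCK) (rv t failᵣ)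
  serveClass-spec s {x} {v} r R x≡ v≡ = run-iff Q {rg hitᵣ} {firstFree ▹ take} {nop} s₁
    (λ h → run-iff Q {rg fndᵣ} {takeMarked} {failᵣ := num 1} s₂
      (λ f → success (proj₂ (proj₂ class) h) (proj₂ free f))
      (λ f → failure (proj₂ (proj₂ class) h) (proj₁ free f)))
    (λ h → served-empty s₁ M₁ (frameA classMask PCK tt s) (frame classMask failᵣ tt s) (proj₁ (proj₂ class) h))
    where
    ρ = ar s RNK
    b = classOf ρ v
    g = mayDoAll b
    s₁ = run classMask s
    s₂ = run firstFree s₁
    Q : Store → Set
    Q t = Served x v ρ (ar s MRK) (ar s PCK) (rv s failᵣ) (ar t MRK) (ar t PCK) (rv t failᵣ)
    class = classMask-spec s (k≡ r) v≡
    M = ar s MRK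
    len = ar s₁ LEN (rv s₁ τᵣ)
    ent : ℕ → ℕ
    ent e = ar s₁ LST (rv s₁ τᵣ + e)
    R₁ : Row k g n len ent
    R₁ = subst (λ z → Row k g n (ar s₁ LEN z) (λ e → ar s₁ LST (z + e))) (sym (proj₁ class))
      (rows-cong n s s₁ (frameA classMask LEN tt s) (frameA classMask LST tt s) R b)
    M₁ : ar s₁ MRK ≡ M
    M₁ = frameA classMask MRK tt s
    mark≡ : ∀ y → ar s₁ MRK y ≡ M y
    mark≡ y = cong (λ f → f y) M₁
    x₁ : rv s₁ xᵣ ≡ x
    x₁ = trans (frame classMask xᵣ tt s) x≡
    free = firstFree-spec s₁ (trans (frame classMask kᵣ tt s) (k≡ r)) x₁ (row-len≤ R₁)
    M₂ : ar s₂ MRK ≡ M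
    M₂ = trans (frameA firstFree MRK tt s₁) M₁
    P₂ : ar s₂ PCK ≡ ar s PCK
    P₂ = trans (frameA firstFree PCK tt s₁) (frameA classMask PCK tt s)
    success : (∃[ u ] u < k × ρ u ≡ v) →
      (∃[ e ] e < len × rv s₂ pickᵣ ≡ ent e × ar s₁ MRK (ent e) ≤ x × (∀ e′ → e′ < e → x < ar s₁ MRK (ent e′))) →
      Q (run takeMarked s₂)
    success (w , w<k , ρw) (e , e<len , pick≡ , unmarked , before) =
      let ent<n , g-ent , c≡ = row-entry R₁ e<len in
      takeMarked-spec s₂ M₂ P₂
        (trans (frame firstFree failᵣ tt s₁) (frame classMask failᵣ tt s))
        (trans (frame firstFree xᵣ tt s₁) x₁)
        (trans (frame firstFree vᵣ tt s₁) (trans (frame classMask vᵣ tt s) v≡))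
        pick≡ w<k ρw ent<n g-ent (subst (_≤ x) (mark≡ (ent e)) unmarked)
        λ z z<y gz → let c< = subst (count g z <_) c≡ (count-strict g gz z<y) in
          subst (x <_) (trans (mark≡ (ent (count g z)))
              (cong M (entry≡ R₁ z (<-trans z<y ent<n) gz (<-≤-trans c< (<⇒≤ (<-≤-trans e<len (row-len≤ R₁)))))))
            (before (count g z) c<)
    failure : (∃[ u ] u < k × ρ u ≡ v) → (∀ e → e < len → x < ar s₁ MRK (ent e)) → Q (run (failᵣ := num 1) s₂)
    failure (w , w<k , ρw) all = served-failed s₂ M₂ P₂ w<k ρw
      λ z z<n gz c<k → subst (x <_) (trans (mark≡ (ent (count g z))) (cong M (entry≡ R₁ z z<n gz c<k)))
        (all (count g z) (subst (count g z <_) (sym (length≡ R₁)) (⊓-glb c<k (count-strict g gz z<n))))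

  greedy-loop : ∀ {ℓ} (J : ℕ → Store → Set ℓ) s {x} → Ready s → Rows n s → rv s xᵣ ≡ x →
    (∀ i v t → J i t → J i (setR vᵣ v t)) → J 0 (run (failᵣ := num 0) s) →
    (∀ v t → v < k → ar t RNK ≡ ar s RNK → Ready t → Rows n t → rv t xᵣ ≡ x → J v t →
      J (suc v) (run serveClass (setR vᵣ v t))) →
    J k (run greedy s)
  greedy-loop J s r R x≡ stable j₀ step =
    for-upto vᵣ kᵣ serveClass J (run (failᵣ := num 0) s) (k≡ r) stable j₀
      λ v t v<k a j → step v t v<k (arrs a RNK tt) (ready-agree (for vᵣ upto kᵣ ⟲ serveClass) tt a r)
        (rows-cong n s t (arrs a LEN tt) (arrs a LST tt) R)
        (trans (regs a xᵣ tt) x≡) j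

  -- Holds for every candidate, also for those that no valid plan follows; the bound on the marks is
  -- what makes the next stamp fresh.
  greedy-sound : ∀ s {x} → Ready s → Rows n s → rv s xᵣ ≡ x → (∀ u → ar s MRK u ≤ x) →
    let t = run greedy s ; ρ = ar s RNK in
    (∀ u → ar t MRK u ≤ suc x)
    × (rv t failᵣ ≡ 0 → ∀ u → u < k → ρ u < k → ar t PCK (ρ u) < n × mayDo (ar t PCK (ρ u)) u ≡ true)
  greedy-sound s {x} r R x≡ marks = greedy-loop J s r R x≡ (λ _ _ _ j → j) ((λ u → m≤n⇒m≤1+n (marks u)) , λ _ _ _ ()) step
    where
    ρ = ar s RNK
    J : ℕ → Store → Set
    J v t = (∀ u → ar t MRK u ≤ suc x)
      × (rv t failᵣ ≡ 0 → ∀ u → u < k → ρ u < v → ar t PCK (ρ u) < n × mayDo (ar t PCK (ρ u)) u ≡ true)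
    step : ∀ v t → v < k → ar t RNK ≡ ρ → Ready t → Rows n t → rv t xᵣ ≡ x → J v t → J (suc v) (run serveClass (setR vᵣ v t))
    step v t v<k ρ≡ r R x≡ (mk , sound) = served (serveClass-spec (setR vᵣ v t) {x} {v} r R x≡ refl)
      where
      served : ∀ {M′ P′ f′} → Served x v (ar t RNK) (ar t MRK) (ar t PCK) (rv t failᵣ) M′ P′ f′ →
        (∀ u → M′ u ≤ suc x) × (f′ ≡ 0 → ∀ u → u < k → ρ u < suc v → P′ (ρ u) < n × mayDo (P′ (ρ u)) u ≡ true)
      served (empty vacant f≡) = mk , λ f u u<k ρu< →
        sound (trans (sym f≡) f) u u<k (≤∧≢⇒< (s≤s⁻¹ ρu<) (λ eq → vacant u u<k (trans (cong (λ h → h u) ρ≡) eq)))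
      served (failed _ _ _ _ f≢0) = mk , λ f → ⊥-elim (f≢0 f)
      served (picked _ y _ _ y<n gy _ _ f≡) = mk′ , λ f u u<k ρu< → at (trans (sym f≡) f) u u<k (m≤n⇒m<n∨m≡n (s≤s⁻¹ ρu<))
        where
        mk′ : ∀ u → (ar t MRK [ y ↦ suc x ]) u ≤ suc x
        mk′ u with u ≟ y
        ... | yes refl = ≤-reflexive (get-set (ar t MRK) u (suc x))
        ... | no u≢y   = ≤-trans (≤-reflexive (get-set-≢ (ar t MRK) (suc x) u≢y)) (mk u)
        at : rv t failᵣ ≡ 0 → ∀ u → u < k → ρ u < v ⊎ ρ u ≡ v →
          (ar t PCK [ v ↦ y ]) (ρ u) < n × mayDo ((ar t PCK [ v ↦ y ]) (ρ u)) u ≡ true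
        at f u u<k (inj₁ ρu<v) rewrite get-set-≢ (ar t PCK) {v} y (<⇒≢ ρu<v) = sound f u u<k ρu<v
        at f u u<k (inj₂ ρu≡v) rewrite ρu≡v | get-set (ar t PCK) v y =
          y<n , within-sound (classOf (ar t RNK) v) (mayDo y) k gy u u<k
            (trans (cong (_≡ᵇ v) (trans (cong (λ h → h u) ρ≡) ρu≡v)) (≡ᵇ-refl v))

  -- If the ranks order the steps as a plan π does, then the pick for the class
  -- of u never exceeds π u: the earlier picks are below the earlier values of
  -- π, so π u is still free.
  greedy-complete : ∀ s {x π} → Ready s → Rows n s → rv s xᵣ ≡ x → (∀ u → ar s MRK u ≤ x) →
    AuthN π → Tracks π (ar s RNK) k → (∀ u → u < k → ar s RNK u < k) →
    let t = run greedy s ; ρ = ar s RNK in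
    rv t failᵣ ≡ 0 × (∀ u w → u < k → w < k → ρ u ≢ ρ w → ar t PCK (ρ u) ≢ ar t PCK (ρ w))
  greedy-complete s {x} {π} r R x≡ marks auth tr ρ<k =
    let f≡ , _ , _ , _ , distinct = greedy-loop J s r R x≡ (λ _ _ _ j → j)
          (refl , (λ _ _ ()) , (λ u h → ⊥-elim (<-irrefl refl (≤-trans h (marks u)))) , (λ _ _ ()) , λ _ _ _ _ ()) step
    in f≡ , λ u w u<k w<k ne → distinct u w u<k w<k (ρ<k u u<k) (ρ<k w w<k) ne
    where
    ρ = ar s RNK
    -- Marks and picks are related in both directions. A mark above `x` stems from an earlier
    -- nonempty class, which yields `μ-free` and the pigeonhole argument; every pick is marked,
    -- which keeps later picks distinct from it.
    Jv : ℕ → (ℕ → ℕ) → (ℕ → ℕ) → ℕ → Set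
    Jv v M P f = f ≡ 0
      × (∀ u → u < k → ρ u < v → P (ρ u) ≤ π u)
      × (∀ y → x < M y → ∃[ i ] i < v × P i ≡ y × (∃[ u ] u < k × ρ u ≡ i))
      × (∀ u → u < k → ρ u < v → x < M (P (ρ u)))
      × (∀ u w → u < k → w < k → ρ u < v → ρ w < v → ρ u ≢ ρ w → P (ρ u) ≢ P (ρ w))
    J : ℕ → Store → Set
    J v t = Jv v (ar t MRK) (ar t PCK) (rv t failᵣ)
    step : ∀ v t → v < k → ar t RNK ≡ ρ → Ready t → Rows n t → rv t xᵣ ≡ x → J v t → J (suc v) (run serveClass (setR vᵣ v t))
    step v t v<k ρ≡ r R x≡ (f≡0 , low , marked , stamped , distinct) =
      served (serveClass-spec (setR vᵣ v t) {x} {v} r R x≡ refl)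
      where
      M = ar t MRK
      P = ar t PCK
      b = classOf (ar t RNK) v
      g = mayDoAll b
      ρ-at : ∀ {u i} → ar t RNK u ≡ i → ρ u ≡ i
      ρ-at {u} eq = trans (cong (λ h → h u) (sym ρ≡)) eq
      module Class (w : ℕ) (w<k : w < k) (ρw≡v : ρ w ≡ v) where
        μ = π w
        gμ : g μ ≡ true
        gμ = within-complete b (mayDo μ) k λ u u<k bu →
          subst (λ z → mayDo z u ≡ true) (tracks-≡⁻¹ tr u w u<k w<k (trans (ρ-at (≡ᵇ-true⁻¹ bu)) (sym ρw≡v)))
            (proj₂ (auth u u<k))
        μ-free : ¬ (x < M μ)
        μ-free h with marked μ h
        ... | i , i<v , Pi≡μ , u , u<k , ρu≡i = <-irrefl refl
          (≤-trans (tracks-<⁻¹ tr u w u<k w<k (subst₂ _<_ (sym ρu≡i) (sym ρw≡v) i<v))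
            (≤-trans (≤-reflexive (trans (sym Pi≡μ) (cong P (sym ρu≡i)))) (low u u<k (subst (_< v) (sym ρu≡i) i<v))))
      served : ∀ {M′ P′ f′} → Served x v (ar t RNK) M P (rv t failᵣ) M′ P′ f′ → Jv (suc v) M′ P′ f′
      served (empty vacant f≡) =
          trans f≡ f≡0
        , (λ u u<k lt → low u u<k (shrink u u<k lt))
        , (λ y h → let i , i<v , eq , w = marked y h in i , m≤n⇒m≤1+n i<v , eq , w)
        , (λ u u<k lt → stamped u u<k (shrink u u<k lt))
        , λ u w u<k w<k lt lt′ → distinct u w u<k w<k (shrink u u<k lt) (shrink w w<k lt′)
        where
        shrink : ∀ u → u < k → ρ u < suc v → ρ u < v
        shrink u u<k lt = ≤∧≢⇒< (s≤s⁻¹ lt) (λ eq → vacant u u<k (trans (cong (λ h → h u) ρ≡) eq))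
      -- Either `π w` is among the first k users of the class, and then it is both free and taken;
      -- or k users of the class precede it, all taken, although fewer than k classes have been
      -- served.
      served (failed w w<k ρw all _) with count g (π w) <? k
      ... | yes c<k = ⊥-elim (μ-free (all (π w) (proj₁ (auth w w<k)) gμ c<k))
        where open Class w w<k (ρ-at ρw)
      ... | no  c≮k = ⊥-elim (pigeonhole-ℕ entry P v<k
              (λ e e′ e<e′ e′<k eq → <⇒≢ e<e′ (trans (sym (entry-count e (<-trans e<e′ e′<k)))
                 (trans (cong (count g) eq) (entry-count e′ e′<k))))
              λ e e<k → let i , i<v , eq , _ = marked (entry e) (entry-marked e e<k) in i , i<v , eq)
        where
        open Class w w<k (ρ-at ρw)
        nth : ∀ e → e < k → ∃[ u ] u < μ × g u ≡ true × count g u ≡ e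
        nth e e<k = count-nth g μ (≤-trans e<k (≮⇒≥ c≮k))
        -- Made total to fit `pigeonhole-ℕ`; the value 0 from k on is never inspected.
        entry : ℕ → ℕ
        entry e with e <? k
        ... | yes e<k = proj₁ (nth e e<k)
        ... | no  _   = 0
        entry-count : ∀ e → e < k → count g (entry e) ≡ e
        entry-count e e<k with e <? k
        ... | yes h = proj₂ (proj₂ (proj₂ (nth e h)))
        ... | no  h = ⊥-elim (h e<k)
        entry-marked : ∀ e → e < k → x < M (entry e)
        entry-marked e e<k with e <? k
        ... | no  h = ⊥-elim (h e<k)
        ... | yes h = let u , u<μ , gu , c≡ = nth e h in
          all u (<-trans u<μ (proj₁ (auth w w<k))) gu (subst (_< k) (sym c≡) h)
      served (picked w y w<k ρw y<n gy My≤x before f≡) =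
          trans f≡ f≡0
        , (λ u u<k lt → low′ u u<k (m≤n⇒m<n∨m≡n (s≤s⁻¹ lt)))
        , marked′
        , (λ u u<k lt → stamped′ u u<k (m≤n⇒m<n∨m≡n (s≤s⁻¹ lt)))
        , λ u z u<k z<k lt lt′ → distinct′ u z u<k z<k (m≤n⇒m<n∨m≡n (s≤s⁻¹ lt)) (m≤n⇒m<n∨m≡n (s≤s⁻¹ lt′))
        where
        open Class w w<k (ρ-at ρw)
        ρw≡v = ρ-at ρw
        P′ = P [ v ↦ y ]
        M′ = M [ y ↦ suc x ]
        P-old : ∀ {i} → i < v → P′ i ≡ P i
        P-old i<v = get-set-≢ P y (<⇒≢ i<v)
        P-new : P′ v ≡ y
        P-new = get-set P v y
        y≤μ : y ≤ μ
        y≤μ = ≮⇒≥ λ μ<y → μ-free (before μ μ<y gμ)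
        low′ : ∀ u → u < k → ρ u < v ⊎ ρ u ≡ v → P′ (ρ u) ≤ π u
        low′ u u<k (inj₁ lt) rewrite P-old lt = low u u<k lt
        low′ u u<k (inj₂ eq) rewrite eq | P-new =
          subst (y ≤_) (tracks-≡⁻¹ tr w u w<k u<k (trans ρw≡v (sym eq))) y≤μ
        marked′ : ∀ z → x < M′ z → ∃[ i ] i < suc v × P′ i ≡ z × (∃[ u ] u < k × ρ u ≡ i)
        marked′ z h with z ≟ y
        ... | yes refl = v , ≤-refl , P-new , w , w<k , ρw≡v
        ... | no z≢y   =
          let i , i<v , eq , u = marked z (subst (x <_) (get-set-≢ M (suc x) z≢y) h)
          in i , m≤n⇒m≤1+n i<v , trans (P-old i<v) eq , u
        stamped′ : ∀ u → u < k → ρ u < v ⊎ ρ u ≡ v → x < M′ (P′ (ρ u))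
        stamped′ u u<k (inj₂ eq) rewrite eq | P-new | get-set M y (suc x) = ≤-refl
        stamped′ u u<k (inj₁ lt) rewrite P-old lt with P (ρ u) ≟ y
        ... | yes eq rewrite eq | get-set M y (suc x) = ≤-refl
        ... | no  ne rewrite get-set-≢ M (suc x) ne = stamped u u<k lt
        old≢new : ∀ u → u < k → ρ u < v → P (ρ u) ≢ y
        old≢new u u<k lt eq = <-irrefl refl (≤-trans (subst (λ z → x < M z) eq (stamped u u<k lt)) My≤x)
        distinct′ : ∀ u z → u < k → z < k → ρ u < v ⊎ ρ u ≡ v → ρ z < v ⊎ ρ z ≡ v → ρ u ≢ ρ z → P′ (ρ u) ≢ P′ (ρ z)
        distinct′ u z u<k z<k (inj₁ lt) (inj₁ lt′) ne rewrite P-old lt | P-old lt′ = distinct u z u<k z<k lt lt′ ne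
        distinct′ u z u<k z<k (inj₁ lt) (inj₂ eq)  ne rewrite P-old lt | eq | P-new = old≢new u u<k lt
        distinct′ u z u<k z<k (inj₂ eq) (inj₁ lt)  ne rewrite P-old lt | eq | P-new = λ h → old≢new z z<k lt (sym h)
        distinct′ u z u<k z<k (inj₂ eq) (inj₂ eq′) ne = ⊥-elim (ne (trans eq (sym eq′)))

-- From a single candidate to the whole search

value-cong : ∀ {d d′} k → (∀ t → t < k → d t ≡ d′ t) → value d k ≡ value d′ k
value-cong zero    h = refl
value-cong (suc s) h = cong₂ (λ a b → a * weakOrders s + b) (h s ≤-refl) (value-cong s λ t t<s → h t (m≤n⇒m≤1+n t<s))

module Solver (I : List ℕ) where
  open Correctness I public
  open Search I public

  -- Cell i is read in round i only, just before it is overwritten, so ranks and plan can share an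
  -- array.
  assign-spec : ∀ s → rv s kᵣ ≡ k → ∀ u → u < k → ar (run assign s) RNK u ≡ ar s PCK (ar s RNK u)
  assign-spec s k≡ u u<k = proj₁ (for-upto sᵣ kᵣ body J s k≡ (λ _ _ _ j → j) (λ _ → (λ ()) , λ _ → refl) step u) u<k
    where
    body = RNK ⟦ rg sᵣ ⟧:= PCK ⟦ RNK ⟦ rg sᵣ ⟧ ⟧
    J : ℕ → Store → Set
    J i t = ∀ u → (u < i → ar t RNK u ≡ ar s PCK (ar s RNK u)) × (i ≤ u → ar t RNK u ≡ ar s RNK u)
    step : ∀ i t → i < k → Agree assign t s → J i t → J (suc i) (run body (setR sᵣ i t))
    step i t _ a j u =
        (λ u< → <suc-elim i (λ u → (ar t RNK [ i ↦ v ]) u ≡ ar s PCK (ar s RNK u))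
          (λ u u<i → trans (get-set-≢ (ar t RNK) v (<⇒≢ u<i)) (proj₁ (j u) u<i))
          (trans (get-set (ar t RNK) i v) (cong₂ (λ f z → f z) (arrs a PCK tt) (proj₂ (j i) ≤-refl))) u u<)
      , λ i<u → trans (get-set-≢ (ar t RNK) v (>⇒≢ i<u)) (proj₂ (j u) (<⇒≤ i<u))
      where
      v = ar t PCK (ar t RNK i)

  pairs-spec : ∀ s {i} → rv s kᵣ ≡ k → rv s sᵣ ≡ i → I at (rv s qᵣ + (1 + i)) ≢ 0 →
    let t = run (for tᵣ upto kᵣ ⟲ testPair) s ; Pair = SatPair (ar s RNK) (rv s qᵣ) i in
    (∀ u → u < k → Pair u → rv t satᵣ ≢ 0) × (rv s satᵣ ≢ 0 → rv t satᵣ ≢ 0)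
    × (rv t satᵣ ≢ 0 → rv s satᵣ ≢ 0 ⊎ (∃[ u ] u < k × Pair u))
  pairs-spec s {i} k≡ s≡ i₁ = for-upto tᵣ kᵣ testPair J s k≡ (λ _ _ _ j → j)
    ((λ _ ()) , (λ h → h) , λ h → inj₁ h) step
    where
    p = ar s RNK
    q = rv s qᵣ
    J : ℕ → Store → Set
    J j t = (∀ u → u < j → SatPair p q i u → rv t satᵣ ≢ 0) × (rv s satᵣ ≢ 0 → rv t satᵣ ≢ 0)
      × (rv t satᵣ ≢ 0 → rv s satᵣ ≢ 0 ⊎ (∃[ u ] u < j × SatPair p q i u))
    step : ∀ j t → j < k → Agree (for tᵣ upto kᵣ ⟲ testPair) t s → J j t → J (suc j) (run testPair (setR tᵣ j t))
    step j t _ a (hits , kept , sound) =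
      run-iff (J (suc j)) {inp (rg qᵣ ⊞ (num 1 ⊞ (rg kᵣ ⊞ rg tᵣ)))} {test} {nop} t′
        (λ h₂ → let i₂ = subst (λ z → I at z ≢ 0) in₂≡ h₂ in
          run-iff (J (suc j)) {inp (rg qᵣ)} {iff ne hit nop} {iff ne nop hit} t′
            (λ h → let sym≢0 = subst (λ z → I at z ≢ 0) q≡ h in
              run-iff (J (suc j)) {ne} {hit} {nop} t′
                (λ e → yes-pair (i₁ , i₂ , inj₁ (sym≢0 , λ eq → neq-≢0 e (trans rs≡ (trans eq (sym rt≡))))))
                (λ e → no-pair λ { (_ , _ , inj₁ (_ , ne)) → ne (trans (sym rs≡) (trans (neq-0 e) rt≡))
                                 ; (_ , _ , inj₂ (z , _)) → sym≢0 z }))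
            (λ h → let sym≡0 = subst (λ z → I at z ≡ 0) q≡ h in
              run-iff (J (suc j)) {ne} {nop} {hit} t′
                (λ e → no-pair λ { (_ , _ , inj₁ (nz , _)) → nz sym≡0
                                 ; (_ , _ , inj₂ (_ , eq)) → neq-≢0 e (trans rs≡ (trans eq (sym rt≡))) })
                (λ e → yes-pair (i₁ , i₂ , inj₂ (sym≡0 , trans (sym rs≡) (trans (neq-0 e) rt≡))))))
        (λ h → no-pair λ (_ , i₂ , _) → i₂ (subst (λ z → I at z ≡ 0) in₂≡ h))
      where
      t′ = setR tᵣ j t
      ne = neq (RNK ⟦ rg sᵣ ⟧) (RNK ⟦ rg tᵣ ⟧)
      hit = satᵣ := num 1
      test = iff (inp (rg qᵣ)) (iff ne hit nop) (iff ne nop hit)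
      q≡ : rv t qᵣ ≡ q
      q≡ = regs a qᵣ tt
      in₂≡ : rv t qᵣ + suc (rv t kᵣ + j) ≡ q + suc (k + j)
      in₂≡ = cong₂ (λ x y → x + suc (y + j)) q≡ (trans (regs a kᵣ tt) k≡)
      rs≡ : ar t RNK (rv t sᵣ) ≡ p i
      rs≡ = cong₂ (λ f z → f z) (arrs a RNK tt) (trans (regs a sᵣ tt) s≡)
      rt≡ : ar t RNK j ≡ p j
      rt≡ = cong (λ f → f j) (arrs a RNK tt)
      yes-pair : SatPair p q i j → J (suc j) (run hit t′)
      yes-pair sp = (λ _ _ _ ()) , (λ _ ()) , λ _ → inj₂ (j , ≤-refl , sp)
      no-pair : ¬ SatPair p q i j → J (suc j) t′
      no-pair ¬sp = <suc-elim j (λ u → SatPair p q i u → rv t satᵣ ≢ 0) hits (λ sp → ⊥-elim (¬sp sp)) , kept , older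
        where
        older : rv t satᵣ ≢ 0 → rv s satᵣ ≢ 0 ⊎ (∃[ u ] u < suc j × SatPair p q i u)
        older h with sound h
        ... | inj₁ z = inj₁ z
        ... | inj₂ (u , u<j , sp) = inj₂ (u , m≤n⇒m≤1+n u<j , sp)

  allPairs-spec : ∀ s → rv s kᵣ ≡ k → rv s satᵣ ≡ 0 →
    let t = run (for sᵣ upto kᵣ ⟲ testStep) s in
    (SatN (ar s RNK) (rv s qᵣ) → rv t satᵣ ≢ 0) × (rv t satᵣ ≢ 0 → SatN (ar s RNK) (rv s qᵣ))
  allPairs-spec s k≡ sat≡ =
    let hits , sound = for-upto sᵣ kᵣ testStep J s k≡ (λ _ _ _ j → j) ((λ _ _ ()) , λ h → ⊥-elim (h sat≡)) step
    in (λ (i , u , i<k , u<k , sp) → hits i u i<k u<k sp) , sound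
    where
    p = ar s RNK
    q = rv s qᵣ
    J : ℕ → Store → Set
    J j t = (∀ i u → i < j → u < k → SatPair p q i u → rv t satᵣ ≢ 0) × (rv t satᵣ ≢ 0 → SatN p q)
    step : ∀ j t → j < k → Agree (for sᵣ upto kᵣ ⟲ testStep) t s → J j t → J (suc j) (run testStep (setR sᵣ j t))
    step j t j<k a (hits , sound) =
      run-iff (J (suc j)) {inp (rg qᵣ ⊞ (num 1 ⊞ rg sᵣ))} {for tᵣ upto kᵣ ⟲ testPair} {nop} t′
        (λ h₁ → after (pairs-spec t′ {j} (trans (regs a kᵣ tt) k≡) refl h₁))
        (λ h₁ → (λ i u i<j u<k sp → <suc-elim j (λ i → SatPair p q i u → rv t satᵣ ≢ 0)
                    (λ i i<j → hits i u i<j u<k)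
                    (λ sp → ⊥-elim (proj₁ sp (subst (λ z → I at (z + suc j) ≡ 0) q≡ h₁))) i i<j sp)
              , sound)
      where
      t′ = setR sᵣ j t
      q≡ : rv t qᵣ ≡ q
      q≡ = regs a qᵣ tt
      same : ∀ {i u} → SatPair p q i u ≡ SatPair (ar t RNK) (rv t qᵣ) i u
      same {i} {u} = cong₂ (λ f z → SatPair f z i u) (sym (arrs a RNK tt)) (sym q≡)
      after : ∀ {sat} → (∀ u → u < k → SatPair (ar t RNK) (rv t qᵣ) j u → sat ≢ 0) × (rv t satᵣ ≢ 0 → sat ≢ 0)
          × (sat ≢ 0 → rv t satᵣ ≢ 0 ⊎ (∃[ u ] u < k × SatPair (ar t RNK) (rv t qᵣ) j u)) →
        (∀ i u → i < suc j → u < k → SatPair p q i u → sat ≢ 0) × (sat ≢ 0 → SatN p q)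
      after {sat} (new , kept , origin) =
          (λ i u i<j u<k → <suc-elim j (λ i → SatPair p q i u → sat ≢ 0)
            (λ i i<j sp → kept (hits i u i<j u<k sp)) (λ sp → new u u<k (subst (λ A → A) same sp)) i i<j)
        , λ h → from (origin h)
        where
        from : rv t satᵣ ≢ 0 ⊎ (∃[ u ] u < k × SatPair (ar t RNK) (rv t qᵣ) j u) → SatN p q
        from (inj₁ z) = sound z
        from (inj₂ (u , u<k , sp)) = j , u , j<k , u<k , subst (λ A → A) (sym same) sp

  verdict-spec : ∀ t {S : Set} → (S → rv t satᵣ ≢ 0) → (rv t satᵣ ≢ 0 → S) →
    let t′ = run (iff (rg satᵣ) nop (okᵣ := num 0)) t in
    (rv t′ okᵣ ≢ 0 → rv t okᵣ ≢ 0 × S) × (rv t okᵣ ≢ 0 → S → rv t′ okᵣ ≢ 0)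
  verdict-spec t {S} complete sound =
    run-iff (λ z → (rv z okᵣ ≢ 0 → rv t okᵣ ≢ 0 × S) × (rv t okᵣ ≢ 0 → S → rv z okᵣ ≢ 0)) {rg satᵣ} {nop} {okᵣ := num 0} t
      (λ h → (λ ok → ok , sound h) , λ ok _ → ok)
      (λ h → (λ ok → ⊥-elim (ok refl)) , λ _ S → ⊥-elim (complete S h))

  testConstraint-spec : ∀ s → rv s kᵣ ≡ k → let t = run testConstraint s ; S = SatN (ar s RNK) (rv s qᵣ) in
    rv t qᵣ ≡ rv s qᵣ + (1 + (k + k)) × (rv t okᵣ ≢ 0 → rv s okᵣ ≢ 0 × S) × (rv s okᵣ ≢ 0 → S → rv t okᵣ ≢ 0)
  testConstraint-spec s k≡ =
      cong₂ (λ x y → x + suc (y + y)) (kept qᵣ tt) (trans (kept kᵣ tt) k≡)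
    , (λ h → let ok , S = proj₁ v h in subst (_≢ 0) ok≡ ok , S)
    , (λ h S → proj₂ v (subst (_≢ 0) (sym ok≡) h) S)
    where
    s₀ = run (satᵣ := num 0) s
    s₁ = run (for sᵣ upto kᵣ ⟲ testStep) s₀
    pairs = allPairs-spec s₀ k≡ refl
    v = verdict-spec s₁ (proj₁ pairs) (proj₂ pairs)
    ok≡ : rv s₁ okᵣ ≡ rv s okᵣ
    ok≡ = frame (for sᵣ upto kᵣ ⟲ testStep) okᵣ tt s₀
    front = satᵣ := num 0 ▹ (for sᵣ upto kᵣ ⟲ testStep) ▹ iff (rg satᵣ) nop (okᵣ := num 0)
    kept : ∀ y → T (fresh y front) → rv (run front s) y ≡ rv s y
    kept y h = frame front y h s

  check-spec : ∀ s → Ready s → let t = run check s ; p = ar s RNK in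
    (rv t okᵣ ≢ 0 → rv s failᵣ ≡ 0 × (∀ j → j < c → SatN p (conAt j)))
    × (rv s failᵣ ≡ 0 → (∀ j → j < c → SatN p (conAt j)) → rv t okᵣ ≢ 0)
  check-spec s r = proj₂ (for-upto jᵣ cᵣ testConstraint J s₀ (c≡ r) (λ _ _ _ j → j)
    (trans (base≡ r) (sym (+-identityʳ (3 + k * n))) , (λ h → 1∸-≢0 (rv s failᵣ) h , λ _ ()) , λ f _ z → no-fail (rv s failᵣ) f z) step)
    where
    s₀ = run (okᵣ := num 1 ⊟ rg failᵣ ▹ qᵣ := rg baseᵣ) s
    p = ar s RNK
    1∸-≢0 : ∀ f → 1 ∸ f ≢ 0 → f ≡ 0
    1∸-≢0 zero    _ = refl
    1∸-≢0 (suc f) h = ⊥-elim (h (0∸n≡0 f))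
    no-fail : ∀ f → f ≡ 0 → 1 ∸ f ≢ 0
    no-fail _ refl ()
    J : ℕ → Store → Set
    J j t = rv t qᵣ ≡ conAt j × (rv t okᵣ ≢ 0 → rv s failᵣ ≡ 0 × (∀ i → i < j → SatN p (conAt i)))
      × (rv s failᵣ ≡ 0 → (∀ i → i < j → SatN p (conAt i)) → rv t okᵣ ≢ 0)
    step : ∀ j t → j < c → Agree (for jᵣ upto cᵣ ⟲ testConstraint) t s₀ → J j t → J (suc j) (run testConstraint (setR jᵣ j t))
    step j t _ a (q≡ , sound , complete) = after (testConstraint-spec (setR jᵣ j t) (trans (regs a kᵣ tt) (k≡ r)))
      where
      S≡ : SatN (ar t RNK) (rv t qᵣ) ≡ SatN p (conAt j)
      S≡ = cong₂ SatN (arrs a RNK tt) q≡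
      next : ∀ x j w → x + j * w + w ≡ x + suc j * w
      next = solve-∀
      after : ∀ {q′ ok′} →
        q′ ≡ rv t qᵣ + (1 + (k + k))
          × (ok′ ≢ 0 → rv t okᵣ ≢ 0 × SatN (ar t RNK) (rv t qᵣ)) × (rv t okᵣ ≢ 0 → SatN (ar t RNK) (rv t qᵣ) → ok′ ≢ 0) →
        q′ ≡ conAt (suc j) × (ok′ ≢ 0 → rv s failᵣ ≡ 0 × (∀ i → i < suc j → SatN p (conAt i)))
          × (rv s failᵣ ≡ 0 → (∀ i → i < suc j → SatN p (conAt i)) → ok′ ≢ 0)
      after (q′≡ , snd , cmp) =
          trans q′≡ (trans (cong (_+ (1 + (k + k))) q≡) (next (3 + k * n) j (1 + (k + k))))
        , (λ h → let ok , S = snd h ; f , all = sound ok in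
             f , <suc-elim j (λ i → SatN p (conAt i)) all (subst (λ A → A) S≡ S))
        , λ f all → cmp (complete f (λ i i<j → all i (m≤n⇒m≤1+n i<j))) (subst (λ A → A) (sym S≡) (all j ≤-refl))

  save-spec : ∀ s → rv s kᵣ ≡ k → let t = run save s in
    (rv s okᵣ ≡ 0 × rv t resᵣ ≡ rv s resᵣ × ar t BST ≡ ar s BST)
    ⊎ (rv s okᵣ ≢ 0 × rv t resᵣ ≡ 1 × (∀ u → u < k → ar t BST u ≡ ar s RNK u))
  save-spec s k≡ =
    run-iff (λ t → (rv s okᵣ ≡ 0 × rv t resᵣ ≡ rv s resᵣ × ar t BST ≡ ar s BST)
                 ⊎ (rv s okᵣ ≢ 0 × rv t resᵣ ≡ 1 × (∀ u → u < k → ar t BST u ≡ ar s RNK u)))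
      {rg okᵣ} {resᵣ := num 1 ▹ copy} {nop} s
      (λ h → inj₂ (h , frame copy resᵣ tt s₀
        , for-upto sᵣ kᵣ body (λ i t → ∀ u → u < i → ar t BST u ≡ ar s RNK u) s₀ k≡ (λ _ _ _ j → j) (λ _ ())
            λ i t _ a j → <suc-elim i (λ u → (ar t BST [ i ↦ ar t RNK i ]) u ≡ ar s RNK u)
              (λ u u<i → trans (get-set-≢ (ar t BST) (ar t RNK i) (<⇒≢ u<i)) (j u u<i))
              (trans (get-set (ar t BST) i (ar t RNK i)) (cong (λ f → f i) (arrs a RNK tt)))))
      (λ h → inj₁ (h , refl , refl))
    where
    body = BST ⟦ rg sᵣ ⟧:= RNK ⟦ rg sᵣ ⟧
    copy = for sᵣ upto kᵣ ⟲ body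
    s₀ = run (resᵣ := num 1) s

  -- A carry out of the first i digits is worth `weakOrders i`, the place value of the next digit.
  -- Counting it in makes the equation an invariant, and an overflow at the end stays visible.
  increment-spec : ∀ s → rv s kᵣ ≡ k → DigitsBelow k (ar s DIG) → let d = ar s DIG ; d′ = ar (run increment s) DIG in
    DigitsBelow k d′ × (∃[ carry ] value d′ k + carry * weakOrders k ≡ value d k + 1)
  increment-spec s k≡ db =
    let db′ , _ , _ , eq = for-upto sᵣ kᵣ incrementDigit J (run (carᵣ := num 1) s) k≡ (λ _ _ _ j → j)
          (db , ≤-refl , (λ _ _ → refl) , refl) step
    in db′ , rv (run increment s) carᵣ , eq
    where
    d = ar s DIG
    J : ℕ → Store → Set
    J i t = DigitsBelow k (ar t DIG) × rv t carᵣ ≤ 1 × (∀ u → i ≤ u → ar t DIG u ≡ d u)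
      × value (ar t DIG) i + rv t carᵣ * weakOrders i ≡ value d i + 1
    step : ∀ i t → i < k → Agree (for sᵣ upto kᵣ ⟲ incrementDigit) t (run (carᵣ := num 1) s) → J i t →
      J (suc i) (run incrementDigit (setR sᵣ i t))
    step i t i<k _ (db′ , car≤ , todo , eq) =
      run-iff (J (suc i)) {rg carᵣ} {iff room bump-it reset} {nop} t′
        (λ h → let car≡1 = ≤-antisym car≤ (n≢0⇒n>0 h) in
          run-iff (J (suc i)) {room} {bump-it} {reset} t′
            (λ g → let D+1< = subst (_< suc i + suc i) (+-comm 1 (D i))
                                  (subst (suc (D i) <_) (cong suc (sym (+-suc i i))) (s≤s (m∸n≢0⇒n<m g))) in
                below (D i + 1) D+1< , z≤n , later (D i + 1)
              , trans (+-identityʳ _) (trans (cong₂ (λ a b → a * w + b) (get-set D i (D i + 1)) (lower (D i + 1)))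
                  (bumped (D i) (d i) w (value D i) (value d i) (rv t carᵣ) (todo i ≤-refl) car≡1 eq)))
            (λ g → let D≡ = ≤-antisym (s≤s⁻¹ (subst (suc (D i) ≤_) (cong suc (+-suc i i)) (db′ i i<k))) (m∸n≡0⇒m≤n g) in
                below 0 (s≤s z≤n) , car≤ , later 0
              , trans (cong₂ (λ a b → a * w + b + rv t carᵣ * weakOrders (suc i)) (get-set D i 0) (lower 0))
                  (carried (d i) i w (value D i) (value d i) (rv t carᵣ)
                    (trans (sym (todo i ≤-refl)) D≡) car≡1 eq)))
        (λ h → db′ , car≤ , (λ u i<u → todo u (<⇒≤ i<u))
          , still (D i) (d i) w (value D i) (value d i) (rv t carᵣ) (todo i ≤-refl) h eq)
      where
      t′ = setR sᵣ i t
      D = ar t DIG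
      w = weakOrders i
      room = (num 1 ⊞ rg sᵣ) ⊞ rg sᵣ ⊟ DIG ⟦ rg sᵣ ⟧
      bump-it = DIG ⟦ rg sᵣ ⟧:= DIG ⟦ rg sᵣ ⟧ ⊞ num 1 ▹ carᵣ := num 0
      reset = DIG ⟦ rg sᵣ ⟧:= num 0
      below : ∀ v → v < suc i + suc i → DigitsBelow k (D [ i ↦ v ])
      below v v< u u<k with u ≟ i
      ... | yes refl = subst (_< suc u + suc u) (sym (get-set D u v)) v<
      ... | no u≢i   = subst (_< suc u + suc u) (sym (get-set-≢ D v u≢i)) (db′ u u<k)
      later : ∀ v u → suc i ≤ u → (D [ i ↦ v ]) u ≡ d u
      later v u i<u = trans (get-set-≢ D v (>⇒≢ i<u)) (todo u (<⇒≤ i<u))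
      lower : ∀ v → value (D [ i ↦ v ]) i ≡ value D i
      lower v = value-cong i λ u u<i → get-set-≢ D v (<⇒≢ u<i)
      bumped : ∀ D d w x y car → D ≡ d → car ≡ 1 → x + car * w ≡ y + 1 → (D + 1) * w + x ≡ d * w + y + 1
      bumped D _ w x y _ refl refl eq = trans (e₁ D w x) (trans (cong (D * w +_) eq) (e₂ (D * w) y))
        where
        e₁ : ∀ D w x → (D + 1) * w + x ≡ D * w + (x + 1 * w)
        e₁ = solve-∀
        e₂ : ∀ a y → a + (y + 1) ≡ a + y + 1
        e₂ = solve-∀
      carried : ∀ d i w x y car → d ≡ suc (i + i) → car ≡ 1 → x + car * w ≡ y + 1 →
        0 * w + x + car * (suc i * (w + w)) ≡ d * w + y + 1
      carried _ i w x y _ refl refl eq = trans (e₁ i w x) (trans (cong (suc (i + i) * w +_) eq) (e₂ (suc (i + i) * w) y))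
        where
        e₁ : ∀ i w x → 0 * w + x + 1 * (suc i * (w + w)) ≡ suc (i + i) * w + (x + 1 * w)
        e₁ = solve-∀
        e₂ : ∀ a y → a + (y + 1) ≡ a + y + 1
        e₂ = solve-∀
      still : ∀ D d w x y car {w′} → D ≡ d → car ≡ 0 → x + car * w ≡ y + 1 → D * w + x + car * w′ ≡ d * w + y + 1
      still D _ w x y _ refl refl eq = trans (+-identityʳ _)
        (trans (cong (D * w +_) (trans (sym (+-identityʳ x)) eq)) (sym (+-assoc (D * w) y 1)))

  -- In `solved` the valid plan `π` only forces a success: the plan that is saved has the same
  -- equalities as `π` but may use other users.
  record Tried (s t : Store) : Set where
    field
      marks′  : ∀ {x} → rv s xᵣ ≡ x → (∀ u → ar s MRK u ≤ x) → ∀ u → ar t MRK u ≤ suc x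
      digits′ : DigitsBelow k (ar t DIG) × (∃[ carry ] value (ar t DIG) k + carry * weakOrders k ≡ value (ar s DIG) k + 1)
      saved   : (rv t resᵣ ≡ rv s resᵣ × ar t BST ≡ ar s BST) ⊎ (rv t resᵣ ≡ 1 × ValidN (ar t BST))
      solved  : ∀ π → ValidN π → Tracks π (ranks (ar s DIG) k) k → rv t resᵣ ≡ 1

  -- A record instead of the bare equation: its type still shows `p` and `s` to inference, where
  -- `run p s` would be unfolded.
  record Runs (p : Cmd) (s t : Store) : Set where
    constructor ran
    field runs : t ≡ run p s
  open Runs public

  keepR : ∀ {p s t} → Runs p s t → ∀ y → T (fresh y p) → rv t y ≡ rv s y
  keepR {p} {s} (ran e) y h = trans (cong (λ z → rv z y) e) (frame p y h s)
  keepA : ∀ {p s t} → Runs p s t → ∀ a → T (freshA a p) → ar t a ≡ ar s a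
  keepA {p} {s} (ran e) a h = trans (cong (λ z → ar z a) e) (frameA p a h s)
  ready : ∀ {p s t} → Runs p s t → T (keepsParams p) → Ready s → Ready t
  ready {p} {s} (ran e) h = ready-agree p h (subst (λ z → Agree p z s) (sym e) (agree p s))

  -- The intermediate stores are variables here: this keeps them folded during
  -- type checking.
  tryCandidate-steps : ∀ s s₁ s₂ s₃ s₄ s₅ s₆ {x} →
    Runs decode s s₁ → Runs greedy s₁ s₂ → Runs assign s₂ s₃ → Runs check s₃ s₄ →
    Runs save s₄ s₅ → Runs increment s₅ s₆ →
    Ready s → Rows n s → rv s xᵣ ≡ x → (∀ u → ar s MRK u ≤ x) →
    DigitsBelow k (ar s DIG) → Tried s s₆
  tryCandidate-steps s s₁ s₂ s₃ s₄ s₅ s₆ {x} e₁ e₂ e₃ e₄ e₅ e₆ r R x≡ marks db = record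
    { marks′ = λ { refl _ u → subst₂ _≤_ (sym (cong (λ f → f u) marks≡)) (cong suc (sym x≡)) (proj₁ sound u) }
    ; digits′ = let db′ , carry , eq = incremented in
                db′ , carry , trans eq (cong (λ d → value d k + 1) dig≡)
    ; saved = saved′ saving
    ; solved = λ π v tr → solved′ π v tr saving
    }
    where
    r₁ = ready e₁ tt r
    R₁ : Rows n s₁
    R₁ = rows-cong n s s₁ (keepA e₁ LEN tt) (keepA e₁ LST tt) R
    x₁ : rv s₁ xᵣ ≡ x
    x₁ = trans (keepR e₁ xᵣ tt) x≡
    marks₁ : ∀ u → ar s₁ MRK u ≤ x
    marks₁ u = subst (λ f → f u ≤ x) (sym (keepA e₁ MRK tt)) (marks u)
    r₂ = ready e₂ tt r₁
    r₃ = ready e₃ tt r₂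
    r₄ = ready e₄ tt r₃
    r₅ = ready e₅ tt r₄
    ρ = ar s₁ RNK
    P = ar s₂ PCK
    plan≡ : ∀ u → u < k → ar s₃ RNK u ≡ P (ρ u)
    plan≡ u u<k = trans (subst (λ z → ar z RNK u ≡ P (ar s₂ RNK u)) (sym (runs e₃)) (assign-spec s₂ (k≡ r₂) u u<k))
      (cong (λ f → P (f u)) (keepA e₂ RNK tt))
    ρ≡ : ∀ u → u < k → ρ u ≡ ranks (ar s DIG) k u
    ρ≡ = subst (λ z → ∀ u → u < k → ar z RNK u ≡ ranks (ar s DIG) k u) (sym (runs e₁)) (decode-spec s (k≡ r))
    ρ<k : ∀ u → u < k → ρ u < k
    ρ<k u u<k = subst (_< k) (sym (ρ≡ u u<k)) (ranks< k db u u<k)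
    sound : (∀ u → ar s₂ MRK u ≤ suc x)
      × (rv s₂ failᵣ ≡ 0 → ∀ u → u < k → ρ u < k → P (ρ u) < n × mayDo (P (ρ u)) u ≡ true)
    sound = subst (λ z → (∀ u → ar z MRK u ≤ suc x)
        × (rv z failᵣ ≡ 0 → ∀ u → u < k → ρ u < k → ar z PCK (ρ u) < n × mayDo (ar z PCK (ρ u)) u ≡ true))
      (sym (runs e₂)) (greedy-sound s₁ r₁ R₁ x₁ marks₁)
    marks≡ : ar s₆ MRK ≡ ar s₂ MRK
    marks≡ = trans (keepA e₆ MRK tt) (trans (keepA e₅ MRK tt) (trans (keepA e₄ MRK tt) (keepA e₃ MRK tt)))
    dig≡ : ar s₅ DIG ≡ ar s DIG
    dig≡ = trans (keepA e₅ DIG tt) (trans (keepA e₄ DIG tt) (trans (keepA e₃ DIG tt) (trans (keepA e₂ DIG tt) (keepA e₁ DIG tt))))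
    incremented : DigitsBelow k (ar s₆ DIG) × (∃[ carry ] value (ar s₆ DIG) k + carry * weakOrders k ≡ value (ar s₅ DIG) k + 1)
    incremented = subst (λ z → DigitsBelow k (ar z DIG) × (∃[ carry ] value (ar z DIG) k + carry * weakOrders k ≡ value (ar s₅ DIG) k + 1))
      (sym (runs e₆)) (increment-spec s₅ (k≡ r₅) (subst (DigitsBelow k) (sym dig≡) db))
    fail≡ : rv s₃ failᵣ ≡ rv s₂ failᵣ
    fail≡ = keepR e₃ failᵣ tt
    verdict : (rv s₄ okᵣ ≢ 0 → rv s₃ failᵣ ≡ 0 × (∀ j → j < c → SatN (ar s₃ RNK) (conAt j)))
      × (rv s₃ failᵣ ≡ 0 → (∀ j → j < c → SatN (ar s₃ RNK) (conAt j)) → rv s₄ okᵣ ≢ 0)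
    verdict = subst (λ z → (rv z okᵣ ≢ 0 → rv s₃ failᵣ ≡ 0 × (∀ j → j < c → SatN (ar s₃ RNK) (conAt j)))
        × (rv s₃ failᵣ ≡ 0 → (∀ j → j < c → SatN (ar s₃ RNK) (conAt j)) → rv z okᵣ ≢ 0))
      (sym (runs e₄)) (check-spec s₃ r₃)
    validN-cong : ∀ {p p′} → (∀ u → u < k → p u ≡ p′ u) → ValidN p → ValidN p′
    validN-cong {p} {p′} h (auth , sat) =
        (λ u u<k → subst (λ z → z < n × mayDo z u ≡ true) (h u u<k) (auth u u<k))
      , λ j j<c → satN-cong (λ a b a<k b<k →
            (λ eq → trans (sym (h a a<k)) (trans eq (h b b<k))) , (λ eq → trans (h a a<k) (trans eq (sym (h b b<k)))))
          (sat j j<c)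
    Outcome : Set
    Outcome = (rv s₄ okᵣ ≡ 0 × rv s₅ resᵣ ≡ rv s₄ resᵣ × ar s₅ BST ≡ ar s₄ BST)
            ⊎ (rv s₄ okᵣ ≢ 0 × rv s₅ resᵣ ≡ 1 × (∀ u → u < k → ar s₅ BST u ≡ ar s₄ RNK u))
    res≡ : rv s₆ resᵣ ≡ rv s₅ resᵣ
    res≡ = keepR e₆ resᵣ tt
    bst≡ : ar s₆ BST ≡ ar s₅ BST
    bst≡ = keepA e₆ BST tt
    saving : Outcome
    saving = subst (λ z → (rv s₄ okᵣ ≡ 0 × rv z resᵣ ≡ rv s₄ resᵣ × ar z BST ≡ ar s₄ BST)
            ⊎ (rv s₄ okᵣ ≢ 0 × rv z resᵣ ≡ 1 × (∀ u → u < k → ar z BST u ≡ ar s₄ RNK u))) (sym (runs e₅)) (save-spec s₄ (k≡ r₄))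
    saved′ : Outcome → (rv s₆ resᵣ ≡ rv s resᵣ × ar s₆ BST ≡ ar s BST) ⊎ (rv s₆ resᵣ ≡ 1 × ValidN (ar s₆ BST))
    saved′ (inj₁ (_ , res , bst)) =
      inj₁ (trans res≡ (trans res (trans (keepR e₄ resᵣ tt) (trans (keepR e₃ resᵣ tt) (trans (keepR e₂ resᵣ tt) (keepR e₁ resᵣ tt)))))
         , trans bst≡ (trans bst (trans (keepA e₄ BST tt) (trans (keepA e₃ BST tt) (trans (keepA e₂ BST tt) (keepA e₁ BST tt))))))
    saved′ (inj₂ (ok , res , bst)) =
      let f , sat = proj₁ verdict ok
          auth : AuthN (ar s₃ RNK)
          auth u u<k = subst (λ z → z < n × mayDo z u ≡ true) (sym (plan≡ u u<k))
            (proj₂ sound (trans (sym fail≡) f) u u<k (ρ<k u u<k))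
      in inj₂ (trans res≡ res , validN-cong
        (λ u u<k → sym (trans (cong (λ f → f u) bst≡) (trans (bst u u<k) (cong (λ f → f u) (keepA e₄ RNK tt)))))
        (auth , sat))
    solved′ : ∀ π → ValidN π → Tracks π (ranks (ar s DIG) k) k → Outcome → rv s₆ resᵣ ≡ 1
    solved′ π _ tr (inj₂ (_ , res , _)) = trans res≡ res
    solved′ π (auth , sat) tr (inj₁ (ok , _)) = ⊥-elim (proj₂ verdict (trans fail≡ (proj₁ cmp))
        (λ j j<c → satN-cong same (sat j j<c)) ok)
      where
      tr′ : Tracks π ρ k
      tr′ t u t<k u<k = subst₂ (λ a b → (π t < π u → a < b) × (π t ≡ π u → a ≡ b)) (sym (ρ≡ t t<k)) (sym (ρ≡ u u<k)) (tr t u t<k u<k)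
      cmp : rv s₂ failᵣ ≡ 0 × (∀ u w → u < k → w < k → ρ u ≢ ρ w → P (ρ u) ≢ P (ρ w))
      cmp = subst (λ z → rv z failᵣ ≡ 0 × (∀ u w → u < k → w < k → ρ u ≢ ρ w → ar z PCK (ρ u) ≢ ar z PCK (ρ w)))
        (sym (runs e₂)) (greedy-complete s₁ r₁ R₁ x₁ marks₁ auth tr′ ρ<k)
      -- Equal values of `π` give equal ranks and hence equal picks; conversely, different ranks
      -- were served different users.
      same : ∀ a b → a < k → b < k →
        (π a ≡ π b → ar s₃ RNK a ≡ ar s₃ RNK b) × (ar s₃ RNK a ≡ ar s₃ RNK b → π a ≡ π b)
      same a b a<k b<k =
          (λ eq → trans (plan≡ a a<k) (trans (cong P (proj₂ (tr′ a b a<k b<k) eq)) (sym (plan≡ b b<k))))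
        , λ eq → tracks-≡⁻¹ tr′ a b a<k b<k (reflect (trans (sym (plan≡ a a<k)) (trans eq (plan≡ b b<k))))
        where
        reflect : P (ρ a) ≡ P (ρ b) → ρ a ≡ ρ b
        reflect eq with ρ a ≟ ρ b
        ... | yes e = e
        ... | no ne = ⊥-elim (proj₂ cmp a b a<k b<k ne eq)

  tryCandidate-spec : ∀ s {x} → Ready s → Rows n s → rv s xᵣ ≡ x → (∀ u → ar s MRK u ≤ x) →
    DigitsBelow k (ar s DIG) → Tried s (run tryCandidate s)
  tryCandidate-spec s = tryCandidate-steps s _ _ _ _ _ _ (ran refl) (ran refl) (ran refl) (ran refl) (ran refl) (ran refl)

  data AnswerN (t : Store) : Set where
    found  : rv t resᵣ ≡ 1 → ValidN (ar t BST) → AnswerN t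
    absent : rv t resᵣ ≡ 0 → (∀ π → ¬ ValidN π) → AnswerN t

  -- The body p is a variable for the same reason.
  enumeration-spec : ∀ p → T (keepsParams (for xᵣ upto numᵣ ⟲ p)) → T (freshA LEN p) → T (freshA LST p) →
    (∀ s {x} → Ready s → Rows n s → rv s xᵣ ≡ x → (∀ u → ar s MRK u ≤ x) →
      DigitsBelow k (ar s DIG) → Tried s (run p s)) →
    ∀ s → Ready s → Rows n s → (∀ u → ar s MRK u ≡ 0) → (∀ u → ar s DIG u ≡ 0) → rv s resᵣ ≡ 0 →
    AnswerN (run (for xᵣ upto numᵣ ⟲ p) s)
  enumeration-spec p keeps len# lst# try s r R marks digits res = answer
    where
    loopₚ = for xᵣ upto numᵣ ⟲ p
    -- The value is claimed only for x below `weakOrders k`, because the last increment wraps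
    -- around. Before that, a carry would force `weakOrders k` to be at most x + 1.
    Base : ℕ → Store → Set
    Base x t = (∀ u → ar t MRK u ≤ x) × DigitsBelow k (ar t DIG) × (x < weakOrders k → value (ar t DIG) k ≡ x)
    base₀ : Base 0 s
    base₀ = (λ u → ≤-reflexive (marks u)) , (λ u _ → ≤-<-trans (≤-reflexive (digits u)) (s≤s z≤n))
      , λ _ → trans (value-cong k (λ t _ → digits t)) (value-0 k)
      where
      value-0 : ∀ k → value (λ _ → 0) k ≡ 0
      value-0 zero    = refl
      value-0 (suc k) = value-0 k
    module _ (x : ℕ) (t : Store) (a : Agree loopₚ t s) (b : Base x t) where
      t′ = setR xᵣ x t
      tried : Tried t′ (run p t′)
      tried = try t′ (ready-agree loopₚ keeps a r)
        (rows-cong n s t (arrs a LEN len#) (arrs a LST lst#) R) refl (proj₁ b) (proj₁ (proj₂ b))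
      base′ : Base (suc x) (run p t′)
      base′ = Tried.marks′ tried refl (proj₁ b) , proj₁ (Tried.digits′ tried) , next (Tried.digits′ tried)
        where
        next : ∀ {d} → DigitsBelow k d × (∃[ carry ] value d k + carry * weakOrders k ≡ value (ar t DIG) k + 1) →
          suc x < weakOrders k → value d k ≡ suc x
        next (_ , zero , eq) x< = trans (sym (+-identityʳ _)) (trans eq (trans (cong (_+ 1) (proj₂ (proj₂ b) (<⇒≤ x<))) (+-comm x 1)))
        next {d} (_ , suc m , eq) x< = ⊥-elim (<-irrefl refl (<-≤-trans x< (≤-trans
          (≤-trans (m≤m+n (weakOrders k) (m * weakOrders k)) (m≤n+m _ (value d k)))
          (≤-reflexive (trans eq (trans (cong (_+ 1) (proj₂ (proj₂ b) (<⇒≤ x<))) (+-comm x 1)))))))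
    Sound : ℕ → ℕ → (ℕ → ℕ) → Set
    Sound _ res bst = res ≡ 0 ⊎ (res ≡ 1 × ValidN bst)
    soundness : Sound 0 (rv (run loopₚ s) resᵣ) (ar (run loopₚ s) BST)
    soundness = proj₂ (for-upto xᵣ numᵣ p (λ x t → Base x t × Sound x (rv t resᵣ) (ar t BST)) s (num≡ r)
      (λ _ _ _ j → j) (base₀ , inj₁ res) λ x t _ a (b , so) → base′ x t a b , keep so (Tried.saved (tried x t a b)))
      where
      keep : ∀ {res bst res′ bst′} → res ≡ 0 ⊎ (res ≡ 1 × ValidN bst) →
        (res′ ≡ res × bst′ ≡ bst) ⊎ (res′ ≡ 1 × ValidN bst′) → res′ ≡ 0 ⊎ (res′ ≡ 1 × ValidN bst′)
      keep so (inj₁ (refl , refl)) = so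
      keep so (inj₂ h) = inj₂ h
    complete : ∀ π → ValidN π → rv (run loopₚ s) resᵣ ≡ 1
    complete π v with tracking-digits π k
    -- The digits `d` that follow `π` come up in round `value d k`; from then on the result stays 1.
    ... | d , db , tr = proj₂ (for-upto xᵣ numᵣ p (λ x t → Base x t × (value d k < x → rv t resᵣ ≡ 1)) s (num≡ r)
      (λ _ _ _ j → j) (base₀ , λ ()) λ x t x<N a (b , so) → base′ x t a b
        , λ lt → step x t x<N a b so (m≤n⇒m<n∨m≡n (s≤s⁻¹ lt))) (value< d k db)
      where
      keep : ∀ {res bst res′} {bst′ : ℕ → ℕ} → res ≡ 1 → (res′ ≡ res × bst′ ≡ bst) ⊎ (res′ ≡ 1 × ValidN bst′) → res′ ≡ 1
      keep e (inj₁ (refl , _)) = e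
      keep e (inj₂ (e′ , _)) = e′
      step : ∀ x t → x < weakOrders k → (a : Agree loopₚ t s) (b : Base x t) → (value d k < x → rv t resᵣ ≡ 1) →
        value d k < x ⊎ value d k ≡ x → rv (run p (setR xᵣ x t)) resᵣ ≡ 1
      step x t x<N a b so (inj₁ lt) = keep (so lt) (Tried.saved (tried x t a b))
      step x t x<N a b so (inj₂ eq) = Tried.solved (tried x t a b) π v
        (λ t₁ u t₁<k u<k → subst₂ (λ p q → (π t₁ < π u → p < q) × (π t₁ ≡ π u → p ≡ q)) (same t₁) (same u) (tr t₁ u t₁<k u<k))
        where
        same : ∀ u → ranks d k u ≡ ranks (ar t DIG) k u
        same = ranks-cong k (value-injective k db (proj₁ (proj₂ b)) (trans eq (sym (proj₂ (proj₂ b) x<N))))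
    answer : AnswerN (run loopₚ s)
    answer with soundness
    ... | inj₂ (e , v) = found e v
    ... | inj₁ z = absent z λ π v → 1≢0 (trans (sym (complete π v)) z)
      where
      1≢0 : 1 ≢ 0
      1≢0 ()

  search-spec : ∀ s → Ready s → Rows n s → (∀ u → ar s MRK u ≡ 0) → (∀ u → ar s DIG u ≡ 0) → rv s resᵣ ≡ 0 →
    AnswerN (run search s)
  search-spec = enumeration-spec tryCandidate tt tt tt tryCandidate-spec

  unconstrained-spec : ∀ s → rv s kᵣ ≡ k → rv s nᵣ ≡ n → c ≡ 0 → (∀ t → t < k → ∃[ u ] u < n × mayDo u t ≡ true) →
    AnswerN (run unconstrained s)
  unconstrained-spec s k≡ n≡ c≡0 auth = found refl
    ( (λ t t<k → let u , u<n , m = auth t t<k in all t t<k (u , u<n , m))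
    , λ j j<c → ⊥-elim (<⇒≢ (≤-<-trans z≤n j<c) (sym c≡0)))
    where
    Fits : ℕ → ℕ → Set
    Fits z t = z < n × mayDo z t ≡ true
    s₀ = run (qᵣ := num 3) s
    inner = for uᵣ upto nᵣ ⟲ lastAuthorised
    J : ℕ → Store → Set
    J i t = rv t qᵣ ≡ 3 + i * n × (∀ a → a < i → (∃[ u ] u < n × mayDo u a ≡ true) → Fits (ar t BST a) a)
    step : ∀ i t → i < k → Agree (for sᵣ upto kᵣ ⟲ inner) t s₀ → J i t → J (suc i) (run inner (setR sᵣ i t))
    step i t _ a (q≡ , old) =
      let q′ , old′ , new = for-upto uᵣ nᵣ lastAuthorised H (setR sᵣ i t) (trans (regs a nᵣ tt) n≡) (λ _ _ _ j → j)
            (trans q≡ (sym (+-identityʳ (3 + i * n))) , old , λ { (_ , () , _) }) row-step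
      in trans q′ (cong (3 +_) (+-comm (i * n) n)) , <suc-elim i (λ a → (∃[ u ] u < n × mayDo u a ≡ true) → Fits (ar (run inner (setR sᵣ i t)) BST a) a) old′ new
      where
      H : ℕ → Store → Set
      H u t = rv t qᵣ ≡ 3 + i * n + u
        × (∀ a → a < i → (∃[ u ] u < n × mayDo u a ≡ true) → Fits (ar t BST a) a)
        × ((∃[ v ] v < u × mayDo v i ≡ true) → Fits (ar t BST i) i)
      row-step : ∀ u z → u < n → Agree inner z (setR sᵣ i t) → H u z → H (suc u) (run lastAuthorised (setR uᵣ u z))
      row-step u z u<n b (q≡ , old , new) =
        run-iff (λ z → H (suc u) (run (qᵣ := rg qᵣ ⊞ num 1) z)) {inp (rg qᵣ)} {BST ⟦ rg sᵣ ⟧:= rg uᵣ} {nop} (setR uᵣ u z)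
          (λ h → put (regs b sᵣ tt) (trans (sym (cong nz (cong (I at_) cell))) (nz-≢0 h)))
          (λ h → q′ , old , λ (v , v<u , m) → new (v , ≤∧≢⇒< (s≤s⁻¹ v<u) (λ { refl → true≢false (trans (sym m) (trans (sym (cong nz (cong (I at_) cell))) (nz-0 h))) }) , m))
        where
        true≢false : true ≢ false
        true≢false ()
        cell : rv z qᵣ ≡ 3 + u + i * n
        cell = trans q≡ (cong (3 +_) (+-comm (i * n) u))
        q′ : rv z qᵣ + 1 ≡ 3 + i * n + suc u
        q′ = trans (cong (_+ 1) q≡) (trans (+-assoc (3 + i * n) u 1) (cong (3 + i * n +_) (+-comm u 1)))
        put : rv z sᵣ ≡ i → mayDo u i ≡ true → H (suc u) (run (qᵣ := rg qᵣ ⊞ num 1) (run (BST ⟦ rg sᵣ ⟧:= rg uᵣ) (setR uᵣ u z)))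
        put s≡ m rewrite s≡ = q′
          , (λ a a<i h → subst (λ w → Fits w a) (sym (get-set-≢ (ar z BST) u (<⇒≢ a<i))) (old a a<i h))
          , λ _ → subst (λ w → Fits w i) (sym (get-set (ar z BST) i u)) (u<n , m)
    all = proj₂ (for-upto sᵣ kᵣ inner J s₀ k≡ (λ _ _ _ j → j) (refl , λ _ ()) step)

  Blank : Store → Set
  Blank s = (∀ a i → ar s a i ≡ 0) × rv s resᵣ ≡ 0

  setup-steps : ∀ s₀ s₁ s₂ s₃ → Runs power s₀ s₁ → Runs candidates s₁ s₂ → Runs constraintBase s₂ s₃ →
    rv s₀ kᵣ ≡ k → rv s₀ nᵣ ≡ n → rv s₀ cᵣ ≡ c → Ready s₃
  setup-steps s₀ s₁ s₂ s₃ e₁ e₂ e₃ k≡ n≡ c≡ = params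
    (trans (keepR e₃ kᵣ tt) k₂) (trans (keepR e₃ nᵣ tt) n₂)
    (trans (keepR e₃ cᵣ tt) (trans (keepR e₂ cᵣ tt) (trans (keepR e₁ cᵣ tt) c≡)))
    (trans (keepR e₃ powᵣ tt) (trans (keepR e₂ powᵣ tt) (subst (λ z → rv z powᵣ ≡ 2 ^ k) (sym (runs e₁)) (power-spec s₀ k≡))))
    (trans (keepR e₃ numᵣ tt) (subst (λ z → rv z numᵣ ≡ weakOrders k) (sym (runs e₂)) (candidates-spec s₁ k₁)))
    (subst (λ z → rv z baseᵣ ≡ 3 + k * n) (sym (runs e₃)) (base-spec s₂ k₂ n₂))
    where
    k₁ = trans (keepR e₁ kᵣ tt) k≡
    k₂ = trans (keepR e₂ kᵣ tt) k₁
    n₂ = trans (keepR e₂ nᵣ tt) (trans (keepR e₁ nᵣ tt) n≡)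

  constrained-steps : ∀ s₀ s₁ s₂ s₃ s₄ →
    Runs power s₀ s₁ → Runs candidates s₁ s₂ → Runs constraintBase s₂ s₃ → Runs users s₃ s₄ →
    rv s₀ kᵣ ≡ k → rv s₀ nᵣ ≡ n → rv s₀ cᵣ ≡ c → Blank s₀ → AnswerN (run search s₄)
  constrained-steps s₀ s₁ s₂ s₃ s₄ e₁ e₂ e₃ e₄ k≡ n≡ c≡ (blank , res≡) =
    search-spec s₄ (ready e₄ tt r₃)
      (subst (Rows n) (sym (runs e₄)) (users-rows s₃ r₃ λ x → trans (cong (λ f → f x) (blank₃ LEN tt tt tt)) (blank LEN x)))
      (λ u → trans (cong (λ f → f u) (trans (keepA e₄ MRK tt) (blank₃ MRK tt tt tt))) (blank MRK u))
      (λ u → trans (cong (λ f → f u) (trans (keepA e₄ DIG tt) (blank₃ DIG tt tt tt))) (blank DIG u))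
      (trans (keepR e₄ resᵣ tt) (trans (keepR e₃ resᵣ tt) (trans (keepR e₂ resᵣ tt) (trans (keepR e₁ resᵣ tt) res≡))))
    where
    r₃ : Ready s₃
    r₃ = setup-steps s₀ s₁ s₂ s₃ e₁ e₂ e₃ k≡ n≡ c≡
    blank₃ : ∀ a → T (freshA a power) → T (freshA a candidates) → T (freshA a constraintBase) → ar s₃ a ≡ ar s₀ a
    blank₃ a h₁ h₂ h₃ = trans (keepA e₃ a h₃) (trans (keepA e₂ a h₂) (keepA e₁ a h₁))

  run-seq₅ : ∀ (Q : Store → Set) p₁ p₂ p₃ p₄ p₅ s →
    (∀ s₁ s₂ s₃ s₄ → Runs p₁ s s₁ → Runs p₂ s₁ s₂ → Runs p₃ s₂ s₃ → Runs p₄ s₃ s₄ → Q (run p₅ s₄)) →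
    Q (run (p₁ ▹ p₂ ▹ p₃ ▹ p₄ ▹ p₅) s)
  run-seq₅ Q p₁ p₂ p₃ p₄ p₅ s h = h _ _ _ _ (ran refl) (ran refl) (ran refl) (ran refl)

  constrained-spec : ∀ s → rv s kᵣ ≡ k → rv s nᵣ ≡ n → rv s cᵣ ≡ c → Blank s → AnswerN (run constrained s)
  constrained-spec s k≡ n≡ c≡ blank = run-seq₅ AnswerN power candidates constraintBase users search s
    λ s₁ s₂ s₃ s₄ e₁ e₂ e₃ e₄ → constrained-steps s s₁ s₂ s₃ s₄ e₁ e₂ e₃ e₄ k≡ n≡ c≡ blank

  run-choice : ∀ (Q : Store → Set) r e p q s →
    (∀ s₁ → Runs r s s₁ → (ev s₁ e ≢ 0 → Q (run p s₁)) × (ev s₁ e ≡ 0 → Q (run q s₁))) →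
    Q (run (r ▹ iff e p q) s)
  run-choice Q r e p q s h = run-iff Q {e} {p} {q} (run r s) (proj₁ (h _ (ran refl))) (proj₂ (h _ (ran refl)))

  record Loaded (s : Store) : Set where
    constructor loaded
    field
      k-in : rv s kᵣ ≡ k
      n-in : rv s nᵣ ≡ n
      c-in : rv s cᵣ ≡ c
      blank-in : Blank s

  afterReading : ∀ s s₁ → Blank s → Runs readParams s s₁ → Loaded s₁
  afterReading _ _ blank (ran refl) = loaded refl refl refl blank

  solve-spec : ∀ s → Blank s → (c ≡ 0 → ∀ t → t < k → ∃[ u ] u < n × mayDo u t ≡ true) → AnswerN (run solve s)
  solve-spec s₀ blank₀ auth = run-choice AnswerN readParams (rg cᵣ) constrained unconstrained s₀ λ s e →
    let loaded k≡ n≡ c≡ blank = afterReading s₀ s blank₀ e in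
      (λ _ → constrained-spec s k≡ n≡ c≡ blank)
    , (λ z → unconstrained-spec s k≡ n≡ (trans (sym c≡) z) (auth (trans (sym c≡) z)))

-- Running time

m≤m*n′ : ∀ m {n} → 1 ≤ n → m ≤ m * n
m≤m*n′ m {n} 1≤n = m≤m*n m n {{>-nonZero 1≤n}}

*-pos : ∀ {m n} → 1 ≤ m → 1 ≤ n → 1 ≤ m * n
*-pos = *-mono-≤

tm-readParams subsetsC passC userC checkC candidateC searchC setupC timeC : ℕ
tm-readParams = suc (costₑ (inp (num 0))) + (suc (costₑ (inp (num 1))) + suc (costₑ (inp (num 2))))
subsetsC   = size (SUB ⟦ num 0 ⟧:= num 1) + (size (wᵣ := num 1) + size (qᵣ := num 3 ⊞ rg uᵣ))
             + (14 + (size doubleTable + (size (wᵣ := rg wᵣ ⊞ rg wᵣ) + size (qᵣ := rg qᵣ ⊞ rg nᵣ))))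
passC      = subsetsC + size push
userC      = size column + suc (costₑ (rg kᵣ ⊟ LEN ⟦ rg τᵣ ⟧) + 1)
checkC     = size (okᵣ := num 1 ⊟ rg failᵣ) + (size (qᵣ := rg baseᵣ) + (14 + size testConstraint))
candidateC = size decode + (size greedy + (size assign + (checkC + (size save + size increment))))
searchC    = 14 + candidateC
setupC     = size power + (size candidates + size constraintBase)
timeC      = (tm-readParams + suc (costₑ (rg cᵣ))) + ((size unconstrained + 14 + size (for uᵣ upto nᵣ ⟲ lastAuthorised))
             + ((14 + userC) + (setupC + (2 * passC + searchC))))

module TimeBound (I : List ℕ) where
  open Solver I public
  open Timing I public

  tm-iff : ∀ (Q : ℕ → Store → Set) {e p q} s →
    (ev s e ≢ 0 → Q (tm p s) (run p s)) → (ev s e ≡ 0 → Q (tm q s) (run q s)) →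
    Q (if nz (ev s e) then tm p s else tm q s) (run (iff e p q) s)
  tm-iff Q {e} s h₁ h₀ with ev s e
  ... | zero  = h₀ refl
  ... | suc _ = h₁ λ ()

  -- The potential method: a round may exceed `K` by `B` for each unit that it adds to `Φ`, and
  -- these surcharges telescope over the loop.
  tm-for-amortised : ∀ x b p {m} (J : Store → Set) (Φ : Store → ℕ) (B K : ℕ) s → rv s b ≡ m →
    J s → (∀ t v → J t → J (setR x v t)) → (∀ t v → Φ (setR x v t) ≡ Φ t) →
    (∀ i t → i < m → Agree (for x upto b ⟲ p) t s → J t →
      J (run p (setR x i t)) × tm p (setR x i t) + B * Φ t ≤ K + B * Φ (run p (setR x i t))) →
    tm (for x upto b ⟲ p) s + B * Φ s ≤ 6 + m * (8 + K) + B * Φ (run (for x upto b ⟲ p) s)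
    × J (run (for x upto b ⟲ p) s)
  tm-for-amortised x b p {m} J Φ B K s refl j₀ jstable stable step =
      ≤-trans (≤-reflexive (+-assoc 2 _ (B * Φ s)))
        (≤-trans (+-monoʳ-≤ 2 (go m 0 refl))
          (≤-reflexive (trans (arith (m * (8 + K)) (B * Φ (S m))) (cong (λ z → 6 + m * (8 + K) + B * z) (sym (stable (S m) m))))))
    , jstable (S m) m (invariant m ≤-refl)
    where
    S : ℕ → Store
    S i = repeat (λ j t → run p (setR x j t)) i s
    arith : ∀ a b → 2 + (a + 4 + b) ≡ 6 + a + b
    arith = solve-∀
    invariant : ∀ i → i ≤ m → J (S i)
    invariant zero    _   = j₀
    invariant (suc i) i<m = proj₁ (step i (S i) i<m (agree-rounds {x} {b} i s) (invariant i (<⇒≤ i<m)))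
    go : ∀ j i → i + j ≡ m → loopTime (λ i → tm p (setR x i (S i))) i j + B * Φ (S i) ≤ j * (8 + K) + 4 + B * Φ (S m)
    go zero i i+0≡m with trans (sym (+-identityʳ i)) i+0≡m
    ... | refl = ≤-refl
    go (suc j) i i+j≡m = begin
      4 + ((cᵢ + 4) + L) + B * Φ (S i)           ≡⟨ e₁ cᵢ L (B * Φ (S i)) ⟩
      8 + L + (cᵢ + B * Φ (S i))                 ≤⟨ +-monoʳ-≤ (8 + L) (proj₂ (step i (S i) i<m (agree-rounds {x} {b} i s) (invariant i (<⇒≤ i<m)))) ⟩
      8 + L + (K + B * Φ (S (suc i)))            ≡⟨ e₂ K L (B * Φ (S (suc i))) ⟩
      8 + K + (L + B * Φ (S (suc i)))            ≤⟨ +-monoʳ-≤ (8 + K) (go j (suc i) (trans (sym (+-suc i j)) i+j≡m)) ⟩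
      8 + K + (j * (8 + K) + 4 + B * Φ (S m))    ≡⟨ e₃ (8 + K) (j * (8 + K)) (B * Φ (S m)) ⟩
      8 + K + j * (8 + K) + 4 + B * Φ (S m)      ∎
      where
      open ≤-Reasoning
      cᵢ = tm p (setR x i (S i))
      L = loopTime (λ i → tm p (setR x i (S i))) (suc i) j
      i<m : i < m
      i<m = ≤-trans (s≤s (m≤m+n i j)) (≤-reflexive (trans (sym (+-suc i j)) i+j≡m))
      e₁ : ∀ c L b → 4 + ((c + 4) + L) + b ≡ 8 + L + (c + b)
      e₁ = solve-∀
      e₂ : ∀ K L b → 8 + L + (K + b) ≡ 8 + K + (L + b)
      e₂ = solve-∀
      e₃ : ∀ a z b → a + (z + 4 + b) ≡ a + z + 4 + b
      e₃ = solve-∀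

  tm-k : ∀ p {d} → T (loopsOnly kᵣ p) → T (fresh kᵣ p) → T (depth p ≤ᵇ d) → ∀ s → rv s kᵣ ≡ k → 1 ≤ k →
    tm p s ≤ size p * k ^ d
  tm-k p {d} only fr dep s k≡ 1≤k = ≤-trans
    (subst (λ z → tm p s ≤ size p * z ^ depth p) k≡ (tm≤ p kᵣ only fr s (subst (1 ≤_) (sym k≡) 1≤k)))
    (*-monoʳ-≤ (size p) (^-monoʳ k 1≤k (≤ᵇ⇒≤ (depth p) d dep)))

  tm-pow : ∀ p → T (loopsOnly powᵣ p) → T (fresh powᵣ p) → T (depth p ≤ᵇ 1) → ∀ s → rv s powᵣ ≡ 2 ^ k →
    tm p s ≤ size p * 2 ^ k
  tm-pow p only fr dep s pow≡ = ≤-trans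
    (subst (λ z → tm p s ≤ size p * z ^ depth p) pow≡ (tm≤ p powᵣ only fr s (subst (1 ≤_) (sym pow≡) (m^n>0 2 k))))
    (*-monoʳ-≤ (size p) (≤-trans (^-monoʳ (2 ^ k) (m^n>0 2 k) (≤ᵇ⇒≤ (depth p) 1 dep)) (≤-reflexive (*-identityʳ (2 ^ k)))))

  loop-arith : ∀ a m d X → 1 ≤ m → 1 ≤ X → a + (6 + m * (8 + d * X)) ≤ (a + (14 + d)) * (m * X)
  loop-arith a m d X 1≤m 1≤X = begin
    a + (6 + m * (8 + d * X))
      ≤⟨ +-mono-≤ (m≤m*n′ a mX) (+-mono-≤ (m≤m*n′ 6 mX) (*-monoʳ-≤ m (+-monoˡ-≤ (d * X) (m≤m*n′ 8 1≤X)))) ⟩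
    a * (m * X) + (6 * (m * X) + m * (8 * X + d * X))
      ≡⟨ e a m d X ⟩
    (a + (14 + d)) * (m * X) ∎
    where
    open ≤-Reasoning
    mX = *-pos 1≤m 1≤X
    e : ∀ a m d X → a * (m * X) + (6 * (m * X) + m * (8 * X + d * X)) ≡ (a + (14 + d)) * (m * X)
    e = solve-∀

  -- Two loop bounds meet here, k outside and 2^k inside, so the bound for a single register covers
  -- only `doubleTable` and the outer loop is counted by hand.
  subsets-time : ∀ s → Ready s → 1 ≤ k → tm subsets s ≤ subsetsC * (k * 2 ^ k)
  subsets-time s r 1≤k = ≤-trans
    (≤-trans (≤-reflexive (trans (cong₂ (λ x y → x + (y + (suc (costₑ (num 3 ⊞ rg uᵣ)) + tm (for sᵣ upto kᵣ ⟲ body) s₀)))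
          (size-⟦⟧:= SUB (num 0) (num 1)) (size-:= wᵣ (num 1)))
        (trans (cong (λ z → a₁ + (a₂ + (z + tm (for sᵣ upto kᵣ ⟲ body) s₀))) (size-:= qᵣ (num 3 ⊞ rg uᵣ)))
          (regroup a₁ a₂ a₃ (tm (for sᵣ upto kᵣ ⟲ body) s₀)))))
      (+-monoʳ-≤ (a₁ + (a₂ + a₃)) (subst (λ z → tm (for sᵣ upto kᵣ ⟲ body) s₀ ≤ 6 + z * (8 + dT * 2 ^ k)) (k≡ r)
        (tm-for {sᵣ} {kᵣ} {body} s₀ (dT * 2 ^ k) λ i t _ a →
          ≤-trans (+-mono-≤ (tm-pow doubleTable tt tt tt (setR sᵣ i t) (trans (regs a powᵣ tt) (pow≡ r)))
              (≤-trans (≤-reflexive (cong₂ _+_ (size-:= wᵣ (rg wᵣ ⊞ rg wᵣ)) (size-:= qᵣ (rg qᵣ ⊞ rg nᵣ)))) (m≤m*n′ rest (m^n>0 2 k))))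
            (≤-reflexive (sym (*-distribʳ-+ (2 ^ k) (size doubleTable) rest)))))))
    (loop-arith (a₁ + (a₂ + a₃)) k dT (2 ^ k) 1≤k (m^n>0 2 k))
    where
    a₁ = size (SUB ⟦ num 0 ⟧:= num 1)
    a₂ = size (wᵣ := num 1)
    a₃ = size (qᵣ := num 3 ⊞ rg uᵣ)
    rest = size (wᵣ := rg wᵣ ⊞ rg wᵣ) + size (qᵣ := rg qᵣ ⊞ rg nᵣ)
    dT = size doubleTable + rest
    body = doubleTable ▹ wᵣ := rg wᵣ ⊞ rg wᵣ ▹ qᵣ := rg qᵣ ⊞ rg nᵣ
    s₀ = run (SUB ⟦ num 0 ⟧:= num 1 ▹ wᵣ := num 1 ▹ qᵣ := num 3 ⊞ rg uᵣ) s
    regroup : ∀ a b c d → a + (b + (c + d)) ≡ (a + (b + c)) + d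
    regroup = solve-∀

  Lengths : Store → Set
  Lengths t = ∀ x → ar t LEN x ≤ k

  -- The number of entries of all rows pays for the updates of the rows.
  entries : Store → ℕ
  entries t = sumTo (λ j → ar t LEN (j * k)) (2 ^ k)

  pass : ℕ
  pass = passC * (k * 2 ^ k)

  -- The `suc` is the cost of the `nop` for a skipped user; a visit to the table is covered by the
  -- growth of `entries` alone.
  record Step (s t : Store) (time : ℕ) : Set where
    constructor amortised
    field
      lengths : Lengths t
      paid    : time + pass * entries s ≤ suc (pass * entries t)

  -- User `u` belongs to the row of its own set, and that row has room. It therefore gains an entry,
  -- and one unit of potential is worth one `pass`.
  pass-step : ∀ s s₁ s₂ {u} → 1 ≤ k → Ready s → rv s uᵣ ≡ u → Lengths s →
    ar s LEN (mask (mayDo u) k * k) < k → Runs subsets s s₁ → Runs push s₁ s₂ →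
    Step s s₂ (tm subsets s + tm push s₁)
  pass-step s s₁ s₂ {u} 1≤k r u≡ len room e₁ e₂ = amortised (Pushed.bounded pushed len₁) (begin
    tm subsets s + tm push s₁ + pass * entries s
      ≤⟨ +-monoˡ-≤ (pass * entries s) (+-mono-≤ (subsets-time s r 1≤k)
           (≤-trans (tm-pow push tt tt tt s₁ (pow≡ r₁)) (*-monoʳ-≤ (size push) (m≤n*m (2 ^ k) k {{>-nonZero 1≤k}})))) ⟩
    subsetsC * (k * 2 ^ k) + size push * (k * 2 ^ k) + pass * entries s
      ≡⟨ cong (_+ pass * entries s) (sym (*-distribʳ-+ (k * 2 ^ k) subsetsC (size push))) ⟩
    pass + pass * entries s
      ≡⟨ sym (*-suc pass (entries s)) ⟩
    pass * suc (entries s)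
      ≤⟨ *-monoʳ-≤ pass more ⟩
    pass * entries s₂
      ≤⟨ n≤1+n _ ⟩
    suc (pass * entries s₂) ∎)
    where
    open ≤-Reasoning
    r₁ : Ready s₁
    r₁ = ready e₁ tt r
    len≡ : ar s₁ LEN ≡ ar s LEN
    len≡ = keepA e₁ LEN tt
    len₁ : Lengths s₁
    len₁ x = subst (λ f → f x ≤ k) (sym len≡) (len x)
    sub : ∀ b → nz (ar s₁ SUB (mask b k)) ≡ mayDoAll b u
    sub = subst (λ z → ∀ b → nz (ar z SUB (mask b k)) ≡ mayDoAll b u) (sym (runs e₁)) (subsets-spec s r u≡)
    pushed : Pushed s₁ s₂
    pushed = subst (Pushed s₁) (sym (runs e₂)) (proj₂ (push-spec s₁ r₁ (trans (keepR e₁ uᵣ tt) u≡) sub))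
    own : ar s₁ SUB (mask (mayDo u) k) ≢ 0
    own = nz⁻¹ (trans (sub (mayDo u)) (within-complete (mayDo u) (mayDo u) k λ _ _ h → h))
    more : suc (entries s) ≤ entries s₂
    more = subst (λ f → suc (sumTo (λ j → f (j * k)) (2 ^ k)) ≤ entries s₂) len≡
      (sumTo-strict (2 ^ k) (mask< (mayDo u) k) (λ j → Pushed.grows pushed (j * k))
        (Pushed.strictly pushed (mask (mayDo u) k) (mask< (mayDo u) k) own
          (subst (λ f → f (mask (mayDo u) k * k) < k) (sym len≡) room)))

  branch-step : ∀ s s₁ {u} → 1 ≤ k → Ready s → rv s uᵣ ≡ u → Lengths s → Runs column s s₁ →
    Step s (run (iff (rg kᵣ ⊟ LEN ⟦ rg τᵣ ⟧) (subsets ▹ push) nop) s₁)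
      (if nz (ev s₁ (rg kᵣ ⊟ LEN ⟦ rg τᵣ ⟧)) then tm (subsets ▹ push) s₁ else 1)
  branch-step s s₁ {u} 1≤k r u≡ len e = tm-iff (λ time t → Step s t time) {rg kᵣ ⊟ LEN ⟦ rg τᵣ ⟧} {subsets ▹ push} {nop} s₁
    (λ h → from (pass-step s₁ _ _ 1≤k r₁ (trans (keepR e uᵣ tt) u≡) len₁
        (subst₂ (λ a b → ar s₁ LEN a < b) τ≡ (k≡ r₁) (m∸n≢0⇒n<m h)) (ran refl) (ran refl)))
    (λ _ → amortised len₁ (≤-reflexive (cong (λ f → suc (pass * sumTo (λ j → f (j * k)) (2 ^ k))) (sym len≡))))
    where
    r₁ : Ready s₁
    r₁ = ready e tt r
    len≡ : ar s₁ LEN ≡ ar s LEN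
    len≡ = keepA e LEN tt
    len₁ : Lengths s₁
    len₁ x = subst (λ f → f x ≤ k) (sym len≡) (len x)
    τ≡ : rv s₁ τᵣ ≡ mask (mayDo u) k * k
    τ≡ = subst (λ z → rv z τᵣ ≡ mask (mayDo u) k * k) (sym (runs e)) (column-spec s (k≡ r) (n≡ r) u≡)
    from : ∀ {t time} → Step s₁ t time → Step s t time
    from {t} {time} (amortised l p) =
      amortised l (subst (λ f → time + pass * sumTo (λ j → f (j * k)) (2 ^ k) ≤ suc (pass * entries t)) len≡ p)

  record UserStep (s t : Store) (time : ℕ) : Set where
    constructor userStep
    field
      lengths : Lengths t
      paid    : time + pass * entries s ≤ userC * k + pass * entries t

  testC : ℕ
  testC = costₑ (rg kᵣ ⊟ LEN ⟦ rg τᵣ ⟧)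

  userStep-seq : ∀ r e p q s → 1 ≤ k → tm r s ≤ size column * k → costₑ e ≤ testC →
    Step s (run (iff e p q) (run r s)) (if nz (ev (run r s) e) then tm p (run r s) else tm q (run r s)) →
    UserStep s (run (r ▹ iff e p q) s) (tm (r ▹ iff e p q) s)
  userStep-seq r e p q s 1≤k r≤ e≤ (amortised l paid) = userStep l (begin
    tm r s + suc (costₑ e + time) + B
      ≡⟨ e₁ (tm r s) (costₑ e) time B ⟩
    tm r s + suc (costₑ e) + (time + B)
      ≤⟨ +-mono-≤ (+-mono-≤ r≤ (s≤s e≤)) paid ⟩
    size column * k + suc testC + suc B′
      ≡⟨ e₂ (size column * k) testC B′ ⟩
    size column * k + suc (testC + 1) + B′
      ≤⟨ +-monoˡ-≤ B′ (+-monoʳ-≤ (size column * k) (m≤m*n′ (suc (testC + 1)) 1≤k)) ⟩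
    size column * k + suc (testC + 1) * k + B′
      ≡⟨ cong (_+ B′) (sym (*-distribʳ-+ k (size column) (suc (testC + 1)))) ⟩
    userC * k + B′ ∎)
    where
    open ≤-Reasoning
    time = if nz (ev (run r s) e) then tm p (run r s) else tm q (run r s)
    B = pass * entries s
    B′ = pass * entries (run (iff e p q) (run r s))
    e₁ : ∀ a E b c → a + suc (E + b) + c ≡ a + suc E + (b + c)
    e₁ = solve-∀
    e₂ : ∀ a E c → a + suc E + suc c ≡ a + suc (E + 1) + c
    e₂ = solve-∀

  addUser-time : ∀ s {u} → 1 ≤ k → Ready s → rv s uᵣ ≡ u → Lengths s → UserStep s (run addUser s) (tm addUser s)
  addUser-time s 1≤k r u≡ len = userStep-seq column (rg kᵣ ⊟ LEN ⟦ rg τᵣ ⟧) (subsets ▹ push) nop s 1≤k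
    (≤-trans (tm-k column {1} tt tt tt s (k≡ r) 1≤k) (≤-reflexive (cong (size column *_) (*-identityʳ k)))) ≤-refl
    (branch-step s _ 1≤k r u≡ len (ran refl))

  -- The potential can never exceed 2^k rows of k entries, which caps the number of passes whatever
  -- n is.
  userLoop-time : ∀ p → T (keepsParams (for uᵣ upto nᵣ ⟲ p)) →
    (∀ s {u} → Ready s → rv s uᵣ ≡ u → Lengths s → UserStep s (run p s) (tm p s)) →
    ∀ s → Ready s → 1 ≤ k → 1 ≤ n → (∀ x → ar s LEN x ≡ 0) →
    tm (for uᵣ upto nᵣ ⟲ p) s ≤ (14 + userC) * (k * n) + pass * (2 ^ k * k)
  userLoop-time p keeps step s r 1≤k 1≤n blank =
    let total , len = tm-for-amortised uᵣ nᵣ p Lengths entries pass (userC * k) s (n≡ r)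
          (λ x → ≤-trans (≤-reflexive (blank x)) z≤n) (λ _ _ j → j) (λ _ _ → refl)
          (λ i t i<n a len → let u = step (setR uᵣ i t) (ready-agree (for uᵣ upto nᵣ ⟲ p) keeps a r) refl len in
            UserStep.lengths u , UserStep.paid u)
    in ≤-trans (m≤m+n (tm (for uᵣ upto nᵣ ⟲ p) s) (pass * entries s)) (≤-trans total (+-mono-≤ main
         (*-monoʳ-≤ pass (sumTo-≤ (2 ^ k) λ j → len (j * k)))))
    where
    main : 6 + n * (8 + userC * k) ≤ (14 + userC) * (k * n)
    main = ≤-trans (loop-arith 0 n userC k 1≤n 1≤k) (≤-reflexive (cong ((14 + userC) *_) (*-comm n k)))

  users-time : ∀ s → Ready s → 1 ≤ k → 1 ≤ n → (∀ x → ar s LEN x ≡ 0) →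
    tm users s ≤ (14 + userC) * (k * n) + pass * (2 ^ k * k)
  users-time s r 1≤k = userLoop-time addUser tt (λ s → addUser-time s 1≤k) s r 1≤k

  check-time : ∀ s → Ready s → 1 ≤ k → 1 ≤ c → tm check s ≤ checkC * (c * k ^ 2)
  check-time s r 1≤k 1≤c = ≤-trans
    (≤-trans (≤-reflexive (trans (cong₂ (λ x y → x + (y + tm (for jᵣ upto cᵣ ⟲ testConstraint) s₀))
          (size-:= okᵣ (num 1 ⊟ rg failᵣ)) (size-:= qᵣ (rg baseᵣ)))
        (sym (+-assoc a₁ a₂ (tm (for jᵣ upto cᵣ ⟲ testConstraint) s₀)))))
      (+-monoʳ-≤ (a₁ + a₂) (subst (λ z → tm (for jᵣ upto cᵣ ⟲ testConstraint) s₀ ≤ 6 + z * (8 + size testConstraint * k ^ 2)) (c≡ r)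
        (tm-for {jᵣ} {cᵣ} {testConstraint} s₀ (size testConstraint * k ^ 2) λ i t _ a →
          tm-k testConstraint {2} tt tt tt (setR jᵣ i t) (trans (regs a kᵣ tt) (k≡ r)) 1≤k))))
    (≤-trans (loop-arith (a₁ + a₂) c (size testConstraint) (k ^ 2) 1≤c (m^n>0 k {{>-nonZero 1≤k}} 2))
      (≤-reflexive (cong (_* (c * k ^ 2)) (+-assoc a₁ a₂ (14 + size testConstraint)))))
    where
    a₁ = size (okᵣ := num 1 ⊟ rg failᵣ)
    a₂ = size (qᵣ := rg baseᵣ)
    s₀ = run (okᵣ := num 1 ⊟ rg failᵣ ▹ qᵣ := rg baseᵣ) s

  candidate-steps : ∀ s s₁ s₂ s₃ s₄ s₅ → Runs decode s s₁ → Runs greedy s₁ s₂ → Runs assign s₂ s₃ →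
    Runs check s₃ s₄ → Runs save s₄ s₅ → Ready s → 1 ≤ k → 1 ≤ c →
    tm decode s + (tm greedy s₁ + (tm assign s₂ + (tm check s₃ + (tm save s₄ + tm increment s₅)))) ≤ candidateC * (c * k ^ 2)
  candidate-steps s s₁ s₂ s₃ s₄ s₅ e₁ e₂ e₃ e₄ e₅ r 1≤k 1≤c = ≤-trans
    (+-mono-≤ (block decode tt tt tt s r) (+-mono-≤ (block greedy tt tt tt s₁ r₁) (+-mono-≤ (block assign tt tt tt s₂ r₂)
      (+-mono-≤ (check-time s₃ r₃ 1≤k 1≤c) (+-mono-≤ (block save tt tt tt s₄ r₄) (block increment tt tt tt s₅ r₅))))))
    (≤-reflexive (collect (size decode) (size greedy) (size assign) checkC (size save) (size increment) (c * k ^ 2)))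
    where
    r₁ = ready e₁ tt r
    r₂ = ready e₂ tt r₁
    r₃ = ready e₃ tt r₂
    r₄ = ready e₄ tt r₃
    r₅ = ready e₅ tt r₄
    block : ∀ p → T (loopsOnly kᵣ p) → T (fresh kᵣ p) → T (depth p ≤ᵇ 2) → ∀ s → Ready s → tm p s ≤ size p * (c * k ^ 2)
    block p h₁ h₂ h₃ s r = ≤-trans (tm-k p {2} h₁ h₂ h₃ s (k≡ r) 1≤k)
      (*-monoʳ-≤ (size p) (m≤n*m (k ^ 2) c {{>-nonZero 1≤c}}))
    collect : ∀ a b c d e f X → a * X + (b * X + (c * X + (d * X + (e * X + f * X)))) ≡ (a + (b + (c + (d + (e + f))))) * X
    collect = solve-∀

  tm-seq₆ : ∀ p₁ p₂ p₃ p₄ p₅ p₆ s {B} →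
    (∀ s₁ s₂ s₃ s₄ s₅ → Runs p₁ s s₁ → Runs p₂ s₁ s₂ → Runs p₃ s₂ s₃ → Runs p₄ s₃ s₄ → Runs p₅ s₄ s₅ →
      tm p₁ s + (tm p₂ s₁ + (tm p₃ s₂ + (tm p₄ s₃ + (tm p₅ s₄ + tm p₆ s₅)))) ≤ B) →
    tm (p₁ ▹ p₂ ▹ p₃ ▹ p₄ ▹ p₅ ▹ p₆) s ≤ B
  tm-seq₆ p₁ p₂ p₃ p₄ p₅ p₆ s h = h _ _ _ _ _ (ran refl) (ran refl) (ran refl) (ran refl) (ran refl)

  candidate-time : ∀ s → Ready s → 1 ≤ k → 1 ≤ c → tm tryCandidate s ≤ candidateC * (c * k ^ 2)
  candidate-time s r 1≤k 1≤c = tm-seq₆ decode greedy assign check save increment s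
    λ s₁ s₂ s₃ s₄ s₅ e₁ e₂ e₃ e₄ e₅ → candidate-steps s s₁ s₂ s₃ s₄ s₅ e₁ e₂ e₃ e₄ e₅ r 1≤k 1≤c

  searchLoop-time : ∀ p → T (keepsParams (for xᵣ upto numᵣ ⟲ p)) →
    (∀ s → Ready s → tm p s ≤ candidateC * (c * k ^ 2)) →
    ∀ s → Ready s → 1 ≤ k → 1 ≤ c → tm (for xᵣ upto numᵣ ⟲ p) s ≤ searchC * (weakOrders k * (c * k ^ 2))
  searchLoop-time p keeps body s r 1≤k 1≤c = ≤-trans
    (subst (λ z → tm (for xᵣ upto numᵣ ⟲ p) s ≤ 6 + z * (8 + candidateC * (c * k ^ 2))) (num≡ r)
      (tm-for {xᵣ} {numᵣ} {p} s (candidateC * (c * k ^ 2)) λ i t _ a →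
        body (setR xᵣ i t) (ready-agree (for xᵣ upto numᵣ ⟲ p) keeps a r)))
    (loop-arith 0 (weakOrders k) candidateC (c * k ^ 2) (weakOrders>0 k) (*-pos 1≤c (m^n>0 k {{>-nonZero 1≤k}} 2)))

  search-time : ∀ s → Ready s → 1 ≤ k → 1 ≤ c → tm search s ≤ searchC * (weakOrders k * (c * k ^ 2))
  search-time s r 1≤k 1≤c = searchLoop-time tryCandidate tt (λ s r → candidate-time s r 1≤k 1≤c) s r 1≤k 1≤c

  -- The search term, still in the form that `weakOrders-bound` will turn into a multiple of c (k -
  -- 1)^k.
  hard : ℕ
  hard = weakOrders k * (c * k ^ 2)

  -- Passes of cost k 2^k, at most 2^k k in number, amount to 4^k k^2. This fits into the search
  -- term because c is at least 1.
  pass-total : 1 ≤ c → pass * (2 ^ k * k) ≤ 2 * passC * hard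
  pass-total 1≤c = begin
    passC * (k * P) * (P * k)             ≡⟨ e₁ passC k P ⟩
    passC * (P * P * (k * k))             ≤⟨ *-monoʳ-≤ passC (*-monoˡ-≤ (k * k) (4^-≤-weakOrders k)) ⟩
    passC * (2 * weakOrders k * (k * k))  ≤⟨ *-monoʳ-≤ passC (*-monoʳ-≤ (2 * weakOrders k) (m≤n*m (k * k) c {{>-nonZero 1≤c}})) ⟩
    passC * (2 * weakOrders k * (c * (k * k)))  ≡⟨ e₂ passC (weakOrders k) c k ⟩
    2 * passC * hard                      ∎
    where
    open ≤-Reasoning
    P = 2 ^ k
    e₁ : ∀ a k P → a * (k * P) * (P * k) ≡ a * (P * P * (k * k))
    e₁ = solve-∀
    e₂ : ∀ a N c k → a * (2 * N * (c * (k * k))) ≡ 2 * a * (N * (c * (k * (k * 1))))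
    e₂ = solve-∀

  constrained-steps-time : ∀ s s₁ s₂ s₃ s₄ →
    Runs power s s₁ → Runs candidates s₁ s₂ → Runs constraintBase s₂ s₃ → Runs users s₃ s₄ →
    rv s kᵣ ≡ k → rv s nᵣ ≡ n → rv s cᵣ ≡ c → Blank s → 1 ≤ k → 1 ≤ n → 1 ≤ c →
    tm power s + (tm candidates s₁ + (tm constraintBase s₂ + (tm users s₃ + tm search s₄)))
      ≤ (14 + userC) * (k * n) + (setupC + (2 * passC + searchC)) * hard
  constrained-steps-time s s₁ s₂ s₃ s₄ e₁ e₂ e₃ e₄ k≡ n≡ c≡ (blank , _) 1≤k 1≤n 1≤c = ≤-trans
    (+-mono-≤ (block power tt tt tt s k≡) (+-mono-≤ (block candidates tt tt tt s₁ k₁) (+-mono-≤ (block constraintBase tt tt tt s₂ k₂)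
      (+-mono-≤ (≤-trans (users-time s₃ r₃ 1≤k 1≤n λ x → trans (cong (λ f → f x) (trans (keepA e₃ LEN tt) (trans (keepA e₂ LEN tt) (keepA e₁ LEN tt)))) (blank LEN x))
                          (+-monoʳ-≤ ((14 + userC) * (k * n)) (pass-total 1≤c)))
        (search-time s₄ (ready e₄ tt r₃) 1≤k 1≤c)))))
    (≤-reflexive (collect (size power) (size candidates) (size constraintBase) ((14 + userC) * (k * n)) (2 * passC) searchC hard))
    where
    r₃ = setup-steps s s₁ s₂ s₃ e₁ e₂ e₃ k≡ n≡ c≡
    k₁ = trans (keepR e₁ kᵣ tt) k≡
    k₂ = trans (keepR e₂ kᵣ tt) k₁
    block : ∀ p → T (loopsOnly kᵣ p) → T (fresh kᵣ p) → T (depth p ≤ᵇ 2) → ∀ s → rv s kᵣ ≡ k → tm p s ≤ size p * hard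
    block p h₁ h₂ h₃ s k≡ = ≤-trans (tm-k p {2} h₁ h₂ h₃ s k≡ 1≤k)
      (*-monoʳ-≤ (size p) (≤-trans (m≤n*m (k ^ 2) c {{>-nonZero 1≤c}}) (m≤n*m (c * k ^ 2) (weakOrders k) {{>-nonZero (weakOrders>0 k)}})))
    collect : ∀ a b c u p d X → a * X + (b * X + (c * X + ((u + p * X) + d * X))) ≡ u + ((a + (b + c)) + (p + d)) * X
    collect = solve-∀

  unconstrained-time : ∀ s → rv s kᵣ ≡ k → rv s nᵣ ≡ n → 1 ≤ k → 1 ≤ n →
    tm unconstrained s ≤ (size unconstrained + 14 + size (for uᵣ upto nᵣ ⟲ lastAuthorised)) * (k * n)
  unconstrained-time s k≡ n≡ 1≤k 1≤n = begin
    suc (costₑ (num 3)) + (tm outer s₀ + suc (costₑ (num 1)))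
      ≡⟨ cong₂ (λ x y → x + (tm outer s₀ + y)) (size-:= qᵣ (num 3)) (size-:= resᵣ (num 1)) ⟩
    a + (tm outer s₀ + b)              ≤⟨ +-monoʳ-≤ a (+-monoˡ-≤ b main) ⟩
    a + (6 + k * (8 + d * n) + b)      ≡⟨ e₁ a b (6 + k * (8 + d * n)) ⟩
    a + b + (6 + k * (8 + d * n))      ≤⟨ loop-arith (a + b) k d n 1≤k 1≤n ⟩
    (a + b + (14 + d)) * (k * n)       ≤⟨ *-monoˡ-≤ (k * n) (≤-trans (+-monoˡ-≤ (14 + d) ab≤) (≤-reflexive (sym (+-assoc (size unconstrained) 14 d)))) ⟩
    (size unconstrained + 14 + d) * (k * n) ∎
    where
    open ≤-Reasoning
    inner = for uᵣ upto nᵣ ⟲ lastAuthorised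
    outer = for sᵣ upto kᵣ ⟲ inner
    a = size (qᵣ := num 3)
    b = size (resᵣ := num 1)
    d = size inner
    s₀ = run (qᵣ := num 3) s
    e₁ : ∀ a b x → a + (x + b) ≡ a + b + x
    e₁ = solve-∀
    ab≤ : a + b ≤ size unconstrained
    ab≤ = ≤-trans (+-monoʳ-≤ a (m≤n+m b (size outer)))
      (≤-reflexive (sym (trans (size-▹ (qᵣ := num 3) (outer ▹ resᵣ := num 1)) (cong (a +_) (size-▹ outer (resᵣ := num 1))))))
    main : tm outer s₀ ≤ 6 + k * (8 + d * n)
    main = subst (λ z → tm outer s₀ ≤ 6 + z * (8 + d * n)) k≡
      (tm-for {sᵣ} {kᵣ} {inner} s₀ (d * n) λ i t _ g →
        let eq = trans (regs g nᵣ tt) n≡ in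
        ≤-trans (tm≤ inner nᵣ tt tt (setR sᵣ i t) (subst (1 ≤_) (sym eq) 1≤n))
          (≤-reflexive (trans (cong (λ z → d * z ^ 1) eq) (cong (d *_) (*-identityʳ n)))))

  tm-seq₅ : ∀ p₁ p₂ p₃ p₄ p₅ s {B} →
    (∀ s₁ s₂ s₃ s₄ → Runs p₁ s s₁ → Runs p₂ s₁ s₂ → Runs p₃ s₂ s₃ → Runs p₄ s₃ s₄ →
      tm p₁ s + (tm p₂ s₁ + (tm p₃ s₂ + (tm p₄ s₃ + tm p₅ s₄))) ≤ B) →
    tm (p₁ ▹ p₂ ▹ p₃ ▹ p₄ ▹ p₅) s ≤ B
  tm-seq₅ p₁ p₂ p₃ p₄ p₅ s h = h _ _ _ _ (ran refl) (ran refl) (ran refl) (ran refl)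

  easyC hardC : ℕ
  easyC = size unconstrained + 14 + size (for uᵣ upto nᵣ ⟲ lastAuthorised)
  hardC = (14 + userC) + (setupC + (2 * passC + searchC))

  constrained-time : ∀ s → rv s kᵣ ≡ k → rv s nᵣ ≡ n → rv s cᵣ ≡ c → Blank s → 1 ≤ k → 1 ≤ n → 1 ≤ c →
    tm constrained s ≤ hardC * (k * n + hard)
  constrained-time s k≡ n≡ c≡ blank 1≤k 1≤n 1≤c = tm-seq₅ power candidates constraintBase users search s
    λ s₁ s₂ s₃ s₄ e₁ e₂ e₃ e₄ → ≤-trans (constrained-steps-time s s₁ s₂ s₃ s₄ e₁ e₂ e₃ e₄ k≡ n≡ c≡ blank 1≤k 1≤n 1≤c)
      (add (14 + userC) (setupC + (2 * passC + searchC)) (k * n) hard)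
    where
    add : ∀ V W x y → V * x + W * y ≤ (V + W) * (x + y)
    add V W x y = ≤-trans (+-mono-≤ (*-monoʳ-≤ V (m≤m+n x y)) (*-monoʳ-≤ W (m≤n+m y x)))
      (≤-reflexive (sym (*-distribʳ-+ (x + y) V W)))

  choice-time : ∀ r e p q s X → 1 ≤ X →
    (∀ s₁ → Runs r s s₁ → (ev s₁ e ≢ 0 → tm p s₁ ≤ hardC * X) × (ev s₁ e ≡ 0 → tm q s₁ ≤ easyC * X)) →
    tm (r ▹ iff e p q) s ≤ ((tm r s + suc (costₑ e)) + (easyC + hardC)) * X
  choice-time r e p q s X 1≤X h = begin
    tm r s + suc (costₑ e + (if nz (ev s₁ e) then tm p s₁ else tm q s₁))
      ≤⟨ +-monoʳ-≤ (tm r s) (s≤s (+-monoʳ-≤ (costₑ e) (tm-iff (λ time _ → time ≤ E * X) {e} {p} {q} s₁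
           (λ z → ≤-trans (proj₁ (h s₁ (ran refl)) z) (*-monoˡ-≤ X (m≤n+m hardC easyC)))
           (λ z → ≤-trans (proj₂ (h s₁ (ran refl)) z) (*-monoˡ-≤ X (m≤m+n easyC hardC)))))) ⟩
    tm r s + suc (costₑ e + E * X)
      ≡⟨ e₁ (tm r s) (costₑ e) (E * X) ⟩
    tm r s + suc (costₑ e) + E * X
      ≤⟨ +-monoˡ-≤ (E * X) (m≤m*n′ (tm r s + suc (costₑ e)) 1≤X) ⟩
    (tm r s + suc (costₑ e)) * X + E * X
      ≡⟨ sym (*-distribʳ-+ X (tm r s + suc (costₑ e)) E) ⟩
    ((tm r s + suc (costₑ e)) + E) * X ∎
    where
    open ≤-Reasoning
    s₁ = run r s
    E = easyC + hardC
    e₁ : ∀ a b z → a + suc (b + z) ≡ (a + suc b) + z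
    e₁ = solve-∀

  solve-time : ∀ s → Blank s → 1 ≤ k → 1 ≤ n → tm solve s ≤ timeC * (k * n + hard)
  solve-time s₀ blank₀ 1≤k 1≤n = choice-time readParams (rg cᵣ) constrained unconstrained s₀ (k * n + hard)
    (≤-trans (*-pos 1≤k 1≤n) (m≤m+n (k * n) hard)) λ s e →
    let loaded k≡ n≡ c≡ blank = afterReading s₀ s blank₀ e in
      (λ z → constrained-time s k≡ n≡ c≡ blank 1≤k 1≤n (n≢0⇒n>0 λ c≡0 → z (trans c≡ c≡0)))
    , (λ _ → ≤-trans (unconstrained-time s k≡ n≡ 1≤k 1≤n) (*-monoʳ-≤ easyC (m≤m+n (k * n) hard)))

-- The output, and instances as inputs

-- The plan lies in the cells 8 i + 7, but an answer is read from the cells 0 to k - 1. Addressing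
-- these crosses the array layout and so takes place outside the LOOP language.
copyStep copyOut program : Program
copyStep = store (var sᵣ) (load (addrₑ BST (var sᵣ))) ⨾ sᵣ ≔ var sᵣ ⊕ lit 1
copyOut  = sᵣ ≔ lit 0 ⨾ while var kᵣ ⊖ var sᵣ loop copyStep ⨾ 0 ≔ var resᵣ
program  = compile solve ⨾ copyOut

roundC copyC : ℕ
roundC = suc (3 + (suc (1 + cost (load (addrₑ BST (var sᵣ)))) + 4))
copyC  = 8 + roundC

m<addr : ∀ i → i < addr BST i
m<addr i = ≤-trans (s≤s (m≤m+n i (i + (dbl i + dbl (dbl i)) + 6))) (≤-reflexive (arith i))
  where
  arith : ∀ i → suc (i + (i + ((i + i) + ((i + i) + (i + i))) + 6)) ≡ (((i + i) + (i + i)) + ((i + i) + (i + i))) + 7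
  arith = solve-∀

module Copy (I : List ℕ) where

  -- Copying upwards never overwrites a cell that is still to be read, as
  -- cell i of the plan is read from an address above i.
  copy-rounds : ∀ {k} j i {σ} → i + j ≡ k → reg σ kᵣ ≡ k → reg σ sᵣ ≡ i →
    Σ[ τ ∈ State ] (I ⊢ while var kᵣ ⊖ var sᵣ loop copyStep , σ ⇓ τ ⟨ j * roundC + 4 ⟩)
      × reg τ resᵣ ≡ reg σ resᵣ × (∀ x → x < i → mem τ x ≡ mem σ x)
      × (∀ x → i ≤ x → x < k → mem τ x ≡ mem σ (addr BST x))
  copy-rounds {k} zero i {σ} i+0≡k k≡ s≡ = σ , ⇓stop test , refl , (λ _ _ → refl)
    , λ x i≤x x<k → ⊥-elim (<-irrefl refl (≤-trans x<k (≤-trans (≤-reflexive (sym i≡k)) i≤x)))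
    where
    i≡k = trans (sym (+-identityʳ i)) i+0≡k
    test : reg σ kᵣ ∸ reg σ sᵣ ≡ 0
    test rewrite k≡ | s≡ | i≡k = n∸n≡0 k
  copy-rounds {k} (suc j) i {σ} i+j≡k k≡ s≡ =
    let τ , d , res , low , high = copy-rounds j (suc i) {σ′} (trans (sym (+-suc i j)) i+j≡k) k≡
                                     (trans (cong (_+ 1) s≡) (+-comm i 1))
    in τ , subst (λ t → I ⊢ while var kᵣ ⊖ var sᵣ loop copyStep , σ ⇓ τ ⟨ t ⟩) (time (j * roundC) (suc (1 + cost (load (addrₑ BST (var sᵣ))))))
             (⇓loop test (⇓⨾ ⇓store ⇓≔) d)
       , res
       , (λ x x<i → trans (low x (m≤n⇒m≤1+n x<i)) (trans (cong (λ z → (mem σ [ z ↦ v ]) x) s≡) (get-set-≢ (mem σ) v (<⇒≢ x<i))))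
       , λ x i≤x x<k → copied {τ} x x<k low high (m≤n⇒m<n∨m≡n i≤x)
    where
    v = mem σ (addr BST (reg σ sᵣ))
    σ′ : State
    σ′ = ⟪ reg σ [ sᵣ ↦ reg σ sᵣ + 1 ] , mem σ [ reg σ sᵣ ↦ v ] ⟫
    test : reg σ kᵣ ∸ reg σ sᵣ ≢ 0
    test rewrite k≡ | s≡ | sym i+j≡k | m+n∸m≡n i (suc j) = λ ()
    time : ∀ z c → suc (3 + ((c + 4) + (z + 4))) ≡ suc (3 + (c + 4)) + z + 4
    time = solve-∀
    copied : ∀ {τ} x → x < k → (∀ x → x < suc i → mem τ x ≡ mem σ′ x) →
      (∀ x → suc i ≤ x → x < k → mem τ x ≡ mem σ′ (addr BST x)) → i < x ⊎ i ≡ x → mem τ x ≡ mem σ (addr BST x)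
    copied x x<k low high (inj₁ i<x) = trans (high x i<x x<k)
      (trans (cong (λ z → (mem σ [ z ↦ v ]) (addr BST x)) s≡) (get-set-≢ (mem σ) v (>⇒≢ (<-trans i<x (m<addr x)))))
    copied x x<k low high (inj₂ refl) = trans (low x ≤-refl)
      (trans (cong (λ z → (mem σ [ z ↦ v ]) x) s≡) (trans (get-set (mem σ) x v) (cong (λ z → mem σ (addr BST z)) s≡)))

  copyOut-spec : ∀ {k σ} → reg σ kᵣ ≡ k →
    Σ[ τ ∈ State ] (I ⊢ copyOut , σ ⇓ τ ⟨ 2 + ((k * roundC + 4) + 2) ⟩)
      × reg τ 0 ≡ reg σ resᵣ × (∀ x → x < k → mem τ x ≡ mem σ (addr BST x))
  copyOut-spec {k} {σ} k≡ =
    let τ , d , res , _ , high = copy-rounds k 0 {⟪ reg σ [ sᵣ ↦ 0 ] , mem σ ⟫} refl k≡ refl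
    in _ , ⇓⨾ ⇓≔ (⇓⨾ d ⇓≔) , res , λ x → high x z≤n

opaque
  totalC : ℕ
  totalC = (timeC + copyC) * 6144

  totalC≡ : totalC ≡ (timeC + copyC) * 6144
  totalC≡ = refl

-- The whole program: outcome and total time

module Run (I : List ℕ) where
  open TimeBound I public
  open Copy I

  solve-keeps-k : ∀ s → Blank s → rv (run solve s) kᵣ ≡ k
  solve-keeps-k s₀ blank₀ = run-choice (λ t → rv t kᵣ ≡ k) readParams (rg cᵣ) constrained unconstrained s₀ λ s e →
    let loaded k≡ _ _ _ = afterReading s₀ s blank₀ e in
      (λ _ → trans (frame constrained kᵣ tt s) k≡)
    , (λ _ → trans (frame unconstrained kᵣ tt s) k≡)

  Outcome : State → Set
  Outcome τ = (reg τ 0 ≡ 1 × (∃[ p ] ValidN p × (∀ i → i < k → mem τ i ≡ p i)))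
            ⊎ (reg τ 0 ≡ 0 × (∀ π → ¬ ValidN π))

  program-from : ∀ s → initial ≈ s → Blank s → (c ≡ 0 → ∀ t → t < k → ∃[ u ] u < n × mayDo u t ≡ true) →
    Σ[ τ ∈ State ] Σ[ t ∈ ℕ ] (I ⊢ program , initial ⇓ τ ⟨ t ⟩) × Outcome τ
      × (1 ≤ k → 1 ≤ n → t ≤ (timeC + copyC) * (k * n + hard))
  program-from s initial≈s blank auth =
    let σ , d , σ≈ = compile-sound solve tt initial≈s
        τ , d′ , res , copied = copyOut-spec {k} {σ} (trans (reg≡ σ≈ kᵣ) (solve-keeps-k s blank))
    in τ , _ , ⇓⨾ d d′
         , outcome {τ} {run solve s} (trans res (reg≡ σ≈ resᵣ)) (λ i i<k → trans (copied i i<k) (mem≡ σ≈ BST i (≤ᵇ⇒≤ 8 8 tt))) (solve-spec s blank auth)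
       , λ 1≤k 1≤n → total (tm solve s) (solve-time s blank 1≤k 1≤n) 1≤k 1≤n
    where
    outcome : ∀ {τ t} → reg τ 0 ≡ rv t resᵣ → (∀ i → i < k → mem τ i ≡ ar t BST i) → AnswerN t → Outcome τ
    outcome res m (found r v)   = inj₁ (trans res r , _ , v , m)
    outcome res m (absent r none-valid) = inj₂ (trans res r , none-valid)
    total : ∀ time → time ≤ timeC * (k * n + hard) → 1 ≤ k → 1 ≤ n →
      time + (2 + ((k * roundC + 4) + 2)) ≤ (timeC + copyC) * (k * n + hard)
    total time le 1≤k 1≤n = begin
      time + (2 + ((k * roundC + 4) + 2))        ≡⟨ cong (time +_) (e₁ (k * roundC)) ⟩
      time + (8 + k * roundC)                    ≤⟨ +-mono-≤ le (+-mono-≤ (m≤m*n′ 8 1≤kn) (≤-trans (≤-reflexive (*-comm k roundC)) (*-monoʳ-≤ roundC (m≤m*n′ k 1≤n)))) ⟩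
      timeC * X + (8 * (k * n) + roundC * (k * n)) ≡⟨ cong (timeC * X +_) (sym (*-distribʳ-+ (k * n) 8 roundC)) ⟩
      timeC * X + copyC * (k * n)                ≤⟨ +-monoʳ-≤ (timeC * X) (*-monoʳ-≤ copyC (m≤m+n (k * n) hard)) ⟩
      timeC * X + copyC * X                      ≡⟨ sym (*-distribʳ-+ X timeC copyC) ⟩
      (timeC + copyC) * X                        ∎
      where
      open ≤-Reasoning
      X = k * n + hard
      1≤kn = *-pos 1≤k 1≤n
      e₁ : ∀ a → 2 + ((a + 4) + 2) ≡ 8 + a
      e₁ = solve-∀

  total-time : ∀ {t} → t ≤ (timeC + copyC) * (k * n + hard) → 2 ≤ k → t ≤ totalC * (c * (k ∸ 1) ^ k + k * n)
  total-time {t} le 2≤k = ≤-trans le (≤-trans (scale (timeC + copyC) (weakOrders k) c (k * n) ((k ∸ 1) ^ k) (weakOrders-bound 2≤k))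
    (*-monoˡ-≤ (c * (k ∸ 1) ^ k + k * n) (≤-reflexive (sym totalC≡))))
    where
    scale : ∀ C N c m Y → N * (k * k) ≤ 6144 * Y → C * (m + N * (c * k ^ 2)) ≤ C * 6144 * (c * Y + m)
    scale C N c m Y h = begin
      C * (m + N * (c * k ^ 2))         ≡⟨ cong (λ z → C * (m + z)) (e₁ N c k) ⟩
      C * (m + c * (N * (k * k)))       ≤⟨ *-monoʳ-≤ C (+-mono-≤ (m≤n*m m 6144) (*-monoʳ-≤ c h)) ⟩
      C * (6144 * m + c * (6144 * Y))   ≡⟨ e₂ C m c Y ⟩
      C * 6144 * (c * Y + m)            ∎
      where
      open ≤-Reasoning
      e₁ : ∀ N c k → N * (c * (k * (k * 1))) ≡ c * (N * (k * k))
      e₁ = solve-∀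
      e₂ : ∀ C m c Y → C * (6144 * m + c * (6144 * Y)) ≡ C * 6144 * (c * Y + m)
      e₂ = solve-∀

-- Instances read back from their encoding

at-++ˡ : ∀ xs {ys} i → i < length xs → (xs ++ ys) at i ≡ xs at i
at-++ˡ (x ∷ xs) zero    _   = refl
at-++ˡ (x ∷ xs) (suc i) i<n = at-++ˡ xs i (s≤s⁻¹ i<n)

at-++ʳ : ∀ xs {ys} i → (xs ++ ys) at (length xs + i) ≡ ys at i
at-++ʳ []       i = refl
at-++ʳ (x ∷ xs) i = at-++ʳ xs i

length-bits : ∀ {n} (X : Subset n) → length (bits X) ≡ n
length-bits []      = refl
length-bits (x ∷ X) = cong suc (length-bits X)

bits-at : ∀ {n} (X : Subset n) i {ys} → (bits X ++ ys) at toℕ i ≡ bit (lookup X i)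
bits-at (x ∷ X) fzero    = refl
bits-at (x ∷ X) (fsuc i) = bits-at X i

bits-skip : ∀ {n} (X : Subset n) i {ys} → (bits X ++ ys) at (n + i) ≡ ys at i
bits-skip X i {ys} = trans (cong (λ z → (bits X ++ ys) at (z + i)) (sym (length-bits X))) (at-++ʳ (bits X) i)

encodeRel-at : ∀ {m n} (R : FinRel m n) i j {ys} →
  (encodeRel R ++ ys) at (toℕ j + toℕ i * n) ≡ bit (lookup (lookup R i) j)
encodeRel-at {n = n} (X ∷ R) fzero j {ys} =
  trans (cong₂ _at_ (++-assoc (bits X) (encodeRel R) ys) (+-identityʳ (toℕ j))) (bits-at X j)
encodeRel-at {n = n} (X ∷ R) (fsuc i) j {ys} = trans
  (cong₂ _at_ (++-assoc (bits X) (encodeRel R) ys) (swap (toℕ j) n (toℕ i * n)))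
  (trans (bits-skip X (toℕ j + toℕ i * n)) (encodeRel-at R i j))
  where
  swap : ∀ a b c → a + (b + c) ≡ b + (a + c)
  swap = solve-∀

encodeRel-skip : ∀ {m n} (R : FinRel m n) x {ys} → (encodeRel R ++ ys) at (m * n + x) ≡ ys at x
encodeRel-skip []      x = refl
encodeRel-skip {suc m} {n} (X ∷ R) x {ys} = trans
  (cong₂ _at_ (++-assoc (bits X) (encodeRel R) ys) (+-assoc n (m * n) x))
  (trans (bits-skip X (m * n + x)) (encodeRel-skip R x))

symbol : ∀ {n} → FinRel n n → ℕ
symbol {n} ρ = if does (ρ ≟ᴿ Δ n) then 0 else 1

-- Stated for an arbitrary reading function, so that it can be moved along the input by
-- `cells-cong`.
record Cells {k n} (cells : ℕ → ℕ) (con : Constraint k n) : Set where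
  constructor cellsOf
  open Constraint con
  field
    at-symbol : cells 0 ≡ symbol ρ
    at-S₁     : ∀ s → cells (1 + toℕ s) ≡ bit (lookup S₁ s)
    at-S₂     : ∀ s → cells (1 + (k + toℕ s)) ≡ bit (lookup S₂ s)

encodeConstraint-cells : ∀ {k n} (con : Constraint k n) {ys} → Cells ((encodeConstraint con ++ ys) at_) con
encodeConstraint-cells ⟨ ρ , S₁ , S₂ ⟩ {ys} = cellsOf refl
  (λ s → trans (cong (_at toℕ s) (++-assoc (bits S₁) (bits S₂) ys)) (bits-at S₁ s))
  (λ s → trans (cong (_at _) (++-assoc (bits S₁) (bits S₂) ys))
    (trans (bits-skip S₁ (toℕ s)) (bits-at S₂ s)))

cells-cong : ∀ {k n f g} {con : Constraint k n} → (∀ x → g x ≡ f x) → Cells f con → Cells g con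
cells-cong eq (cellsOf a b d) = cellsOf (trans (eq _) a) (λ s → trans (eq _) (b s)) (λ s → trans (eq _) (d s))

encodeConstraint-skip : ∀ {k n} (con : Constraint k n) x {ys} →
  (encodeConstraint con ++ ys) at ((1 + (k + k)) + x) ≡ ys at x
encodeConstraint-skip {k} ⟨ ρ , S₁ , S₂ ⟩ x {ys} = trans
  (cong₂ _at_ (++-assoc (bits S₁) (bits S₂) ys) (+-assoc k k x))
  (trans (bits-skip S₁ (k + x)) (bits-skip S₂ x))

module _ {k n : ℕ} (zs : List ℕ) where

  private
    w = 1 + (k + k)
    code : List (Constraint k n) → List ℕ
    code C = concatMap encodeConstraint C ++ zs

  -- Every constraint fills `w` cells, one for its symbol and k for each of its two sets.
  code-skip : ∀ con C j x → code (con ∷ C) at (suc j * w + x) ≡ code C at (j * w + x)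
  code-skip con C j x = trans
    (cong₂ _at_ (++-assoc (encodeConstraint con) (concatMap encodeConstraint C) zs) (+-assoc w (j * w) x))
    (encodeConstraint-skip con (j * w + x))

  code-head : ∀ con C → Cells (λ x → code (con ∷ C) at x) con
  code-head con C = cells-cong
    (λ x → cong (_at x) (++-assoc (encodeConstraint con) (concatMap encodeConstraint C) zs))
    (encodeConstraint-cells con)

  all-from-code : ∀ {P Q : Constraint k n → Set} C → All Q C →
    (∀ con j → Q con → j < length C → Cells (λ x → code C at (j * w + x)) con → P con) → All P C
  all-from-code []        []       h = []
  all-from-code (con ∷ C) (q ∷ qs) h = h con 0 q (s≤s z≤n) (code-head con C)
    ∷ all-from-code C qs λ con′ j q′ j< cs → h con′ (suc j) q′ (s≤s j<) (cells-cong (code-skip con C j) cs)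

  code-from-all : ∀ {P : Constraint k n → Set} C → All P C → ∀ j → j < length C →
    ∃[ con ] P con × Cells (λ x → code C at (j * w + x)) con
  code-from-all (con ∷ C) (p ∷ ps) zero    _  = con , p , code-head con C
  code-from-all (con ∷ C) (p ∷ ps) (suc j) j< =
    let con′ , p′ , cs = code-from-all C ps j (s≤s⁻¹ j<) in con′ , p′ , cells-cong (code-skip con C j) cs

bit≢0⇒∈ : ∀ {n} {X : Subset n} {i} → bit (lookup X i) ≢ 0 → i ∈ X
bit≢0⇒∈ {X = X} {i} h with lookup X i in eq
... | inside  = lookup⇒[]= i X eq
... | outside = ⊥-elim (h refl)

∈⇒bit≢0 : ∀ {n} {X : Subset n} {i} → i ∈ X → bit (lookup X i) ≢ 0
∈⇒bit≢0 i∈X eq rewrite []=⇒lookup i∈X with eq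
... | ()

related-Δ : ∀ {n} {i j : Fin n} → Related (Δ n) i j → i ≡ j
related-Δ {n} {i} {j} h = sym (x∈⁅y⁆⇒x≡y i (subst (j ∈_) (lookup∘tabulate ⁅_⁆ i) h))

Δ-related : ∀ {n} {i j : Fin n} → i ≡ j → Related (Δ n) i j
Δ-related {n} {i} refl = subst (i ∈_) (sym (lookup∘tabulate ⁅_⁆ i)) (x∈⁅x⁆ i)

related-Δᶜ : ∀ {n} {i j : Fin n} → Related (Δᶜ n) i j → i ≢ j
related-Δᶜ {n} {i} {j} h eq = x∈∁p⇒x∉p (subst (j ∈_) (lookup-map i ∁ (Δ n)) h) (Δ-related eq)

Δᶜ-related : ∀ {n} {i j : Fin n} → i ≢ j → Related (Δᶜ n) i j
Δᶜ-related {n} {i} {j} ne = subst (j ∈_) (sym (lookup-map i ∁ (Δ n))) (x∉p⇒x∈∁p λ h → ne (related-Δ h))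

module Instance {k n} (W : Schema k n) (eqNeq : WSP₃[=,≠] W) where
  open Schema W

  I : List ℕ
  I = encode W

  open Run I hiding (k; n; c)

  related⇒RelN : ∀ {con : Constraint k n} {i j} → EqNeq con → let ρ = Constraint.ρ con in
    Related ρ i j → RelN (symbol ρ) (toℕ i) (toℕ j)
  related⇒RelN {⟨ ρ , _ , _ ⟩} {i} {j} e r with ρ ≟ᴿ Δ n
  ... | yes refl = inj₂ (refl , cong toℕ (related-Δ r))
  ... | no ρ≢Δ with e
  ...   | inj₁ ρ≡Δ  = ⊥-elim (ρ≢Δ ρ≡Δ)
  ...   | inj₂ refl = inj₁ ((λ ()) , λ eq → related-Δᶜ r (toℕ-injective eq))

  RelN⇒related : ∀ {con : Constraint k n} {i j} → EqNeq con → let ρ = Constraint.ρ con in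
    RelN (symbol ρ) (toℕ i) (toℕ j) → Related ρ i j
  RelN⇒related {⟨ ρ , _ , _ ⟩} {i} {j} e r with ρ ≟ᴿ Δ n
  RelN⇒related e (inj₁ (z , _))  | yes refl = ⊥-elim (z refl)
  RelN⇒related e (inj₂ (_ , eq)) | yes refl = Δ-related (toℕ-injective eq)
  RelN⇒related e r               | no ρ≢Δ with e
  RelN⇒related e r               | no ρ≢Δ | inj₁ ρ≡Δ  = ⊥-elim (ρ≢Δ ρ≡Δ)
  RelN⇒related e (inj₁ (_ , ne)) | no ρ≢Δ | inj₂ refl = Δᶜ-related λ eq → ne (cong toℕ eq)
  RelN⇒related e (inj₂ (() , _)) | no ρ≢Δ | inj₂ refl

  module _ (π : Plan k n) (p : ℕ → ℕ) (p≡ : ∀ s → p (toℕ s) ≡ toℕ (π s)) where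

    RelN-at : ∀ ρ {s₁ s₂} → RelN ρ (p (toℕ s₁)) (p (toℕ s₂)) ≡ RelN ρ (toℕ (π s₁)) (toℕ (π s₂))
    RelN-at ρ {s₁} {s₂} = cong₂ (RelN ρ) (p≡ s₁) (p≡ s₂)

    satisfies⇒SatN : ∀ {con q} → EqNeq con → Cells (λ x → I at (q + x)) con → Satisfies π con → SatN p q
    satisfies⇒SatN {⟨ ρ , S₁ , S₂ ⟩} {q} e cs (s₁ , s₂ , s₁∈ , s₂∈ , r) =
      toℕ s₁ , toℕ s₂ , toℕ<n s₁ , toℕ<n s₂
      , subst (_≢ 0) (sym (Cells.at-S₁ cs s₁)) (∈⇒bit≢0 s₁∈)
      , subst (_≢ 0) (sym (Cells.at-S₂ cs s₂)) (∈⇒bit≢0 s₂∈)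
      , subst (λ z → RelN z (p (toℕ s₁)) (p (toℕ s₂)))
          (sym (trans (cong (I at_) (sym (+-identityʳ q))) (Cells.at-symbol cs)))
          (subst (λ A → A) (sym (RelN-at (symbol ρ))) (related⇒RelN {⟨ ρ , S₁ , S₂ ⟩} e r))

    SatN⇒satisfies : ∀ {con q} → EqNeq con → Cells (λ x → I at (q + x)) con → SatN p q → Satisfies π con
    SatN⇒satisfies {⟨ ρ , S₁ , S₂ ⟩} {q} e cs (a , b , a<k , b<k , i₁ , i₂ , r) = s₁ , s₂
      , bit≢0⇒∈ (subst (_≢ 0) (Cells.at-S₁ cs s₁) (subst (λ z → I at (q + (1 + z)) ≢ 0) (sym a≡) i₁))
      , bit≢0⇒∈ (subst (_≢ 0) (Cells.at-S₂ cs s₂) (subst (λ z → I at (q + (1 + (k + z))) ≢ 0) (sym b≡) i₂))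
      , RelN⇒related {⟨ ρ , S₁ , S₂ ⟩} e (subst (λ A → A) (RelN-at (symbol ρ))
          (subst₂ (λ x y → RelN (symbol ρ) (p x) (p y)) (sym a≡) (sym b≡)
            (subst (λ z → RelN z (p a) (p b)) (trans (cong (I at_) (sym (+-identityʳ q))) (Cells.at-symbol cs)) r)))
      where
      s₁ = fromℕ< a<k
      s₂ = fromℕ< b<k
      a≡ = toℕ-fromℕ< a<k
      b≡ = toℕ-fromℕ< b<k

  mayDo-at : ∀ s u → mayDo (toℕ u) (toℕ s) ≡ nz (bit (lookup (lookup A s) u))
  mayDo-at s u = cong nz (encodeRel-at A s u)

  related⇒mayDo : ∀ {s u} → Related A s u → mayDo (toℕ u) (toℕ s) ≡ true
  related⇒mayDo {s} {u} r = trans (mayDo-at s u) (nz-≢0 (∈⇒bit≢0 r))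

  mayDo⇒related : ∀ {s u} → mayDo (toℕ u) (toℕ s) ≡ true → Related A s u
  mayDo⇒related {s} {u} m = bit≢0⇒∈ (nz⁻¹ (trans (sym (mayDo-at s u)) m))

  tail : List ℕ
  tail = encodeRel E

  cells-at : ∀ j x → I at (conAt j + x) ≡ (concatMap encodeConstraint C ++ tail) at (j * (1 + (k + k)) + x)
  cells-at j x = trans (cong (λ z → (encodeRel A ++ (concatMap encodeConstraint C ++ tail)) at z) (+-assoc (k * n) (j * (1 + (k + k))) x))
    (encodeRel-skip A (j * (1 + (k + k)) + x))

  natPlan : Plan k n → ℕ → ℕ
  natPlan π t with t <? k
  ... | yes t<k = toℕ (π (fromℕ< t<k))
  -- An arbitrary value: `ValidN` only looks at steps below k.
  ... | no  _   = 0

  natPlan-toℕ : ∀ π s → natPlan π (toℕ s) ≡ toℕ (π s)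
  natPlan-toℕ π s with toℕ s <? k
  ... | yes h = cong (λ z → toℕ (π z)) (toℕ-injective (toℕ-fromℕ< h))
  ... | no ¬h = ⊥-elim (¬h (toℕ<n s))

  valid⇒ValidN : ∀ π → Valid W π → ValidN (natPlan π)
  valid⇒ValidN π (auth , sat) = auth′ , λ j j<c →
    let con , (e , s) , cs = code-from-all tail C (All.zip (eqNeq , sat)) j j<c in
    satisfies⇒SatN π (natPlan π) (natPlan-toℕ π) {q = conAt j} e (cells-cong (cells-at j) cs) s
    where
    auth′ : AuthN (natPlan π)
    auth′ t t<k = subst (λ z → natPlan π z < n × mayDo (natPlan π z) z ≡ true) (toℕ-fromℕ< t<k)
      (subst (λ z → z < n × mayDo z (toℕ s) ≡ true) (sym (natPlan-toℕ π s)) (toℕ<n (π s) , related⇒mayDo (auth s)))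
      where s = fromℕ< t<k

  validN⇒Valid : ∀ p → ValidN p → Σ[ π ∈ Plan k n ] Valid W π × (∀ s → p (toℕ s) ≡ toℕ (π s))
  validN⇒Valid p (auth , sat) = π
    , ( (λ s → mayDo⇒related (subst (λ z → mayDo z (toℕ s) ≡ true) (p≡ s) (proj₂ (auth (toℕ s) (toℕ<n s)))))
      , all-from-code tail C eqNeq λ con j e j<c cs →
          SatN⇒satisfies π p p≡ {q = conAt j} e (cells-cong (cells-at j) cs) (sat j j<c))
    , p≡
    where
    π : Plan k n
    π s = fromℕ< (proj₁ (auth (toℕ s) (toℕ<n s)))
    p≡ : ∀ s → p (toℕ s) ≡ toℕ (π s)
    p≡ s = sym (toℕ-fromℕ< (proj₁ (auth (toℕ s) (toℕ<n s))))

  -- This yields a plan when there are no constraints, and n ≥ 1 as soon as there is a step, without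
  -- which k n would not bound even constant time.
  someone : ∀ t → t < k → ∃[ u ] u < n × mayDo u t ≡ true
  someone t t<k = let u , r = authorized (fromℕ< t<k) in
    toℕ u , toℕ<n u , subst (λ z → mayDo (toℕ u) z ≡ true) (toℕ-fromℕ< t<k) (related⇒mayDo r)

  answer : ∀ {τ} → Outcome τ → Answer W τ
  answer (inj₁ (res , p , v , m)) = let π , valid , p≡ = validN⇒Valid p v in
    plan π valid res λ s → trans (m (toℕ s) (toℕ<n s)) (p≡ s)
  answer (inj₂ (res , no-plan)) = none (λ (π , v) → no-plan (natPlan π) (valid⇒ValidN π v)) res

  solved-within : Σ[ τ ∈ State ] Σ[ t ∈ ℕ ] (I ⊢ program , initial ⇓ τ ⟨ t ⟩) × Answer W τ
    × (2 ≤ k → t ≤ totalC * (#C * (k ∸ 1) ^ k + k * n))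
  solved-within =
    let τ , t , d , o , time = program-from ((λ _ → 0) ∥ (λ _ _ → 0)) (sim (λ _ → refl) (λ _ _ _ → refl)) ((λ _ _ → refl) , refl) (λ _ → someone)
    in τ , t , d , answer o , λ 2≤k → total-time (time (≤-trans (s≤s z≤n) 2≤k) (1≤n 2≤k)) 2≤k
    where
    1≤n : 2 ≤ k → 1 ≤ n
    1≤n 2≤k = let _ , u<n , _ = someone 0 (≤-trans (s≤s z≤n) 2≤k) in ≤-trans (s≤s z≤n) u<n

-- Neither the program nor its constant depends on the class, so only the bounds have to be
-- compared.
decidable-in-time : ∀ (P : SchemaClass) bound → (∀ {k n} (W : Schema k n) → P W → WSP₃[=,≠] W) →
  (∀ c n k → 2 ≤ k → c * (k ∸ 1) ^ k + k * n ≤ bound c n k) → DecidableInTime P bound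
decidable-in-time P bound sub le = program , totalC , λ {k} {n} W pW →
  let τ , t , d , a , time = Instance.solved-within W (sub W pW) in
  τ , t , d , a , λ 2≤k → ≤-trans (time 2≤k) (*-monoʳ-≤ totalC (le (Schema.#C W) n k 2≤k))

theorem5 : DecidableInTime WSP₂[=,≠] (λ c n k → (k ∸ 1) ^ c * (c * (k ∸ 1) ^ k + k * n))
    × DecidableInTime WSP₃[=,≠] (λ c n k → k ^ (2 * c) * (c * (k ∸ 1) ^ k + k * n))
theorem5 =
    decidable-in-time WSP₂[=,≠] (λ c n k → (k ∸ 1) ^ c * (c * (k ∸ 1) ^ k + k * n)) (λ W → All.map proj₁)
      -- A power of k - 1 is positive here thanks to `2 ≤ k`, so the leading factor only enlarges
      -- the bound.
      (λ { c n (suc (suc k)) _ → m≤n*m _ (suc k ^ c) {{m^n≢0 (suc k) c}} ; c n (suc zero) (s≤s ()) })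
  , decidable-in-time WSP₃[=,≠] (λ c n k → k ^ (2 * c) * (c * (k ∸ 1) ^ k + k * n)) (λ W h → h)
      (λ { c n (suc k) _ → m≤n*m _ (suc k ^ (2 * c)) {{m^n≢0 (suc k) (2 * c)}} })
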